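{- Let $n$ be an odd positive integer and let $Q\subseteq\mathbb{R}^{n-1}$ be the convex hull of all dual degree partitions $(d^*_1,\ldots,d^*_{n-1})$ of simple graphs on $n$ vertices. Then the facet-defining inequalities of $Q$ are the $n$ inequalities \[ n \geq x_1 \geq x_2 \geq \cdots \geq x_{n-1} \geq 0 \] together with the inequality \[ (x_1-x_2)+(x_3-x_4)+\cdots+(x_{n-2}-x_{n-1}) \leq n-1. \] The extreme points of $Q$ are the following $\frac{(n+1)^2}{4}$ points: the $\frac{n+1}{2}$ points \[ \mathbf{a}^{(k)} = (\underbrace{n,\ldots,n}_{2k},\underbrace{0,\ldots,0}_{n-1-2k}), \quad 0\le 2k\le n-1; \] the $\frac{n^2-1}{8}$ points \[ \mathbf{b}^{(k,l)} = (\underbrace{n,\ldots,n}_{2k},\underbrace{n-1,\ldots,n-1}_{2l+1},\underbrace{0,\ldots,0}_{n-2-2k-2l}), \quad 0\le 2k+2l\le n-3; \] and the $\frac{n^2-1}{8}$ points \[ \mathbf{c}^{(k,l)} = (\underbrace{n,\ldots,n}_{2k+1},\underbrace{1,\ldots,1}_{2l+1},\underbrace{0,\ldots,0}_{n-3-2k-2l}), \quad 0\le 2k+2l\le n-3, \] where $k,l$ range over nonnegative integers.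
   Context: All graphs are simple (undirected, no loops, no multiple edges) on the vertex set $\{1,\ldots,n\}$. The degree $d_i$ of vertex $i$ is its number of neighbors; vertices are labeled so that $n-1\ge d_1\ge\cdots\ge d_n\ge 0$, and $\mathbf{d}=(d_1,\ldots,d_n)$ is the degree partition. The dual degree partition of the graph is $\mathbf{d}^*=(d^*_1,\ldots,d^*_n)$ where $d^*_j=|\{i : d_i\ge j\}|$, so $n\ge d^*_1\ge\cdots\ge d^*_n=0$. Since $d^*_n=0$ always, each dual degree partition is regarded as the point $(d^*_1,\ldots,d^*_{n-1})\in\mathbb{R}^{n-1}$ (the last coordinate is suppressed).
   Formalization: Points, convex weights and inequality coefficients are rational, so Q is the rational convex hull in rational (n-1)-space; the facet part is stated for n ≥ 3 (degenerate at n = 1), and the numbers of listed points are not asserted separately. -}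

module Defs where

open import Data.Nat as ℕ using (ℕ; zero; suc; _≡ᵇ_; _<ᵇ_; _≤ᵇ_; _%_)
open import Data.Integer using (+_)
open import Data.Fin using (Fin; toℕ)
import Data.Fin as Fin
open import Data.Bool using (Bool; true; false; if_then_else_)
open import Data.Rational using (ℚ; 0ℚ; 1ℚ; _+_; _*_; _-_; -_; _≤_; _<_; _/_)
open import Data.Product using (Σ; ∃; _×_; _,_)
open import Data.Sum using (_⊎_)
open import Relation.Nullary using (¬_)
open import Relation.Binary.PropositionalEquality using (_≡_)

record Graph (n : ℕ) : Set where
  field
    adj    : Fin n → Fin n → Bool
    sym    : ∀ i j → adj i j ≡ adj j i
    irrefl : ∀ i → adj i i ≡ false
open Graph public

count : ∀ {n} → (Fin n → Bool) → ℕ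
count {zero}  p = zero
count {suc n} p = (if p Fin.zero then 1 else 0) ℕ.+ count (λ i → p (Fin.suc i))

degree : ∀ {n} → Graph n → Fin n → ℕ
degree G i = count (adj G i)

dualDeg : ∀ {n} → Graph n → ℕ → ℕ
dualDeg G j = count (λ i → j ≤ᵇ degree G i)

-- Rational points of ℚ^d  (coordinate x_{i+1} is  x i  for i : Fin d)

Pt : ℕ → Set
Pt d = Fin d → ℚ

ℕ→ℚ : ℕ → ℚ
ℕ→ℚ k = (+ k) / 1

_≐_ : ∀ {d} → Pt d → Pt d → Set
x ≐ y = ∀ i → x i ≡ y i

sumFin : ∀ {k} → (Fin k → ℚ) → ℚ
sumFin {zero}  f = 0ℚ
sumFin {suc k} f = f Fin.zero + sumFin (λ i → f (Fin.suc i))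

dot : ∀ {d} → Pt d → Pt d → ℚ
dot a x = sumFin (λ i → a i * x i)

dualPt : ∀ {n} → Graph n → Pt (n ℕ.∸ 1)
dualPt G i = ℕ→ℚ (dualDeg G (suc (toℕ i)))

Q : (n : ℕ) → Pt (n ℕ.∸ 1) → Set
Q n x = Σ ℕ λ k → Σ (Fin k → ℚ) λ w → Σ (Fin k → Graph n) λ g →
          (∀ i → 0ℚ ≤ w i) × (sumFin w ≡ 1ℚ) ×
          (∀ j → x j ≡ sumFin (λ i → w i * dualPt (g i) j))

AffIndep : ∀ {d k} → (Fin k → Pt d) → Set
AffIndep {d} {k} p = ∀ (λ' : Fin k → ℚ) → sumFin λ' ≡ 0ℚ →
  (∀ j → sumFin (λ i → λ' i * p i j) ≡ 0ℚ) → ∀ i → λ' i ≡ 0ℚ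

HasAffIndep : ∀ {d} → (Pt d → Set) → ℕ → Set
HasAffIndep {d} S k = Σ (Fin k → Pt d) λ p → (∀ i → S (p i)) × AffIndep p

AffDim : ∀ {d} → (Pt d → Set) → ℕ → Set
AffDim S r = HasAffIndep S (suc r) × ¬ HasAffIndep S (suc (suc r))

Valid : ∀ {d} → (Pt d → Set) → Pt d → ℚ → Set
Valid S a b = ∀ x → S x → dot a x ≤ b

Face : ∀ {d} → (Pt d → Set) → Pt d → ℚ → Pt d → Set
Face S a b x = S x × (dot a x ≡ b)

IsFacetIneq : ∀ {d} → (Pt d → Set) → Pt d → ℚ → Set
IsFacetIneq S a b = Valid S a b × (Σ ℕ λ r → AffDim S (suc r) × AffDim (Face S a b) r)

IsExtreme : ∀ {d} → (Pt d → Set) → Pt d → Set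
IsExtreme S x = S x × (∀ y z t → S y → S z → 0ℚ < t → t < 1ℚ →
  (∀ i → x i ≡ t * y i + (1ℚ - t) * z i) → y ≐ z)

-- The data of Theorem 2.2, for n = 2m+1 (so the dimension n-1 is 2m)

-- the n + 1 inequalities (coordinates 0-based: index i is x_{i+1})
data IneqIx (m : ℕ) : Set where
  upper  : IneqIx m                            -- n ≥ x_1
  mono   : (t : ℕ) → suc (suc t) ℕ.≤ 2 ℕ.* m → IneqIx m
                                               -- x_{t+1} ≥ x_{t+2}
  nonneg : IneqIx m                            -- x_{n-1} ≥ 0
  alt    : IneqIx m                            -- (x1-x2)+…+(x_{n-2}-x_{n-1}) ≤ n-1

ineqCoef : ∀ m → IneqIx m → Pt (2 ℕ.* m)
ineqCoef m upper      i = if toℕ i ≡ᵇ 0 then 1ℚ else 0ℚ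
ineqCoef m (mono t _) i =
  if toℕ i ≡ᵇ suc t then 1ℚ else (if toℕ i ≡ᵇ t then - 1ℚ else 0ℚ)
ineqCoef m nonneg     i = if suc (toℕ i) ≡ᵇ 2 ℕ.* m then - 1ℚ else 0ℚ
ineqCoef m alt        i = if toℕ i % 2 ≡ᵇ 0 then 1ℚ else - 1ℚ

ineqRhs : ∀ m → IneqIx m → ℚ
ineqRhs m upper      = ℕ→ℚ (suc (2 ℕ.* m))
ineqRhs m (mono t _) = 0ℚ
ineqRhs m nonneg     = 0ℚ
ineqRhs m alt        = ℕ→ℚ (2 ℕ.* m)

ptA : ∀ m → ℕ → Pt (2 ℕ.* m)
ptA m k i = if toℕ i <ᵇ 2 ℕ.* k then ℕ→ℚ (suc (2 ℕ.* m)) else 0ℚ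

ptB : ∀ m → ℕ → ℕ → Pt (2 ℕ.* m)
ptB m k l i =
  if toℕ i <ᵇ 2 ℕ.* k then ℕ→ℚ (suc (2 ℕ.* m))
  else (if toℕ i <ᵇ 2 ℕ.* k ℕ.+ 2 ℕ.* l ℕ.+ 1 then ℕ→ℚ (2 ℕ.* m) else 0ℚ)

ptC : ∀ m → ℕ → ℕ → Pt (2 ℕ.* m)
ptC m k l i =
  if toℕ i <ᵇ 2 ℕ.* k ℕ.+ 1 then ℕ→ℚ (suc (2 ℕ.* m))
  else (if toℕ i <ᵇ 2 ℕ.* k ℕ.+ 2 ℕ.* l ℕ.+ 2 then 1ℚ else 0ℚ)

-- x is one of the listed points a^(k) (2k ≤ n-1), b^(k,l), c^(k,l) (2k+2l ≤ n-3)
Listed : ∀ m → Pt (2 ℕ.* m) → Set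
Listed m x =
  (Σ ℕ λ k → (k ℕ.≤ m) × (x ≐ ptA m k)) ⊎
  ((Σ ℕ λ k → Σ ℕ λ l → (suc (k ℕ.+ l) ℕ.≤ m) × (x ≐ ptB m k l)) ⊎
   (Σ ℕ λ k → Σ ℕ λ l → (suc (k ℕ.+ l) ℕ.≤ m) × (x ≐ ptC m k l)))

{-# OPTIONS --safe #-}
module Submission where

-- In the coordinates y_0 = n - x_1, y_t = x_t - x_(t+1), y_(n-1) = x_(n-1) the first n inequalities
-- cut out a simplex with vertices n u_t, where u_t = (1,...,1,0,...,0) with t ones, and the last one
-- says that the sum O of the odd y_t is at most n - 1. For a graph O counts the vertices of odd
-- degree, an even number, hence at most n - 1 as n is odd. The hyperplane O = n - 1 truncates the
-- simplex at its odd vertices; what remains has the vertices n u_s with s even and the points W(D,s)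
-- on the edges joining an odd D to an even s, and each is realized by a graph with one vertex of
-- degree s and all others of degree D (a circulant graph, modified along a perfect matching if D is
-- odd). An inequality valid on the polytope is, by an explicit LP duality, a nonnegative combination
-- of the n + 1 listed ones; if two coefficients are positive, its face lies in two distinct facet
-- hyperplanes and is too small to be a facet.

open import Defs
open import Data.Nat using (ℕ; suc; _*_; _≤_)
open import Data.Rational using (ℚ; 0ℚ; _<_) renaming (_*_ to _*ℚ_; _≤_ to _≤ℚ_)
open import Data.Product using (Σ; _×_)
open import Relation.Binary.PropositionalEquality using (_≡_)
open import Function.Bundles using (_⇔_)

open import Data.Bool using (Bool; true; false; if_then_else_; not; _∧_; _xor_)
open import Data.Empty using (⊥; ⊥-elim)
open import Data.Fin using (Fin; zero; suc; toℕ; punchIn)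
open import Data.Nat using (zero; _+_; z≤n; s≤s)
open import Data.Product using (_,_; proj₁; proj₂)
open import Data.Rational using (1ℚ; ½; 1/_) renaming (_+_ to _+ℚ_; _-_ to _-ℚ_; -_ to ⊖_)
open import Data.Rational.Solver using (module +-*-Solver)
open import Data.Sum using (_⊎_; inj₁; inj₂)
open import Data.Unit using (tt)
open import Function.Bundles using (mk⇔)
open import Relation.Binary.Definitions using (tri<; tri≈; tri>)
open import Relation.Binary.PropositionalEquality using (_≢_; refl; cong; cong₂; subst; trans; module ≡-Reasoning)
open import Relation.Nullary using (¬_; Dec; yes; no)
open import Relation.Nullary.Decidable using (dec-true; dec-false)
open +-*-Solver using (solve; _:=_; _:+_; _:*_; _:-_; :-_; con)
import Algebra.Bundles as Bundles
import Algebra.Properties.Semiring.Sum as SemiringSum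
import Data.Bool as Bool
import Data.Bool.Properties as Bool
import Data.Fin as Fin
import Data.Fin.Properties as Fin
import Data.Integer as ℤ
import Data.Integer.Properties as ℤ
import Data.Nat as ℕ
import Data.Nat.Properties as ℕ
import Data.Nat.Solver
import Data.Rational as ℚ
import Data.Rational.Properties as ℚ
import Relation.Binary.PropositionalEquality as ≡
import Relation.Nullary

-- Rational arithmetic

-- The dual degree partition of a graph is the sum of u_(deg v) over its vertices v, so y_t counts
-- the vertices of degree exactly t; this is why degree parity governs the one extra inequality. The
-- y_t always sum to n, hence are n times barycentric coordinates, and almost every argument is
-- carried out in them: a point is recovered from its gaps by telescoping. The obstacle is that
-- dimension is defined through affinely independent points, so every facet claim needs two kinds of
-- evidence. Lower bounds come from explicit points, almost all of them detected by a gap that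
-- vanishes at the other points. Upper bounds come from elimination: d + 2 points of a d-dimensional
-- space are affinely dependent, which is contradicted by adjoining points that lie off the
-- hyperplanes in question. Convex combinations are treated as conical ones with a recorded total
-- weight, so that the double sums of the vertex decomposition can be added and rescaled freely,
-- with a single division at the end.

private variable
  N d : ℕ

*-nonneg : ∀ {p q} → 0ℚ ≤ℚ p → 0ℚ ≤ℚ q → 0ℚ ≤ℚ p *ℚ q
*-nonneg {p} {q} 0≤p 0≤q = ℚ.nonNegative⁻¹ (p *ℚ q)
  {{ℚ.nonNeg*nonNeg⇒nonNeg p {{ℚ.nonNegative 0≤p}} q {{ℚ.nonNegative 0≤q}}}}

*-pos : ∀ {p q} → 0ℚ < p → 0ℚ < q → 0ℚ < p *ℚ q
*-pos {p} {q} 0<p 0<q = ℚ.positive⁻¹ (p *ℚ q)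
  {{ℚ.pos*pos⇒pos p {{ℚ.positive 0<p}} q {{ℚ.positive 0<q}}}}

+-nonneg : ∀ {p q} → 0ℚ ≤ℚ p → 0ℚ ≤ℚ q → 0ℚ ≤ℚ p +ℚ q
+-nonneg = ℚ.+-mono-≤

+-pos-nonneg : ∀ {p q} → 0ℚ < p → 0ℚ ≤ℚ q → 0ℚ < p +ℚ q
+-pos-nonneg = ℚ.+-mono-<-≤

diff-nonneg : ∀ {p q} → p ≤ℚ q → 0ℚ ≤ℚ q -ℚ p
diff-nonneg {p} {q} p≤q = subst (_≤ℚ q -ℚ p) (ℚ.+-inverseʳ p) (ℚ.+-monoˡ-≤ (⊖ p) p≤q)

sub-add : ∀ q p → (q -ℚ p) +ℚ p ≡ q
sub-add = solve 2 (λ q p → (q :- p) :+ p := q) refl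

diff-nonneg⁻¹ : ∀ {q p} → 0ℚ ≤ℚ q -ℚ p → p ≤ℚ q
diff-nonneg⁻¹ {q} {p} h = ≡.subst₂ _≤ℚ_ (ℚ.+-identityˡ p) (sub-add q p) (ℚ.+-monoˡ-≤ p h)

diff-pos : ∀ {p q} → p < q → 0ℚ < q -ℚ p
diff-pos {p} {q} p<q = subst (_< q -ℚ p) (ℚ.+-inverseʳ p) (ℚ.+-monoˡ-< (⊖ p) p<q)

diff≡0 : ∀ {q p} → q -ℚ p ≡ 0ℚ → q ≡ p
diff≡0 {q} {p} h = trans (≡.sym (sub-add q p)) (trans (cong (_+ℚ p) h) (ℚ.+-identityˡ p))

0≤∧≢0⇒0< : ∀ {p} → 0ℚ ≤ℚ p → p ≢ 0ℚ → 0ℚ < p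
0≤∧≢0⇒0< {p} 0≤p p≢0 with ℚ.<-cmp 0ℚ p
... | tri< 0<p _ _ = 0<p
... | tri≈ _ 0≡p _ = ⊥-elim (p≢0 (≡.sym 0≡p))
... | tri> 0≮p _ p<0 = ⊥-elim (ℚ.<-irrefl refl (ℚ.<-≤-trans p<0 0≤p))

0≤⇒≡0⊎0< : ∀ {p} → 0ℚ ≤ℚ p → p ≡ 0ℚ ⊎ 0ℚ < p
0≤⇒≡0⊎0< {p} 0≤p with p ℚ.≟ 0ℚ
... | yes p≡0 = inj₁ p≡0
... | no p≢0 = inj₂ (0≤∧≢0⇒0< 0≤p p≢0)

0<⇒≢0 : ∀ {p} → 0ℚ < p → p ≢ 0ℚ
0<⇒≢0 0<p p≡0 = ℚ.<⇒≢ 0<p (≡.sym p≡0)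

recip : ∀ {p} → 0ℚ < p → Σ ℚ λ r → 0ℚ < r × r *ℚ p ≡ 1ℚ
recip {p} 0<p = 1/ p , ℚ.positive⁻¹ (1/ p) {{ℚ.1/pos⇒pos p}} , ℚ.*-inverseˡ p
  where
  instance
    p-pos = ℚ.positive 0<p
    p-nonZero = ℚ.pos⇒nonZero p

p*q≡0⇒q≡0 : ∀ {p q} → p ≢ 0ℚ → p *ℚ q ≡ 0ℚ → q ≡ 0ℚ
p*q≡0⇒q≡0 {p} {q} p≢0 pq≡0 = begin
  q                    ≡⟨ ℚ.*-identityˡ q ⟨
  1ℚ *ℚ q              ≡⟨ cong (_*ℚ q) (ℚ.*-inverseˡ p) ⟨
  1/ p *ℚ p *ℚ q       ≡⟨ ℚ.*-assoc (1/ p) p q ⟩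
  1/ p *ℚ (p *ℚ q)     ≡⟨ cong (1/ p *ℚ_) pq≡0 ⟩
  1/ p *ℚ 0ℚ           ≡⟨ ℚ.*-zeroʳ (1/ p) ⟩
  0ℚ                   ∎
  where
  open ≡-Reasoning
  instance p-nonZero = ℚ.≢-nonZero p≢0

p+q≡0⇒p≡0 : ∀ {p q} → 0ℚ ≤ℚ p → 0ℚ ≤ℚ q → p +ℚ q ≡ 0ℚ → p ≡ 0ℚ
p+q≡0⇒p≡0 {p} {q} 0≤p 0≤q p+q≡0 with 0≤⇒≡0⊎0< 0≤p
... | inj₁ p≡0 = p≡0
... | inj₂ 0<p = ⊥-elim (0<⇒≢0 (+-pos-nonneg 0<p 0≤q) p+q≡0)

p+q≡0⇒q≡0 : ∀ {p q} → 0ℚ ≤ℚ p → 0ℚ ≤ℚ q → p +ℚ q ≡ 0ℚ → q ≡ 0ℚ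
p+q≡0⇒q≡0 {p} {q} 0≤p 0≤q p+q≡0 = p+q≡0⇒p≡0 0≤q 0≤p (trans (ℚ.+-comm q p) p+q≡0)

-- `ℕ→ℚ a` is a fraction brought to lowest terms by a gcd, which is stuck on a variable `a`. The
-- local `m` is the reduced form written out; sums of such forms compute up to factors 1.
ℕ→ℚ-homo-+ : ∀ a b → ℕ→ℚ (a + b) ≡ ℕ→ℚ a +ℚ ℕ→ℚ b
ℕ→ℚ-homo-+ a b = ≡.sym (begin
  ℕ→ℚ a +ℚ ℕ→ℚ b       ≡⟨ cong₂ _+ℚ_ (mk a) (mk b) ⟩
  m a +ℚ m b           ≡⟨ cong₂ (λ i j → (i ℤ.+ j) ℚ./ 1) (ℤ.*-identityʳ (ℤ.+ a)) (ℤ.*-identityʳ (ℤ.+ b)) ⟩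
  ℕ→ℚ (a + b)          ∎)
  where
  open ≡-Reasoning
  open import Data.Nat.Coprimality using (1-coprimeTo) renaming (sym to coprime-sym)
  m : ℕ → ℚ
  m a = ℚ.mkℚ (ℤ.+ a) 0 (coprime-sym (1-coprimeTo a))
  mk : ∀ a → ℕ→ℚ a ≡ m a
  mk a = ℚ.↥p/↧p≡p (m a)

ℕ→ℚ-nonneg : ∀ a → 0ℚ ≤ℚ ℕ→ℚ a
ℕ→ℚ-nonneg zero = ℚ.≤-refl
ℕ→ℚ-nonneg (suc a) = subst (0ℚ ≤ℚ_) (≡.sym (ℕ→ℚ-homo-+ 1 a)) (+-nonneg (ℚ.nonNegative⁻¹ 1ℚ) (ℕ→ℚ-nonneg a))

ℕ→ℚ-suc : ∀ a → ℕ→ℚ (suc a) ≡ ℕ→ℚ a +ℚ 1ℚ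
ℕ→ℚ-suc a = trans (ℕ→ℚ-homo-+ 1 a) (ℚ.+-comm 1ℚ (ℕ→ℚ a))

ℕ→ℚ-mono : ∀ {a b} → a ≤ b → ℕ→ℚ a ≤ℚ ℕ→ℚ b
ℕ→ℚ-mono {a} {b} a≤b = subst (ℕ→ℚ a ≤ℚ_)
  (trans (≡.sym (ℕ→ℚ-homo-+ a (b ℕ.∸ a))) (cong ℕ→ℚ (ℕ.m+[n∸m]≡n a≤b)))
  (subst (_≤ℚ ℕ→ℚ a +ℚ ℕ→ℚ (b ℕ.∸ a)) (ℚ.+-identityʳ (ℕ→ℚ a)) (ℚ.+-monoʳ-≤ (ℕ→ℚ a) (ℕ→ℚ-nonneg (b ℕ.∸ a))))

ℕ→ℚ-pos : ∀ {a} → 1 ≤ a → 0ℚ < ℕ→ℚ a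
ℕ→ℚ-pos 1≤a = ℚ.<-≤-trans (ℚ.positive⁻¹ 1ℚ) (ℕ→ℚ-mono 1≤a)

-- Finite sums

private module ΣL = SemiringSum (Bundles.CommutativeRing.semiring ℚ.+-*-commutativeRing)

sumFin≡sum : (f : Fin N → ℚ) → sumFin f ≡ ΣL.sum f
sumFin≡sum {zero} f = refl
sumFin≡sum {suc N} f = cong (f zero +ℚ_) (sumFin≡sum (λ i → f (suc i)))

sum-cong : {f g : Fin N → ℚ} → (∀ i → f i ≡ g i) → sumFin f ≡ sumFin g
sum-cong {zero} h = refl
sum-cong {suc N} h = cong₂ _+ℚ_ (h zero) (sum-cong {N} (λ i → h (suc i)))

sum-+ : (f g : Fin N → ℚ) → sumFin (λ i → f i +ℚ g i) ≡ sumFin f +ℚ sumFin g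
sum-+ f g = trans (sumFin≡sum (λ i → f i +ℚ g i))
  (trans (ΣL.∑-distrib-+ f g) (≡.sym (cong₂ _+ℚ_ (sumFin≡sum f) (sumFin≡sum g))))

sum-*ˡ : (c : ℚ) (f : Fin N → ℚ) → sumFin (λ i → c *ℚ f i) ≡ c *ℚ sumFin f
sum-*ˡ c f = trans (sumFin≡sum (λ i → c *ℚ f i))
  (trans (≡.sym (ΣL.*-distribˡ-sum c f)) (cong (c *ℚ_) (≡.sym (sumFin≡sum f))))

sum-*ʳ : (f : Fin N → ℚ) (c : ℚ) → sumFin (λ i → f i *ℚ c) ≡ sumFin f *ℚ c
sum-*ʳ {N} f c = trans (sum-cong {N} (λ i → ℚ.*-comm (f i) c)) (trans (sum-*ˡ c f) (ℚ.*-comm c (sumFin f)))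

sum-sub : (f g : Fin N → ℚ) → sumFin (λ i → f i -ℚ g i) ≡ sumFin f -ℚ sumFin g
sum-sub {zero} f g = refl
sum-sub {suc N} f g = trans (cong (f zero -ℚ g zero +ℚ_) (sum-sub (λ i → f (suc i)) (λ i → g (suc i))))
  (solve 4 (λ a b c d → a :- b :+ (c :- d) := a :+ c :- (b :+ d)) refl
    (f zero) (g zero) (sumFin (λ i → f (suc i))) (sumFin (λ i → g (suc i))))

sum-swap : (f : Fin N → Fin d → ℚ) →
  sumFin (λ i → sumFin (f i)) ≡ sumFin (λ j → sumFin (λ i → f i j))
sum-swap f = trans (flat f) (trans (ΣL.∑-comm f) (≡.sym (flat (λ j i → f i j))))
  where
  flat : (f : Fin N → Fin d → ℚ) → sumFin (λ i → sumFin (f i)) ≡ ΣL.sum (λ i → ΣL.sum (f i))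
  flat {N} f = trans (sum-cong {N} (λ i → sumFin≡sum (f i))) (sumFin≡sum (λ i → ΣL.sum (f i)))

sum-punchIn : (f : Fin (suc N) → ℚ) (i : Fin (suc N)) →
  sumFin f ≡ f i +ℚ sumFin (λ j → f (punchIn i j))
sum-punchIn f i = trans (sumFin≡sum f) (trans (ΣL.sum-remove {i = i} f)
  (cong (f i +ℚ_) (≡.sym (sumFin≡sum (λ j → f (punchIn i j))))))

sum-zero : {f : Fin N → ℚ} → (∀ i → f i ≡ 0ℚ) → sumFin f ≡ 0ℚ
sum-zero {zero} h = refl
sum-zero {suc N} h = cong₂ _+ℚ_ (h zero) (sum-zero {N} (λ i → h (suc i)))

sum-single : (f : Fin N → ℚ) (i : Fin N) → (∀ j → j ≢ i → f j ≡ 0ℚ) → sumFin f ≡ f i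
sum-single {suc N} f i h = trans (sum-punchIn f i) (trans
  (cong (f i +ℚ_) (sum-zero {N} (λ j → h (punchIn i j) (Fin.punchInᵢ≢i i j)))) (ℚ.+-identityʳ (f i)))

sum-nonneg : {f : Fin N → ℚ} → (∀ i → 0ℚ ≤ℚ f i) → 0ℚ ≤ℚ sumFin f
sum-nonneg {zero} h = ℚ.≤-refl
sum-nonneg {suc N} h = +-nonneg (h zero) (sum-nonneg {N} (λ i → h (suc i)))

sum≡0⇒≡0 : {f : Fin N → ℚ} → (∀ i → 0ℚ ≤ℚ f i) → sumFin f ≡ 0ℚ → ∀ i → f i ≡ 0ℚ
sum≡0⇒≡0 {suc N} h s zero = p+q≡0⇒p≡0 (h zero) (sum-nonneg {N} (λ i → h (suc i))) s
sum≡0⇒≡0 {suc N} h s (suc i) =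
  sum≡0⇒≡0 {N} (λ i → h (suc i)) (p+q≡0⇒q≡0 (h zero) (sum-nonneg {N} (λ i → h (suc i))) s) i

-- Affine dependence

comb : (Fin N → ℚ) → (Fin N → Pt d) → Pt d
comb w p j = sumFin (λ i → w i *ℚ p i j)

dot-congʳ : (a : Pt d) {x y : Pt d} → x ≐ y → dot a x ≡ dot a y
dot-congʳ {d} a x≐y = sum-cong {d} (λ i → cong (a i *ℚ_) (x≐y i))

dot-congˡ : {a b : Pt d} (x : Pt d) → a ≐ b → dot a x ≡ dot b x
dot-congˡ {d} x a≐b = sum-cong {d} (λ i → cong (_*ℚ x i) (a≐b i))

dot-zeroʳ : (a : Pt d) → dot a (λ _ → 0ℚ) ≡ 0ℚ
dot-zeroʳ {d} a = sum-zero {d} (λ i → ℚ.*-zeroʳ (a i))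

dot-comb : (a : Pt d) (w : Fin N → ℚ) (p : Fin N → Pt d) →
  dot a (comb w p) ≡ sumFin (λ i → w i *ℚ dot a (p i))
dot-comb {d} {N} a w p = begin
  sumFin (λ j → a j *ℚ sumFin (λ i → w i *ℚ p i j))
    ≡⟨ sum-cong {d} (λ j → ≡.sym (sum-*ˡ (a j) (λ i → w i *ℚ p i j))) ⟩
  sumFin (λ j → sumFin (λ i → a j *ℚ (w i *ℚ p i j)))
    ≡⟨ sum-swap (λ j i → a j *ℚ (w i *ℚ p i j)) ⟩
  sumFin (λ i → sumFin (λ j → a j *ℚ (w i *ℚ p i j)))
    ≡⟨ sum-cong {N} (λ i → trans
         (sum-cong {d} (λ j → solve 3 (λ a w x → a :* (w :* x) := w :* (a :* x)) refl (a j) (w i) (p i j)))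
         (sum-*ˡ (w i) (λ j → a j *ℚ p i j))) ⟩
  sumFin (λ i → w i *ℚ dot a (p i)) ∎
  where open ≡-Reasoning

-- The coefficients are kept in the shape of a slack, so that gaps, the alternating form and the
-- slacks of inequalities all pass through the same lemmas.
Affine : (Pt d → ℚ) → Set
Affine {d} F = Σ (Pt d) λ a → Σ ℚ λ b → ∀ x → F x ≡ b -ℚ dot a x

Affine-cong : {F G : Pt d → ℚ} → (∀ x → F x ≡ G x) → Affine G → Affine F
Affine-cong F≡G (a , b , h) = a , b , λ x → trans (F≡G x) (h x)

affine-comb : (a : Pt d) (b : ℚ) (w : Fin N → ℚ) (p : Fin N → Pt d) →
  sumFin (λ i → w i *ℚ (b -ℚ dot a (p i))) ≡ sumFin w *ℚ b -ℚ dot a (comb w p)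
affine-comb {d} {N} a b w p = begin
  sumFin (λ i → w i *ℚ (b -ℚ dot a (p i)))
    ≡⟨ sum-cong {N} (λ i → solve 3 (λ w b s → w :* (b :- s) := w :* b :- w :* s) refl (w i) b (dot a (p i))) ⟩
  sumFin (λ i → w i *ℚ b -ℚ w i *ℚ dot a (p i))
    ≡⟨ sum-sub (λ i → w i *ℚ b) (λ i → w i *ℚ dot a (p i)) ⟩
  sumFin (λ i → w i *ℚ b) -ℚ sumFin (λ i → w i *ℚ dot a (p i))
    ≡⟨ cong₂ _-ℚ_ (sum-*ʳ w b) (≡.sym (dot-comb a w p)) ⟩
  sumFin w *ℚ b -ℚ dot a (comb w p) ∎
  where open ≡-Reasoning

affine-combination : {F : Pt d → ℚ} → Affine F → (w : Fin N → ℚ) (p : Fin N → Pt d) (x : Pt d) →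
  sumFin w ≡ 1ℚ → (∀ j → x j ≡ comb w p j) → F x ≡ sumFin (λ i → w i *ℚ F (p i))
affine-combination {d} {N} {F} (a , b , h) w p x Σw≡1 x≐ = begin
  F x                                        ≡⟨ h x ⟩
  b -ℚ dot a x                               ≡⟨ cong₂ _-ℚ_ (≡.sym (ℚ.*-identityˡ b)) (dot-congʳ a x≐) ⟩
  1ℚ *ℚ b -ℚ dot a (comb w p)                ≡⟨ cong (λ s → s *ℚ b -ℚ dot a (comb w p)) Σw≡1 ⟨
  sumFin w *ℚ b -ℚ dot a (comb w p)          ≡⟨ affine-comb a b w p ⟨
  sumFin (λ i → w i *ℚ (b -ℚ dot a (p i)))   ≡⟨ sum-cong {N} (λ i → cong (w i *ℚ_) (≡.sym (h (p i)))) ⟩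
  sumFin (λ i → w i *ℚ F (p i))              ∎
  where open ≡-Reasoning

affine-dependence : {F : Pt d → ℚ} → Affine F → (w : Fin N → ℚ) (p : Fin N → Pt d) →
  sumFin w ≡ 0ℚ → (∀ j → comb w p j ≡ 0ℚ) → sumFin (λ i → w i *ℚ F (p i)) ≡ 0ℚ
affine-dependence {d} {N} {F} (a , b , h) w p Σw≡0 Σwp≡0 = begin
  sumFin (λ i → w i *ℚ F (p i))              ≡⟨ sum-cong {N} (λ i → cong (w i *ℚ_) (h (p i))) ⟩
  sumFin (λ i → w i *ℚ (b -ℚ dot a (p i)))   ≡⟨ affine-comb a b w p ⟩
  sumFin w *ℚ b -ℚ dot a (comb w p)          ≡⟨ cong₂ (λ s t → s *ℚ b -ℚ t) Σw≡0 (trans (dot-congʳ a Σwp≡0) (dot-zeroʳ a)) ⟩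
  0ℚ *ℚ b -ℚ 0ℚ                              ≡⟨ cong (_-ℚ 0ℚ) (ℚ.*-zeroˡ b) ⟩
  0ℚ                                         ∎
  where open ≡-Reasoning

-- Fraction-free Gaussian elimination. If the first column vanishes, one row gets weight 0 and
-- induction handles the rest. Otherwise a row `p` with nonzero pivot clears that column from the
-- other rows; a dependence `v` of the cleared rows lifts to the weights `piv *ℚ v` on them and
-- `⊖ s` on row `p`, where `s` collects what was subtracted.
linear-dependence : ∀ N (M : Fin (suc N) → Fin N → ℚ) →
  Σ (Fin (suc N) → ℚ) λ w → (Σ (Fin (suc N)) λ i → w i ≢ 0ℚ) × (∀ j → sumFin (λ i → w i *ℚ M i j) ≡ 0ℚ)
linear-dependence zero M = (λ _ → 1ℚ) , (zero , ℚ.1≢0) , λ ()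
linear-dependence (suc N) M with Fin.any? (λ i → Relation.Nullary.¬? (M i zero ℚ.≟ 0ℚ))
... | no all0 = w , (suc (proj₁ nz) , proj₂ nz) , dep
  where
  IH = linear-dependence N (λ i j → M (suc i) (suc j))
  nz = proj₁ (proj₂ IH)
  w : Fin (suc (suc N)) → ℚ
  w zero = 0ℚ
  w (suc i) = proj₁ IH i
  M0 : ∀ i → M i zero ≡ 0ℚ
  M0 i with M i zero ℚ.≟ 0ℚ
  ... | yes e = e
  ... | no ne = ⊥-elim (all0 (i , ne))
  dep : ∀ j → sumFin (λ i → w i *ℚ M i j) ≡ 0ℚ
  dep zero = sum-zero {suc (suc N)} (λ i → trans (cong (w i *ℚ_) (M0 i)) (ℚ.*-zeroʳ (w i)))
  dep (suc j) = trans (cong₂ _+ℚ_ (ℚ.*-zeroˡ (M zero (suc j))) (proj₂ (proj₂ IH) j)) (ℚ.+-identityˡ 0ℚ)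
... | yes (p , Mp≢0) = w , (punchIn p (proj₁ nz) , w-nz) , dep
  where
  open ≡-Reasoning
  piv = M p zero
  row : Fin (suc N) → Fin (suc N) → ℚ
  row i = M (punchIn p i)
  IH = linear-dependence N (λ i j → piv *ℚ row i (suc j) -ℚ row i zero *ℚ M p (suc j))
  v = proj₁ IH
  nz = proj₁ (proj₂ IH)
  s = sumFin (λ i → v i *ℚ row i zero)
  w : Fin (suc (suc N)) → ℚ
  w i with p Fin.≟ i
  ... | yes _ = ⊖ s
  ... | no p≢i = piv *ℚ v (Fin.punchOut p≢i)
  w-p : w p ≡ ⊖ s
  w-p with p Fin.≟ p
  ... | yes _ = refl
  ... | no p≢p = ⊥-elim (p≢p refl)
  w-row : ∀ i → w (punchIn p i) ≡ piv *ℚ v i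
  w-row i with p Fin.≟ punchIn p i
  ... | yes e = ⊥-elim (Fin.punchInᵢ≢i p i (≡.sym e))
  ... | no p≢ = cong (λ k → piv *ℚ v k) (trans (Fin.punchOut-cong p refl) (Fin.punchOut-punchIn p))
  w-nz : w (punchIn p (proj₁ nz)) ≢ 0ℚ
  w-nz e = proj₂ nz (p*q≡0⇒q≡0 Mp≢0 (trans (≡.sym (w-row (proj₁ nz))) e))
  split : ∀ j → sumFin (λ i → w i *ℚ M i j) ≡ ⊖ s *ℚ M p j +ℚ piv *ℚ sumFin (λ i → v i *ℚ row i j)
  split j = begin
    sumFin (λ i → w i *ℚ M i j)
      ≡⟨ sum-punchIn (λ i → w i *ℚ M i j) p ⟩
    w p *ℚ M p j +ℚ sumFin (λ i → w (punchIn p i) *ℚ row i j)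
      ≡⟨ cong₂ _+ℚ_ (cong (_*ℚ M p j) w-p) (sum-cong {suc N} (λ i →
           trans (cong (_*ℚ row i j) (w-row i)) (ℚ.*-assoc piv (v i) (row i j)))) ⟩
    ⊖ s *ℚ M p j +ℚ sumFin (λ i → piv *ℚ (v i *ℚ row i j))
      ≡⟨ cong (⊖ s *ℚ M p j +ℚ_) (sum-*ˡ piv (λ i → v i *ℚ row i j)) ⟩
    ⊖ s *ℚ M p j +ℚ piv *ℚ sumFin (λ i → v i *ℚ row i j) ∎
  dep : ∀ j → sumFin (λ i → w i *ℚ M i j) ≡ 0ℚ
  dep zero = trans (split zero) (solve 2 (λ s x → :- s :* x :+ x :* s := con 0ℚ) refl s piv)
  dep (suc j) = begin
    sumFin (λ i → w i *ℚ M i (suc j))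
      ≡⟨ split (suc j) ⟩
    ⊖ s *ℚ m +ℚ piv *ℚ t
      ≡⟨ solve 3 (λ s m pt → :- s :* m :+ pt := pt :- s :* m) refl s m (piv *ℚ t) ⟩
    piv *ℚ t -ℚ s *ℚ m
      ≡⟨ cong₂ _-ℚ_ (≡.sym (sum-*ˡ piv (λ i → v i *ℚ row i (suc j)))) (≡.sym (sum-*ʳ (λ i → v i *ℚ row i zero) m)) ⟩
    sumFin (λ i → piv *ℚ (v i *ℚ row i (suc j))) -ℚ sumFin (λ i → v i *ℚ row i zero *ℚ m)
      ≡⟨ sum-sub (λ i → piv *ℚ (v i *ℚ row i (suc j))) (λ i → v i *ℚ row i zero *ℚ m) ⟨
    sumFin (λ i → piv *ℚ (v i *ℚ row i (suc j)) -ℚ v i *ℚ row i zero *ℚ m)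
      ≡⟨ sum-cong {suc N} (λ i → solve 5 (λ c v x y m → c :* (v :* x) :- v :* y :* m := v :* (c :* x :- y :* m)) refl
           piv (v i) (row i (suc j)) (row i zero) m) ⟩
    sumFin (λ i → v i *ℚ (piv *ℚ row i (suc j) -ℚ row i zero *ℚ m))
      ≡⟨ proj₂ (proj₂ IH) j ⟩
    0ℚ ∎
    where
    m = M p (suc j)
    t = sumFin (λ i → v i *ℚ row i (suc j))

-- A prepended coordinate 1 turns an affine dependence into a linear one, among d + 2 vectors with d
-- + 1 entries.
¬AffIndep-excess : (p : Fin (suc (suc d)) → Pt d) → ¬ AffIndep p
¬AffIndep-excess {d} p indep = proj₂ nz (indep w Σw≡0 (λ j → proj₂ (proj₂ lin) (suc j)) (proj₁ nz))
  where
  homogeneous : Fin (suc (suc d)) → Fin (suc d) → ℚ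
  homogeneous i zero = 1ℚ
  homogeneous i (suc j) = p i j
  lin = linear-dependence (suc d) homogeneous
  w = proj₁ lin
  nz = proj₁ (proj₂ lin)
  Σw≡0 : sumFin w ≡ 0ℚ
  Σw≡0 = trans (sum-cong {suc (suc d)} (λ i → ≡.sym (ℚ.*-identityʳ (w i)))) (proj₂ (proj₂ lin) zero)

infixr 5 _◂_
_◂_ : Pt d → (Fin N → Pt d) → Fin (suc N) → Pt d
(q ◂ p) zero = q
(q ◂ p) (suc i) = p i

-- Applied to an affine dependence, `F` erases every term except that of `q`, so the weight of `q`
-- is zero and a dependence of `p` remains.
AffIndep-extend : {F : Pt d → ℚ} → Affine F → (p : Fin N → Pt d) (q : Pt d) →
  AffIndep p → (∀ i → F (p i) ≡ 0ℚ) → F q ≢ 0ℚ → AffIndep (q ◂ p)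
AffIndep-extend {d} {N} {F} aff p q indep Fp≡0 Fq≢0 w Σw≡0 dep = zeros
  where
  open ≡-Reasoning
  w₀ = w zero
  w₀≡0 : w₀ ≡ 0ℚ
  w₀≡0 = p*q≡0⇒q≡0 Fq≢0 (begin
    F q *ℚ w₀                                         ≡⟨ ℚ.*-comm (F q) w₀ ⟩
    w₀ *ℚ F q                                         ≡⟨ ℚ.+-identityʳ (w₀ *ℚ F q) ⟨
    w₀ *ℚ F q +ℚ 0ℚ                                   ≡⟨ cong (w₀ *ℚ F q +ℚ_) (sum-zero {N} (λ i →
                                                            trans (cong (w (suc i) *ℚ_) (Fp≡0 i)) (ℚ.*-zeroʳ (w (suc i))))) ⟨
    w₀ *ℚ F q +ℚ sumFin (λ i → w (suc i) *ℚ F (p i))  ≡⟨ affine-dependence aff w (q ◂ p) Σw≡0 dep ⟩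
    0ℚ                                                ∎)
  drop₀ : ∀ {s t : ℚ} → s ≡ 0ℚ → s +ℚ t ≡ 0ℚ → t ≡ 0ℚ
  drop₀ {s} {t} s≡0 h = trans (≡.sym (ℚ.+-identityˡ t)) (trans (cong (_+ℚ t) (≡.sym s≡0)) h)
  zeros : ∀ i → w i ≡ 0ℚ
  zeros zero = w₀≡0
  zeros (suc i) = indep (λ i → w (suc i)) (drop₀ w₀≡0 Σw≡0)
    (λ j → drop₀ (trans (cong (_*ℚ q j) w₀≡0) (ℚ.*-zeroˡ (q j))) (dep j)) i

AffIndep-tail : (p : Fin (suc N) → Pt d) → AffIndep p → AffIndep (λ i → p (suc i))
AffIndep-tail {N} {d} p indep w Σw≡0 dep i = indep w′ (trans (ℚ.+-identityˡ (sumFin w)) Σw≡0) dep′ (suc i)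
  where
  w′ : Fin (suc N) → ℚ
  w′ zero = 0ℚ
  w′ (suc i) = w i
  dep′ : ∀ j → comb w′ p j ≡ 0ℚ
  dep′ j = trans (cong₂ _+ℚ_ (ℚ.*-zeroˡ (p zero j)) (dep j)) (ℚ.+-identityˡ 0ℚ)

HasAffIndep-mono : {S : Pt d → Set} → ∀ {k l} → k ℕ.≤′ l → HasAffIndep S l → HasAffIndep S k
HasAffIndep-mono ℕ.≤′-refl h = h
HasAffIndep-mono {S = S} (ℕ.≤′-step k≤l) (p , p∈S , indep) =
  HasAffIndep-mono {S = S} k≤l ((λ i → p (suc i)) , (λ i → p∈S (suc i)) , AffIndep-tail p indep)

-- Evaluating `F s` on a dependence isolates the weight of `s`. The exempt index `e` gets its weight
-- from the vanishing sum of weights, so one point needs no functional that detects it; the facet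
-- families below use this for the vertex shared by many of their points.
AffIndep-diagonal : (p : Fin N → Pt d) (e : Fin N) (F : Fin N → Pt d → ℚ) →
  (∀ s → s ≢ e → Affine (F s)) → (∀ s → s ≢ e → F s (p s) ≢ 0ℚ) →
  (∀ s → s ≢ e → ∀ t → t ≢ s → F s (p t) ≡ 0ℚ) → AffIndep p
AffIndep-diagonal {N} p e F aff diag off w Σw≡0 dep i with i Fin.≟ e
... | yes refl = trans (≡.sym (sum-single w e others)) Σw≡0
  where
  others : ∀ s → s ≢ e → w s ≡ 0ℚ
  others s s≢e = p*q≡0⇒q≡0 (diag s s≢e) (trans (ℚ.*-comm (F s (p s)) (w s)) (trans
    (≡.sym (sum-single (λ t → w t *ℚ F s (p t)) s (λ t t≢s →
      trans (cong (w t *ℚ_) (off s s≢e t t≢s)) (ℚ.*-zeroʳ (w t)))))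
    (affine-dependence (aff s s≢e) w p Σw≡0 dep)))
... | no i≢e = p*q≡0⇒q≡0 (diag i i≢e) (trans (ℚ.*-comm (F i (p i)) (w i)) (trans
    (≡.sym (sum-single (λ t → w t *ℚ F i (p t)) i (λ t t≢i →
      trans (cong (w t *ℚ_) (off i i≢e t t≢i)) (ℚ.*-zeroʳ (w t)))))
    (affine-dependence (aff i i≢e) w p Σw≡0 dep)))

-- Barycentric coordinates of the simplex c ≥ x₁ ≥ … ≥ x_d ≥ 0

ind : Bool → ℚ
ind b = if b then 1ℚ else 0ℚ

ind-nonneg : ∀ b → 0ℚ ≤ℚ ind b
ind-nonneg true = ℚ.nonNegative⁻¹ 1ℚ
ind-nonneg false = ℚ.≤-refl

odd : ℕ → Bool
odd zero = false
odd (suc k) = not (odd k)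

true≢false : true ≢ false
true≢false ()

-- c − x₁, x₁ − x₂, …, x_{d-1} − x_d, x_d
gap : ℚ → Pt d → Fin (suc d) → ℚ
gap {zero} c x zero = c
gap {suc d} c x zero = c -ℚ x zero
gap {suc d} c x (suc t) = gap (x zero) (λ i → x (suc i)) t

u : ℕ → Pt d
u t i = ind (toℕ i ℕ.<ᵇ t)

gap-cong : (c : ℚ) {x y : Pt d} → x ≐ y → ∀ t → gap c x t ≡ gap c y t
gap-cong {zero} c x≐y zero = refl
gap-cong {suc d} c x≐y zero = cong (c -ℚ_) (x≐y zero)
gap-cong {suc d} c {x} {y} x≐y (suc t) = trans
  (cong (λ c → gap c (λ i → x (suc i)) t) (x≐y zero)) (gap-cong (y zero) (λ i → x≐y (suc i)) t)

gap-sum : (c : ℚ) (x : Pt d) → sumFin (gap c x) ≡ c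
gap-sum {zero} c x = ℚ.+-identityʳ c
gap-sum {suc d} c x = trans (cong (c -ℚ x zero +ℚ_) (gap-sum (x zero) (λ i → x (suc i)))) (sub-add c (x zero))

gap-zero : (t : Fin (suc d)) → gap 0ℚ (λ (_ : Fin d) → 0ℚ) t ≡ 0ℚ
gap-zero {zero} zero = refl
gap-zero {suc d} zero = refl
gap-zero {suc d} (suc t) = gap-zero t

-- The bound is the entry in front of the first coordinate, so gaps are linear in the pair of bound
-- and point. The two bounds are independent because the recursion replaces them by the first
-- coordinates.
gap-linear : (α β b c : ℚ) (x y : Pt d) (t : Fin (suc d)) →
  gap (α *ℚ b +ℚ β *ℚ c) (λ i → α *ℚ x i +ℚ β *ℚ y i) t ≡ α *ℚ gap b x t +ℚ β *ℚ gap c y t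
gap-linear {zero} α β b c x y zero = refl
gap-linear {suc d} α β b c x y zero =
  solve 6 (λ α β b c x y → α :* b :+ β :* c :- (α :* x :+ β :* y) := α :* (b :- x) :+ β :* (c :- y)) refl
    α β b c (x zero) (y zero)
gap-linear {suc d} α β b c x y (suc t) =
  gap-linear α β (x zero) (y zero) (λ i → x (suc i)) (λ i → y (suc i)) t

gap-u-≡ : (t : Fin (suc d)) → gap {d} 1ℚ (u (toℕ t)) t ≡ 1ℚ
gap-u-≡ {zero} zero = refl
gap-u-≡ {suc d} zero = refl
gap-u-≡ {suc d} (suc t) = gap-u-≡ t

gap-u-≢ : (s t : Fin (suc d)) → t ≢ s → gap {d} 1ℚ (u (toℕ s)) t ≡ 0ℚ
gap-u-≢ {zero} zero zero t≢s = ⊥-elim (t≢s refl)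
gap-u-≢ {suc d} zero zero t≢s = ⊥-elim (t≢s refl)
gap-u-≢ {suc d} zero (suc t) t≢s = gap-zero t
gap-u-≢ {suc d} (suc s) zero t≢s = refl
gap-u-≢ {suc d} (suc s) (suc t) t≢s = gap-u-≢ s t (λ e → t≢s (cong suc e))

-- Telescoping: a coordinate is the sum of all gaps behind it. The gap of index 0 meets u_0, which
-- is the origin, and therefore any bound `c` may be chosen.
gap-expansion : (c : ℚ) (x : Pt d) (i : Fin d) → x i ≡ sumFin (λ t → gap c x t *ℚ u (toℕ t) i)
gap-expansion {suc d} c x zero = ≡.sym (begin
  (c -ℚ x zero) *ℚ 0ℚ +ℚ sumFin (λ t → gap (x zero) x′ t *ℚ 1ℚ)
    ≡⟨ cong₂ _+ℚ_ (ℚ.*-zeroʳ (c -ℚ x zero)) (sum-cong {suc d} (λ t → ℚ.*-identityʳ (gap (x zero) x′ t))) ⟩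
  0ℚ +ℚ sumFin (gap (x zero) x′)
    ≡⟨ ℚ.+-identityˡ (sumFin (gap (x zero) x′)) ⟩
  sumFin (gap (x zero) x′)
    ≡⟨ gap-sum (x zero) x′ ⟩
  x zero ∎)
  where
  open ≡-Reasoning
  x′ : Pt d
  x′ i = x (suc i)
gap-expansion {suc d} c x (suc i) = ≡.sym (trans
  (cong₂ _+ℚ_ (ℚ.*-zeroʳ (c -ℚ x zero)) (≡.sym (gap-expansion (x zero) (λ i → x (suc i)) i)))
  (ℚ.+-identityˡ (x (suc i))))

gap-injective : (c : ℚ) (x y : Pt d) → (∀ t → gap c x t ≡ gap c y t) → x ≐ y
gap-injective {d} c x y h i = trans (gap-expansion c x i) (trans
  (sum-cong {suc d} (λ t → cong (_*ℚ u (toℕ t) i) (h t))) (≡.sym (gap-expansion c y i)))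

dot-expansion : (a : Pt d) (c : ℚ) (x : Pt d) → dot a x ≡ sumFin (λ t → gap c x t *ℚ dot a (u (toℕ t)))
dot-expansion a c x = trans (dot-congʳ a (gap-expansion c x)) (dot-comb a (gap c x) (λ t → u (toℕ t)))

oddSum evenSum : ℚ → Pt d → ℚ
oddSum c x = sumFin (λ t → ind (odd (toℕ t)) *ℚ gap c x t)
evenSum c x = sumFin (λ t → ind (not (odd (toℕ t))) *ℚ gap c x t)

ind-split : ∀ b (p : ℚ) → ind b *ℚ p +ℚ ind (not b) *ℚ p ≡ p
ind-split true p = trans (cong₂ _+ℚ_ (ℚ.*-identityˡ p) (ℚ.*-zeroˡ p)) (ℚ.+-identityʳ p)
ind-split false p = trans (cong₂ _+ℚ_ (ℚ.*-zeroˡ p) (ℚ.*-identityˡ p)) (ℚ.+-identityˡ p)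

oddSum+evenSum : (c : ℚ) (x : Pt d) → oddSum c x +ℚ evenSum c x ≡ c
oddSum+evenSum {d} c x = trans (≡.sym (sum-+ (λ t → ind (odd (toℕ t)) *ℚ gap c x t) (λ t → ind (not (odd (toℕ t))) *ℚ gap c x t)))
  (trans (sum-cong {suc d} (λ t → ind-split (odd (toℕ t)) (gap c x t))) (gap-sum c x))

evenSum≡ : (c : ℚ) (x : Pt d) → evenSum c x ≡ c -ℚ oddSum c x
evenSum≡ c x = trans (solve 2 (λ o e → e := o :+ e :- o) refl (oddSum c x) (evenSum c x))
  (cong (_-ℚ oddSum c x) (oddSum+evenSum c x))

not-not : ∀ b → not (not b) ≡ b
not-not true = refl
not-not false = refl

oddSum-suc : (c : ℚ) (x : Pt (suc d)) → oddSum c x ≡ evenSum (x zero) (λ i → x (suc i))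
oddSum-suc c x = trans (cong (_+ℚ evenSum (x zero) (λ i → x (suc i))) (ℚ.*-zeroˡ (c -ℚ x zero)))
  (ℚ.+-identityˡ (evenSum (x zero) (λ i → x (suc i))))

-- Parity is tested exactly as in `ineqCoef m alt`, so that the two coefficient vectors agree by
-- computation; `odd` is the structurally recursive parity used elsewhere.
sgn : ℕ → ℚ
sgn k = if k ℕ.% 2 ℕ.≡ᵇ 0 then 1ℚ else ⊖ 1ℚ

sgn-suc : ∀ k → sgn (suc k) ≡ ⊖ sgn k
sgn-suc zero = refl
sgn-suc (suc zero) = refl
sgn-suc (suc (suc k)) = sgn-suc k

-- Removing the first coordinate shifts all gap indices by one and swaps the parities. Since the
-- even and odd sums of the tail add up to its bound `x zero`, this gives O(x) = x_1 - O(tail),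
-- which unrolls to alternating signs.
oddSum≡dot : (c : ℚ) (x : Pt d) → oddSum c x ≡ dot (λ i → sgn (toℕ i)) x
oddSum≡dot {zero} c x = trans (ℚ.+-identityʳ (0ℚ *ℚ c)) (ℚ.*-zeroˡ c)
oddSum≡dot {suc d} c x = begin
  oddSum c x
    ≡⟨ oddSum-suc c x ⟩
  evenSum (x zero) x′
    ≡⟨ evenSum≡ (x zero) x′ ⟩
  x zero -ℚ oddSum (x zero) x′
    ≡⟨ cong (x zero -ℚ_) (oddSum≡dot (x zero) x′) ⟩
  x zero -ℚ dot (λ i → sgn (toℕ i)) x′
    ≡⟨ cong₂ _+ℚ_ (≡.sym (ℚ.*-identityˡ (x zero))) (neg-sum (λ i → sgn (toℕ i)) x′) ⟩
  1ℚ *ℚ x zero +ℚ dot (λ i → ⊖ sgn (toℕ i)) x′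
    ≡⟨ cong (1ℚ *ℚ x zero +ℚ_) (dot-congˡ x′ (λ i → ≡.sym (sgn-suc (toℕ i)))) ⟩
  dot (λ i → sgn (toℕ i)) x ∎
  where
  open ≡-Reasoning
  x′ : Pt d
  x′ i = x (suc i)
  neg-sum : (a y : Pt d) → ⊖ dot a y ≡ dot (λ i → ⊖ a i) y
  neg-sum a y = trans (solve 1 (λ s → :- s := :- con 1ℚ :* s) refl (dot a y)) (trans
    (≡.sym (sum-*ˡ (⊖ 1ℚ) (λ i → a i *ℚ y i)))
    (sum-cong {d} (λ i → solve 2 (λ a y → :- con 1ℚ :* (a :* y) := :- a :* y) refl (a i) (y i))))

dot-linear : (a : Pt d) (α β : ℚ) (x y : Pt d) → dot a (λ i → α *ℚ x i +ℚ β *ℚ y i) ≡ α *ℚ dot a x +ℚ β *ℚ dot a y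
dot-linear {d} a α β x y = begin
  sumFin (λ i → a i *ℚ (α *ℚ x i +ℚ β *ℚ y i))
    ≡⟨ sum-cong {d} (λ i → solve 5 (λ a α β x y → a :* (α :* x :+ β :* y) := α :* (a :* x) :+ β :* (a :* y)) refl
         (a i) α β (x i) (y i)) ⟩
  sumFin (λ i → α *ℚ (a i *ℚ x i) +ℚ β *ℚ (a i *ℚ y i))
    ≡⟨ sum-+ (λ i → α *ℚ (a i *ℚ x i)) (λ i → β *ℚ (a i *ℚ y i)) ⟩
  sumFin (λ i → α *ℚ (a i *ℚ x i)) +ℚ sumFin (λ i → β *ℚ (a i *ℚ y i))
    ≡⟨ cong₂ _+ℚ_ (sum-*ˡ α (λ i → a i *ℚ x i)) (sum-*ˡ β (λ i → a i *ℚ y i)) ⟩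
  α *ℚ dot a x +ℚ β *ℚ dot a y ∎
  where open ≡-Reasoning

-- W D s is a multiple of the simplex vertex u s if D = s, and otherwise the point
-- where the edge between the vertices D and s meets the alternating hyperplane.
W : ℚ → Fin (suc d) → Fin (suc d) → Pt d
W M D s i = M *ℚ u (toℕ D) i +ℚ 1ℚ *ℚ u (toℕ s) i

gap-W : (M : ℚ) (D s t : Fin (suc d)) →
  gap (M +ℚ 1ℚ) (W M D s) t ≡ M *ℚ gap {d} 1ℚ (u (toℕ D)) t +ℚ 1ℚ *ℚ gap {d} 1ℚ (u (toℕ s)) t
gap-W {d} M D s t = trans (cong (λ c → gap (c +ℚ 1ℚ) (W M D s) t) (≡.sym (ℚ.*-identityʳ M)))
  (gap-linear {d} M 1ℚ 1ℚ 1ℚ (u (toℕ D)) (u (toℕ s)) t)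

gap-W-off : (M : ℚ) (D s t : Fin (suc d)) → t ≢ D → t ≢ s → gap (M +ℚ 1ℚ) (W M D s) t ≡ 0ℚ
gap-W-off {d} M D s t t≢D t≢s = trans (gap-W M D s t) (trans
  (cong₂ (λ p q → M *ℚ p +ℚ 1ℚ *ℚ q) (gap-u-≢ D t t≢D) (gap-u-≢ s t t≢s))
  (solve 1 (λ M → M :* con 0ℚ :+ con 1ℚ :* con 0ℚ := con 0ℚ) refl M))

gap-W-D : (M : ℚ) (D s : Fin (suc d)) → D ≢ s → gap (M +ℚ 1ℚ) (W M D s) D ≡ M
gap-W-D {d} M D s D≢s = trans (gap-W M D s D) (trans
  (cong₂ (λ p q → M *ℚ p +ℚ 1ℚ *ℚ q) (gap-u-≡ D) (gap-u-≢ s D D≢s))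
  (solve 1 (λ M → M :* con 1ℚ :+ con 1ℚ :* con 0ℚ := M) refl M))

gap-W-s : (M : ℚ) (D s : Fin (suc d)) → D ≢ s → gap (M +ℚ 1ℚ) (W M D s) s ≡ 1ℚ
gap-W-s {d} M D s D≢s = trans (gap-W M D s s) (trans
  (cong₂ (λ p q → M *ℚ p +ℚ 1ℚ *ℚ q) (gap-u-≢ D s (λ e → D≢s (≡.sym e))) (gap-u-≡ s))
  (solve 1 (λ M → M :* con 0ℚ :+ con 1ℚ :* con 1ℚ := con 1ℚ) refl M))

gap-W-≡ : (M : ℚ) (s : Fin (suc d)) → gap (M +ℚ 1ℚ) (W M s s) s ≡ M +ℚ 1ℚ
gap-W-≡ {d} M s = trans (gap-W M s s s) (trans
  (cong₂ (λ p q → M *ℚ p +ℚ 1ℚ *ℚ q) (gap-u-≡ s) (gap-u-≡ s))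
  (solve 1 (λ M → M :* con 1ℚ :+ con 1ℚ :* con 1ℚ := M :+ con 1ℚ) refl M))

-- The index `s` is even in both cases: `D ≡ s` is an uncut vertex of the simplex, and an odd `D` is
-- the far end of an edge that crosses the alternating hyperplane.
IsVertex : Fin (suc d) → Fin (suc d) → Set
IsVertex D s = odd (toℕ s) ≡ false × (D ≡ s ⊎ odd (toℕ D) ≡ true)

odd≢even : {D s : Fin (suc d)} → odd (toℕ D) ≡ true → odd (toℕ s) ≡ false → D ≢ s
odd≢even oD es refl = true≢false (trans (≡.sym oD) es)

oddSum-edge : (c : ℚ) (x : Pt d) (D s : Fin (suc d)) → odd (toℕ D) ≡ true → odd (toℕ s) ≡ false →
  (∀ t → t ≢ D → t ≢ s → gap c x t ≡ 0ℚ) → oddSum c x ≡ gap c x D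
oddSum-edge c x D s oD es off = trans (sum-single (λ t → ind (odd (toℕ t)) *ℚ gap c x t) D term)
  (trans (cong (λ b → ind b *ℚ gap c x D) oD) (ℚ.*-identityˡ (gap c x D)))
  where
  term : ∀ t → t ≢ D → ind (odd (toℕ t)) *ℚ gap c x t ≡ 0ℚ
  term t t≢D with t Fin.≟ s
  ... | yes refl = trans (cong (λ b → ind b *ℚ gap c x t) es) (ℚ.*-zeroˡ (gap c x t))
  ... | no t≢s = trans (cong (ind (odd (toℕ t)) *ℚ_) (off t t≢D t≢s)) (ℚ.*-zeroʳ (ind (odd (toℕ t))))

evenSum-edge : (c : ℚ) (x : Pt d) (D s : Fin (suc d)) → odd (toℕ D) ≡ true → odd (toℕ s) ≡ false →
  (∀ t → t ≢ D → t ≢ s → gap c x t ≡ 0ℚ) → evenSum c x ≡ gap c x s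
evenSum-edge c x D s oD es off = trans (sum-single (λ t → ind (not (odd (toℕ t))) *ℚ gap c x t) s term)
  (trans (cong (λ b → ind (not b) *ℚ gap c x s) es) (ℚ.*-identityˡ (gap c x s)))
  where
  term : ∀ t → t ≢ s → ind (not (odd (toℕ t))) *ℚ gap c x t ≡ 0ℚ
  term t t≢s with t Fin.≟ D
  ... | yes refl = trans (cong (λ b → ind (not b) *ℚ gap c x t) oD) (ℚ.*-zeroˡ (gap c x t))
  ... | no t≢D = trans (cong (ind (not (odd (toℕ t))) *ℚ_) (off t t≢D t≢s)) (ℚ.*-zeroʳ (ind (not (odd (toℕ t)))))

oddSum-W : (M : ℚ) (D s : Fin (suc d)) → odd (toℕ D) ≡ true → odd (toℕ s) ≡ false →
  oddSum (M +ℚ 1ℚ) (W M D s) ≡ M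
oddSum-W M D s oD es = trans (oddSum-edge (M +ℚ 1ℚ) (W M D s) D s oD es (gap-W-off M D s))
  (gap-W-D M D s (odd≢even oD es))

-- Conical combinations

-- The total weight is an index, so mass 1 means a convex combination while sums and multiples stay
-- inside the type. Points are functions compared pointwise, hence the constructors carry equations
-- for them.
data Cone {d} (P : Pt d → Set) : ℚ → Pt d → Set where
  nil  : ∀ {x} → (∀ i → x i ≡ 0ℚ) → Cone P 0ℚ x
  cons : ∀ {w T T′ p x x′} → 0ℚ ≤ℚ w → P p → Cone P T x →
         T′ ≡ w +ℚ T → (∀ i → x′ i ≡ w *ℚ p i +ℚ x i) → Cone P T′ x′

private variable
  P : Pt d → Set
  S T : ℚ
  ξ η : Pt d

cone-cong : S ≡ T → ξ ≐ η → Cone P S ξ → Cone P T η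
cone-cong refl x≐y (nil h) = nil (λ i → trans (≡.sym (x≐y i)) (h i))
cone-cong refl x≐y (cons 0≤w p∈P C e h) = cons 0≤w p∈P C e (λ i → trans (≡.sym (x≐y i)) (h i))

cone-mass-nonneg : Cone P T ξ → 0ℚ ≤ℚ T
cone-mass-nonneg (nil _) = ℚ.≤-refl
cone-mass-nonneg (cons 0≤w _ C refl _) = +-nonneg 0≤w (cone-mass-nonneg C)

cone-add : Cone P S ξ → Cone P T η → Cone P (S +ℚ T) (λ i → ξ i +ℚ η i)
cone-add {T = T} {η = y} (nil h) D = cone-cong (≡.sym (ℚ.+-identityˡ T))
  (λ i → trans (≡.sym (ℚ.+-identityˡ (y i))) (cong (_+ℚ y i) (≡.sym (h i)))) D
cone-add {T = T} {η = y} (cons {w} {T₁} {p = p} {x₁} 0≤w p∈P C e h) D = cons 0≤w p∈P (cone-add C D)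
  (trans (cong (_+ℚ T) e) (ℚ.+-assoc w T₁ T))
  (λ i → trans (cong (_+ℚ y i) (h i)) (ℚ.+-assoc (w *ℚ p i) (x₁ i) (y i)))

cone-scale : (c : ℚ) → 0ℚ ≤ℚ c → Cone P T ξ → Cone P (c *ℚ T) (λ i → c *ℚ ξ i)
cone-scale c 0≤c (nil h) = cone-cong (≡.sym (ℚ.*-zeroʳ c)) (λ _ → refl)
  (nil (λ i → trans (cong (c *ℚ_) (h i)) (ℚ.*-zeroʳ c)))
cone-scale c 0≤c (cons {w} {T} {p = p} {x₁} 0≤w p∈P C e h) = cons (*-nonneg 0≤c 0≤w) p∈P (cone-scale c 0≤c C)
  (trans (cong (c *ℚ_) e) (ℚ.*-distribˡ-+ c w T))
  (λ i → trans (cong (c *ℚ_) (h i)) (solve 4 (λ c w p x → c :* (w :* p :+ x) := c :* w :* p :+ c :* x) refl c w (p i) (x₁ i)))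

cone-point : P ξ → Cone P 1ℚ ξ
cone-point {ξ = x} x∈P = cons (ℚ.nonNegative⁻¹ 1ℚ) x∈P (nil (λ _ → refl)) refl
  (λ i → ≡.sym (trans (ℚ.+-identityʳ (1ℚ *ℚ x i)) (ℚ.*-identityˡ (x i))))

cone-concat : {R : Pt d → Set} → (∀ p → P p → Cone R 1ℚ p) → Cone P T ξ → Cone R T ξ
cone-concat f (nil h) = nil h
cone-concat f (cons {w} {T} {p = p} 0≤w p∈P C e h) =
  cone-cong (trans (cong (_+ℚ T) (ℚ.*-identityʳ w)) (≡.sym e)) (λ i → ≡.sym (h i))
    (cone-add (cone-scale w 0≤w (f p p∈P)) (cone-concat f C))

-- The alternative `c i ≡ 0ℚ` serves coefficients masked by parity: the points at indices of the
-- wrong parity need not belong to the cone.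
cone-comb : (c : Fin N → ℚ) (T : Fin N → ℚ) (p : Fin N → Pt d) → (∀ i → 0ℚ ≤ℚ c i) →
  (∀ i → c i ≡ 0ℚ ⊎ Cone P (T i) (p i)) → Cone P (sumFin (λ i → c i *ℚ T i)) (comb c p)
cone-comb {zero} c T p 0≤c h = nil (λ _ → refl)
cone-comb {suc N} {P = P} c T p 0≤c h = cone-add (head (h zero))
  (cone-comb (λ i → c (suc i)) (λ i → T (suc i)) (λ i → p (suc i)) (λ i → 0≤c (suc i)) (λ i → h (suc i)))
  where
  head : c zero ≡ 0ℚ ⊎ Cone P (T zero) (p zero) → Cone P (c zero *ℚ T zero) (λ j → c zero *ℚ p zero j)
  head (inj₂ C) = cone-scale (c zero) (0≤c zero) C
  head (inj₁ c≡0) = cone-cong (≡.sym (trans (cong (_*ℚ T zero) c≡0) (ℚ.*-zeroˡ (T zero)))) (λ _ → refl)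
    (nil (λ j → trans (cong (_*ℚ p zero j) c≡0) (ℚ.*-zeroˡ (p zero j))))

VertexPt : ℚ → Pt d → Set
VertexPt {d} M p = Σ (Fin (suc d)) λ D → Σ (Fin (suc d)) λ s → IsVertex D s × (p ≐ W M D s)

-- With y the gaps of x, O and E their odd and even sums and n = M + 1,
--   n M E x = n Σ_{i odd} y_i Σ_{k even} y_k W(i,k) + (M E − O) Σ_{k even} y_k W(k,k),
-- and M E − O = n (M − O).
vertex-decomposition : (M : ℚ) → 0ℚ < M → (x : Pt d) →
  (∀ t → 0ℚ ≤ℚ gap (M +ℚ 1ℚ) x t) → oddSum (M +ℚ 1ℚ) x ≤ℚ M → Cone (VertexPt M) 1ℚ x
vertex-decomposition {d} M 0<M x 0≤y O≤M = cone-cong (proj₂ (proj₂ inv)) rescale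
    (cone-scale κ (ℚ.<⇒≤ (proj₁ (proj₂ inv))) total)
  where
  open ≡-Reasoning
  n = M +ℚ 1ℚ
  α β : Fin (suc d) → ℚ
  α t = ind (not (odd (toℕ t))) *ℚ gap n x t
  β t = ind (odd (toℕ t)) *ℚ gap n x t
  O = oddSum n x
  E = evenSum n x
  X Y : Pt d
  X = comb α (λ t → u (toℕ t))
  Y = comb β (λ t → u (toℕ t))
  0≤α : ∀ t → 0ℚ ≤ℚ α t
  0≤α t = *-nonneg (ind-nonneg (not (odd (toℕ t)))) (0≤y t)
  0≤β : ∀ t → 0ℚ ≤ℚ β t
  0≤β t = *-nonneg (ind-nonneg (odd (toℕ t))) (0≤y t)
  0≤M-O : 0ℚ ≤ℚ M -ℚ O
  0≤M-O = diff-nonneg O≤M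
  E≡ : E ≡ M -ℚ O +ℚ 1ℚ
  E≡ = trans (evenSum≡ n x) (solve 2 (λ M O → M :+ con 1ℚ :- O := M :- O :+ con 1ℚ) refl M O)
  -- O is at most M = n - 1, so E is at least 1 and n M E can be inverted.
  0<E : 0ℚ < E
  0<E = subst (0ℚ <_) (≡.sym E≡) (ℚ.+-mono-≤-< 0≤M-O (ℚ.positive⁻¹ 1ℚ))
  0<n : 0ℚ < n
  0<n = +-pos-nonneg 0<M (ℚ.nonNegative⁻¹ 1ℚ)
  inv = recip (*-pos (*-pos 0<n 0<M) 0<E)
  κ = proj₁ inv
  X+Y : ∀ j → X j +ℚ Y j ≡ x j
  X+Y j = begin
    X j +ℚ Y j
      ≡⟨ sum-+ (λ t → α t *ℚ u (toℕ t) j) (λ t → β t *ℚ u (toℕ t) j) ⟨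
    sumFin (λ t → α t *ℚ u (toℕ t) j +ℚ β t *ℚ u (toℕ t) j)
      ≡⟨ sum-cong {suc d} (λ t → trans
           (solve 3 (λ a b v → a :* v :+ b :* v := (b :+ a) :* v) refl (α t) (β t) (u (toℕ t) j))
           (cong (_*ℚ u (toℕ t) j) (ind-split (odd (toℕ t)) (gap n x t)))) ⟩
    sumFin (λ t → gap n x t *ℚ u (toℕ t) j)
      ≡⟨ gap-expansion n x j ⟨
    x j ∎
  even? : ∀ k → α k ≡ 0ℚ ⊎ odd (toℕ k) ≡ false
  even? k with odd (toℕ k)
  ... | true = inj₁ (ℚ.*-zeroˡ (gap n x k))
  ... | false = inj₂ refl
  odd? : ∀ k → β k ≡ 0ℚ ⊎ odd (toℕ k) ≡ true
  odd? k with odd (toℕ k)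
  ... | false = inj₁ (ℚ.*-zeroˡ (gap n x k))
  ... | true = inj₂ refl
  V = VertexPt {d} M
  weighted : (z : ℚ) (c : Fin (suc d) → ℚ) (v : Fin (suc d) → ℚ) →
    sumFin (λ k → c k *ℚ (z +ℚ v k)) ≡ sumFin c *ℚ z +ℚ sumFin (λ k → c k *ℚ v k)
  weighted z c v = trans (sum-cong {suc d} (λ k → ℚ.*-distribˡ-+ (c k) z (v k)))
    (trans (sum-+ (λ k → c k *ℚ z) (λ k → c k *ℚ v k)) (cong (_+ℚ sumFin (λ k → c k *ℚ v k)) (sum-*ʳ c z)))
  oddVertex : ∀ i → odd (toℕ i) ≡ true → Cone V E (λ j → E *ℚ (M *ℚ u (toℕ i) j) +ℚ X j)
  oddVertex i oi = cone-cong (trans (sum-*ʳ α 1ℚ) (ℚ.*-identityʳ E))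
    (λ j → trans (weighted (M *ℚ u (toℕ i) j) α (λ k → 1ℚ *ℚ u (toℕ k) j))
      (cong (E *ℚ (M *ℚ u (toℕ i) j) +ℚ_) (sum-cong {suc d} (λ k → cong (α k *ℚ_) (ℚ.*-identityˡ (u (toℕ k) j))))))
    (cone-comb α (λ _ → 1ℚ) (W M i) 0≤α (λ k → edge k (even? k)))
    where
    edge : ∀ k → α k ≡ 0ℚ ⊎ odd (toℕ k) ≡ false → α k ≡ 0ℚ ⊎ Cone V 1ℚ (W M i k)
    edge k (inj₁ e) = inj₁ e
    edge k (inj₂ ek) = inj₂ (cone-point (i , k , (ek , inj₂ oi) , λ _ → refl))
  oddPart : Cone V (O *ℚ E) (λ j → E *ℚ M *ℚ Y j +ℚ O *ℚ X j)
  oddPart = cone-cong (sum-*ʳ β E) sums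
    (cone-comb β (λ _ → E) (λ i j → E *ℚ (M *ℚ u (toℕ i) j) +ℚ X j) 0≤β (λ i → pick i (odd? i)))
    where
    pick : ∀ i → β i ≡ 0ℚ ⊎ odd (toℕ i) ≡ true → β i ≡ 0ℚ ⊎ Cone V E (λ j → E *ℚ (M *ℚ u (toℕ i) j) +ℚ X j)
    pick i (inj₁ e) = inj₁ e
    pick i (inj₂ oi) = inj₂ (oddVertex i oi)
    sums : ∀ j → sumFin (λ i → β i *ℚ (E *ℚ (M *ℚ u (toℕ i) j) +ℚ X j)) ≡ E *ℚ M *ℚ Y j +ℚ O *ℚ X j
    sums j = begin
      sumFin (λ i → β i *ℚ (E *ℚ (M *ℚ u (toℕ i) j) +ℚ X j))
        ≡⟨ sum-cong {suc d} (λ i → solve 5 (λ b E M v X → b :* (E :* (M :* v) :+ X) := b :* (X :+ E :* M :* v)) refl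
             (β i) E M (u (toℕ i) j) (X j)) ⟩
      sumFin (λ i → β i *ℚ (X j +ℚ E *ℚ M *ℚ u (toℕ i) j))
        ≡⟨ weighted (X j) β (λ i → E *ℚ M *ℚ u (toℕ i) j) ⟩
      O *ℚ X j +ℚ sumFin (λ i → β i *ℚ (E *ℚ M *ℚ u (toℕ i) j))
        ≡⟨ cong (O *ℚ X j +ℚ_) (trans
             (sum-cong {suc d} (λ i → solve 3 (λ b c v → b :* (c :* v) := c :* (b :* v)) refl (β i) (E *ℚ M) (u (toℕ i) j)))
             (sum-*ˡ (E *ℚ M) (λ i → β i *ℚ u (toℕ i) j))) ⟩
      O *ℚ X j +ℚ E *ℚ M *ℚ Y j
        ≡⟨ ℚ.+-comm (O *ℚ X j) (E *ℚ M *ℚ Y j) ⟩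
      E *ℚ M *ℚ Y j +ℚ O *ℚ X j ∎
  evenPart : Cone V E (λ j → n *ℚ X j)
  evenPart = cone-cong (trans (sum-*ʳ α 1ℚ) (ℚ.*-identityʳ E))
    (λ j → trans
      (sum-cong {suc d} (λ k → solve 3 (λ a M v → a :* (M :* v :+ con 1ℚ :* v) := (M :+ con 1ℚ) :* (a :* v)) refl
        (α k) M (u (toℕ k) j)))
      (sum-*ˡ n (λ k → α k *ℚ u (toℕ k) j)))
    (cone-comb α (λ _ → 1ℚ) (λ k → W M k k) 0≤α (λ k → pick k (even? k)))
    where
    pick : ∀ k → α k ≡ 0ℚ ⊎ odd (toℕ k) ≡ false → α k ≡ 0ℚ ⊎ Cone V 1ℚ (W M k k)
    pick k (inj₁ e) = inj₁ e
    pick k (inj₂ ek) = inj₂ (cone-point (k , k , (ek , inj₁ refl) , λ _ → refl))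
  total : Cone V (n *ℚ M *ℚ E) (λ j → n *ℚ M *ℚ E *ℚ x j)
  total = cone-cong
    (solve 3 (λ M O E → (M :+ con 1ℚ) :* (O :* E) :+ (M :+ con 1ℚ) :* (M :- O) :* E := (M :+ con 1ℚ) :* M :* E) refl M O E)
    -- With E written as M - O + 1 this is a polynomial identity: Y_j has coefficient n E M, and X_j
    -- has n O + n n (M - O) = n M E.
    (λ j → trans (cong (λ E → n *ℚ (E *ℚ M *ℚ Y j +ℚ O *ℚ X j) +ℚ n *ℚ (M -ℚ O) *ℚ (n *ℚ X j)) E≡) (trans
      (solve 4 (λ M O X Y → (M :+ con 1ℚ) :* ((M :- O :+ con 1ℚ) :* M :* Y :+ O :* X) :+ (M :+ con 1ℚ) :* (M :- O) :* ((M :+ con 1ℚ) :* X)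
          := (M :+ con 1ℚ) :* M :* (M :- O :+ con 1ℚ) :* (X :+ Y)) refl M O (X j) (Y j))
      (cong₂ (λ E z → n *ℚ M *ℚ E *ℚ z) (≡.sym E≡) (X+Y j))))
    (cone-add (cone-scale n (ℚ.<⇒≤ 0<n) oddPart)
      (cone-scale (n *ℚ (M -ℚ O)) (*-nonneg (ℚ.<⇒≤ 0<n) 0≤M-O) evenPart))
  rescale : ∀ j → κ *ℚ (n *ℚ M *ℚ E *ℚ x j) ≡ x j
  rescale j = trans (≡.sym (ℚ.*-assoc κ (n *ℚ M *ℚ E) (x j)))
    (trans (cong (_*ℚ x j) (proj₂ (proj₂ inv))) (ℚ.*-identityˡ (x j)))

-- Counting

δ : Bool → ℕ
δ b = if b then 1 else 0

count-cong : {p q : Fin N → Bool} → (∀ i → p i ≡ q i) → count p ≡ count q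
count-cong {zero} h = refl
count-cong {suc N} h = cong₂ _+_ (cong δ (h zero)) (count-cong (λ i → h (suc i)))

count-const : (p : Fin N → Bool) (b : Bool) → (∀ i → p i ≡ b) → count p ≡ δ b * N
count-const {zero} p b h = ≡.sym (ℕ.*-zeroʳ (δ b))
count-const {suc N} p b h = trans (cong₂ _+_ (cong δ (h zero)) (count-const (λ i → p (suc i)) b (λ i → h (suc i))))
  (≡.sym (ℕ.*-suc (δ b) N))

δ≤1 : ∀ b → δ b ≤ 1
δ≤1 true = ℕ.≤-refl
δ≤1 false = z≤n

count-≤ : (p : Fin N → Bool) → count p ≤ N
count-≤ {zero} p = z≤n
count-≤ {suc N} p = ℕ.+-mono-≤ (δ≤1 (p zero)) (count-≤ (λ i → p (suc i)))

count-false-≤ : (p : Fin (suc N) → Bool) (i : Fin (suc N)) → p i ≡ false → count p ≤ N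
count-false-≤ {N} p zero e = subst (λ b → δ b + count (λ i → p (suc i)) ≤ N) (≡.sym e) (count-≤ (λ i → p (suc i)))
count-false-≤ {suc N} p (suc i) e = ℕ.+-mono-≤ (δ≤1 (p zero)) (count-false-≤ (λ i → p (suc i)) i e)

δ-mono : ∀ {a b} → (Bool.T a → Bool.T b) → δ a ≤ δ b
δ-mono {false} h = z≤n
δ-mono {true} {true} h = ℕ.≤-refl
δ-mono {true} {false} h = ⊥-elim (h tt)

count-mono : (p q : Fin N → Bool) → (∀ i → Bool.T (p i) → Bool.T (q i)) → count p ≤ count q
count-mono {zero} p q h = z≤n
count-mono {suc N} p q h = ℕ.+-mono-≤ (δ-mono (h zero)) (count-mono (λ i → p (suc i)) (λ i → q (suc i)) (λ i → h (suc i)))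

ℕ→ℚ-δ : ∀ b → ℕ→ℚ (δ b) ≡ ind b
ℕ→ℚ-δ true = refl
ℕ→ℚ-δ false = refl

ℕ→ℚ-count : (p : Fin N → Bool) → ℕ→ℚ (count p) ≡ sumFin (λ i → ind (p i))
ℕ→ℚ-count {zero} p = refl
ℕ→ℚ-count {suc N} p = trans (ℕ→ℚ-homo-+ (δ (p zero)) (count (λ i → p (suc i))))
  (cong₂ _+ℚ_ (ℕ→ℚ-δ (p zero)) (ℕ→ℚ-count (λ i → p (suc i))))

countℕ : ℕ → (ℕ → Bool) → ℕ
countℕ N p = count {N} (λ i → p (toℕ i))

countℕ-cong : ∀ N (p q : ℕ → Bool) → (∀ x → x ℕ.< N → p x ≡ q x) → countℕ N p ≡ countℕ N q
countℕ-cong N p q h = count-cong {N} (λ i → h (toℕ i) (Fin.toℕ<n i))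

countℕ-split : ∀ a b (p : ℕ → Bool) → countℕ (a + b) p ≡ countℕ a p + countℕ b (λ x → p (a + x))
countℕ-split zero b p = refl
countℕ-split (suc a) b p = trans (cong (δ (p 0) +_) (countℕ-split a b (λ x → p (suc x))))
  (≡.sym (ℕ.+-assoc (δ (p 0)) (countℕ a (λ x → p (suc x))) (countℕ b (λ x → p (suc (a + x))))))

countℕ-last : ∀ N (p : ℕ → Bool) → countℕ (suc N) p ≡ countℕ N p + δ (p N)
countℕ-last N p = trans (cong (λ k → countℕ k p) (ℕ.+-comm 1 N)) (trans (countℕ-split N 1 p)
  (cong (countℕ N p +_) (trans (ℕ.+-identityʳ (δ (p (N + 0)))) (cong (λ k → δ (p k)) (ℕ.+-identityʳ N)))))

countℕ-true : ∀ N (p : ℕ → Bool) → (∀ x → x ℕ.< N → p x ≡ true) → countℕ N p ≡ N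
countℕ-true N p h = trans (count-const (λ i → p (toℕ i)) true (λ i → h (toℕ i) (Fin.toℕ<n i))) (ℕ.+-identityʳ N)

countℕ-false : ∀ N (p : ℕ → Bool) → (∀ x → x ℕ.< N → p x ≡ false) → countℕ N p ≡ 0
countℕ-false N p h = count-const (λ i → p (toℕ i)) false (λ i → h (toℕ i) (Fin.toℕ<n i))

countℕ-remove : ∀ N k (p : ℕ → Bool) → k ℕ.< N → p k ≡ true →
  countℕ N p ≡ suc (countℕ N (λ x → p x ∧ not (x ℕ.≡ᵇ k)))
countℕ-remove (suc N) zero p _ pk = begin
  δ (p 0) + countℕ N (λ x → p (suc x))
    ≡⟨ cong₂ _+_ (cong δ pk) (countℕ-cong N (λ x → p (suc x)) (λ x → p (suc x) ∧ true) (λ x _ → ≡.sym (Bool.∧-identityʳ (p (suc x))))) ⟩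
  suc (countℕ N (λ x → p (suc x) ∧ true))
    ≡⟨ cong (λ b → suc (δ b + countℕ N (λ x → p (suc x) ∧ true))) (Bool.∧-zeroʳ (p 0)) ⟨
  suc (δ (p 0 ∧ false) + countℕ N (λ x → p (suc x) ∧ true)) ∎
  where open ≡-Reasoning
countℕ-remove (suc N) (suc k) p (s≤s k<N) pk = begin
  δ (p 0) + countℕ N (λ x → p (suc x))
    ≡⟨ cong₂ _+_ (cong δ (≡.sym (Bool.∧-identityʳ (p 0)))) (countℕ-remove N k (λ x → p (suc x)) k<N pk) ⟩
  δ (p 0 ∧ true) + suc (countℕ N (λ x → p (suc x) ∧ not (x ℕ.≡ᵇ k)))
    ≡⟨ ℕ.+-suc (δ (p 0 ∧ true)) (countℕ N (λ x → p (suc x) ∧ not (x ℕ.≡ᵇ k))) ⟩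
  suc (δ (p 0 ∧ true) + countℕ N (λ x → p (suc x) ∧ not (x ℕ.≡ᵇ k))) ∎
  where open ≡-Reasoning

-- Passing from row i to row i + 1 puts f (i + 1) in front and drops the last entry f (N - 1 - i).
-- The two arguments add up to N, so the symmetry of `f` keeps the count.
countℕ-rotate : ∀ N (f : ℕ → Bool) → (∀ x y → x + y ≡ N → f x ≡ f y) →
  ∀ i → i ℕ.< N → countℕ N (λ j → f ℕ.∣ i - j ∣) ≡ countℕ N f
countℕ-rotate N f f-sym zero _ = refl
countℕ-rotate (suc N) f f-sym (suc i) (s≤s i<N) = begin
  δ (f (suc i)) + countℕ N (λ j → f ℕ.∣ i - j ∣)
    ≡⟨ ℕ.+-comm (δ (f (suc i))) (countℕ N (λ j → f ℕ.∣ i - j ∣)) ⟩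
  countℕ N (λ j → f ℕ.∣ i - j ∣) + δ (f (suc i))
    ≡⟨ cong (λ b → countℕ N (λ j → f ℕ.∣ i - j ∣) + δ b)
         (trans (f-sym (suc i) (N ℕ.∸ i) (cong suc (ℕ.m+[n∸m]≡n (ℕ.<⇒≤ i<N))))
           (cong f (≡.sym (ℕ.m≤n⇒∣m-n∣≡n∸m (ℕ.<⇒≤ i<N))))) ⟩
  countℕ N (λ j → f ℕ.∣ i - j ∣) + δ (f ℕ.∣ i - N ∣)
    ≡⟨ countℕ-last N (λ j → f ℕ.∣ i - j ∣) ⟨
  countℕ (suc N) (λ j → f ℕ.∣ i - j ∣)
    ≡⟨ countℕ-rotate (suc N) f f-sym i (ℕ.m<n⇒m<1+n i<N) ⟩
  countℕ (suc N) f ∎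
  where open ≡-Reasoning

T-ext : ∀ {a b} → (Bool.T a → Bool.T b) → (Bool.T b → Bool.T a) → a ≡ b
T-ext {false} {false} f g = refl
T-ext {false} {true} f g = ⊥-elim (g tt)
T-ext {true} {false} f g = ⊥-elim (f tt)
T-ext {true} {true} f g = refl

<ᵇ-true : ∀ {a b} → a ℕ.< b → (a ℕ.<ᵇ b) ≡ true
<ᵇ-true a<b = T-ext (λ _ → tt) (λ _ → ℕ.<⇒<ᵇ a<b)

<ᵇ-false : ∀ {a b} → b ≤ a → (a ℕ.<ᵇ b) ≡ false
<ᵇ-false {a} {b} b≤a = T-ext (λ a<ᵇb → ℕ.≤⇒≯ b≤a (ℕ.<ᵇ⇒< a b a<ᵇb)) ⊥-elim

<ᵇ-flip : ∀ a e x y → x + y ≡ a + e → (a ℕ.<ᵇ x) ≡ (y ℕ.<ᵇ e)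
<ᵇ-flip a e x y eq = T-ext
  (λ h → ℕ.<⇒<ᵇ (ℕ.+-cancelˡ-< x y e (subst (ℕ._< x + e) (≡.sym eq) (ℕ.+-monoˡ-< e (ℕ.<ᵇ⇒< a x h)))))
  (λ h → ℕ.<⇒<ᵇ (ℕ.+-cancelʳ-< e a x (subst (ℕ._< x + e) eq (ℕ.+-monoʳ-< x (ℕ.<ᵇ⇒< y e h)))))

countℕ-<ᵇ : ∀ q N → q ≤ N → countℕ N (λ x → x ℕ.<ᵇ q) ≡ q
countℕ-<ᵇ q N q≤N = begin
  countℕ N below                                            ≡⟨ cong (λ k → countℕ k below) (ℕ.m+[n∸m]≡n q≤N) ⟨
  countℕ (q + (N ℕ.∸ q)) below                              ≡⟨ countℕ-split q (N ℕ.∸ q) below ⟩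
  countℕ q below + countℕ (N ℕ.∸ q) (λ x → below (q + x))   ≡⟨ cong₂ _+_
      (countℕ-true q below (λ x → <ᵇ-true))
      (countℕ-false (N ℕ.∸ q) (λ x → below (q + x)) (λ x _ → <ᵇ-false (ℕ.m≤m+n q x))) ⟩
  q + 0                                                     ≡⟨ ℕ.+-identityʳ q ⟩
  q                                                         ∎
  where
  open ≡-Reasoning
  below : ℕ → Bool
  below x = x ℕ.<ᵇ q

-- Graphs realizing the extreme points

-- Distances of adjacent vertices in the circulant graph of degree c on 1 + b + (c + b) vertices.
window : ℕ → ℕ → ℕ → Bool
window b c x = (b ℕ.<ᵇ x) ∧ (x ℕ.<ᵇ suc b + c)

-- The two ends b and 1 + b + c of the window add up to the number of vertices, so the reflection of
-- distances exchanges its two tests.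
window-sym : ∀ b c x y → x + y ≡ suc b + (c + b) → window b c x ≡ window b c y
window-sym b c x y eq = trans
  (cong₂ _∧_ (<ᵇ-flip b (suc b + c) x y (trans eq shift))
    (≡.sym (<ᵇ-flip b (suc b + c) y x (trans (ℕ.+-comm y x) (trans eq shift)))))
  (Bool.∧-comm (y ℕ.<ᵇ suc b + c) (b ℕ.<ᵇ y))
  where
  shift : suc b + (c + b) ≡ b + (suc b + c)
  shift = trans (≡.sym (ℕ.+-assoc (suc b) c b)) (ℕ.+-comm (suc b + c) b)

window-count : ∀ b c → countℕ (suc b + (c + b)) (window b c) ≡ c
window-count b c = begin
  countℕ (suc b + (c + b)) w
    ≡⟨ countℕ-split (suc b) (c + b) w ⟩
  countℕ (suc b) w + countℕ (c + b) w′
    ≡⟨ cong (_+ countℕ (c + b) w′) (countℕ-false (suc b) w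
         (λ x x<1+b → cong (_∧ (x ℕ.<ᵇ suc b + c)) (<ᵇ-false {b} {x} (ℕ.s≤s⁻¹ x<1+b)))) ⟩
  countℕ (c + b) w′
    ≡⟨ countℕ-split c b w′ ⟩
  countℕ c w′ + countℕ b (λ x → w′ (c + x))
    ≡⟨ cong₂ _+_
         (countℕ-true c w′ (λ x x<c → cong₂ _∧_ (<ᵇ-true (ℕ.m≤m+n (suc b) x)) (<ᵇ-true (ℕ.+-monoʳ-< (suc b) x<c))))
         (countℕ-false b (λ x → w′ (c + x)) (λ x _ → trans
           (cong ((b ℕ.<ᵇ suc b + (c + x)) ∧_) (<ᵇ-false (ℕ.+-monoʳ-≤ (suc b) (ℕ.m≤m+n c x))))
           (Bool.∧-zeroʳ (b ℕ.<ᵇ suc b + (c + x))))) ⟩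
  c + 0
    ≡⟨ ℕ.+-identityʳ c ⟩
  c ∎
  where
  open ≡-Reasoning
  w w′ : ℕ → Bool
  w = window b c
  w′ x = w (suc b + x)

-- The b shortest and the b longest nonzero distances are left out, together with 0. Hence N - 1 - c
-- is even, and on an odd number of vertices the degree `c` is even.
circulant : ∀ N b c → N ≡ suc b + (c + b) → Σ (Graph N) λ G → ∀ i → degree G i ≡ c
circulant N b c N≡ = G , λ i → trans
  (countℕ-rotate N (window b c) (λ x y e → window-sym b c x y (trans e N≡)) (toℕ i) (Fin.toℕ<n i))
  (trans (cong (λ k → countℕ k (window b c)) N≡) (window-count b c))
  where
  G : Graph N
  G = record
    { adj = λ i j → window b c ℕ.∣ toℕ i - toℕ j ∣
    ; sym = λ i j → cong (window b c) (ℕ.∣-∣-comm (toℕ i) (toℕ j))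
    ; irrefl = λ i → cong (window b c) (ℕ.∣n-n∣≡0 (toℕ i))
    }

-- The circulant graph of odd degree 2r + 1 on 2m vertices contains the antipodal matching;
-- q of its edges are removed and their endpoints joined to a new vertex zero.
apex : ∀ N m b r q → N ≡ m + m → m ≡ suc b + r → q ≤ m →
  Σ (Graph (suc N)) λ G → (degree G zero ≡ q + q) × (∀ i → degree G (suc i) ≡ suc (r + r))
apex N m b r q N≡ m≡ q≤m = G , degree-zero , degree-suc
  where
  open ≡-Reasoning
  c = suc (r + r)
  f f⁻ matched : ℕ → Bool
  f = window b c
  f⁻ x = f x ∧ not (x ℕ.≡ᵇ m)
  -- This tests whether the residue of i modulo m is below q; such vertices come in q antipodal
  -- pairs i, i + m.
  matched i = (if i ℕ.<ᵇ m then i else i ℕ.∸ m) ℕ.<ᵇ q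
  N≡′ : N ≡ suc b + (c + b)
  N≡′ = trans N≡ (trans (cong₂ _+_ m≡ m≡)
    (S.solve 2 (λ b r → one S.:+ b S.:+ r S.:+ (one S.:+ b S.:+ r) S.:= one S.:+ b S.:+ (one S.:+ (r S.:+ r) S.:+ b)) refl b r))
    where
    module S = Data.Nat.Solver.+-*-Solver
    one : S.Polynomial 2
    one = S.con 1
  m<N : m ℕ.< N
  m<N = subst (m ℕ.<_) (≡.sym N≡) (ℕ.m<m+n m (subst (0 ℕ.<_) (≡.sym m≡) (s≤s z≤n)))
  f-sym : ∀ x y → x + y ≡ N → f x ≡ f y
  f-sym x y e = window-sym b c x y (trans e N≡′)
  fm : f m ≡ true
  fm = cong₂ _∧_ (<ᵇ-true (subst (b ℕ.<_) (≡.sym m≡) (ℕ.m≤m+n (suc b) r)))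
    (<ᵇ-true (subst (ℕ._< suc b + c) (≡.sym m≡) (ℕ.+-monoʳ-< (suc b) (s≤s (ℕ.m≤m+n r r)))))
  half : ∀ x y → x + y ≡ N → x ≡ m → y ≡ m
  half x y e refl = ℕ.+-cancelˡ-≡ m y m (trans e N≡)
  f⁻-sym : ∀ x y → x + y ≡ N → f⁻ x ≡ f⁻ y
  f⁻-sym x y e = cong₂ (λ s t → s ∧ not t) (f-sym x y e) (T-ext
    (λ h → ℕ.≡⇒≡ᵇ y m (half x y e (ℕ.≡ᵇ⇒≡ x m h)))
    (λ h → ℕ.≡⇒≡ᵇ x m (half y x (trans (ℕ.+-comm y x) e) (ℕ.≡ᵇ⇒≡ y m h))))
  f-count : countℕ N f ≡ c
  f-count = trans (cong (λ k → countℕ k f) N≡′) (window-count b c)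
  f⁻-count : countℕ N f⁻ ≡ r + r
  f⁻-count = ℕ.suc-injective (trans (≡.sym (countℕ-remove N m f m<N fm)) f-count)
  matched-low : ∀ x → x ℕ.< m → matched x ≡ (x ℕ.<ᵇ q)
  matched-low x x<m = cong (λ b → (if b then x else x ℕ.∸ m) ℕ.<ᵇ q) (<ᵇ-true x<m)
  matched-high : ∀ x → matched (m + x) ≡ (x ℕ.<ᵇ q)
  matched-high x = trans (cong (λ b → (if b then m + x else m + x ℕ.∸ m) ℕ.<ᵇ q) (<ᵇ-false (ℕ.m≤m+n m x)))
    (cong (ℕ._<ᵇ q) (ℕ.m+n∸m≡n m x))
  matched-antipodal′ : ∀ i j → i ≤ j → j ℕ.< N → ℕ.∣ i - j ∣ ≡ m → matched i ≡ matched j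
  matched-antipodal′ i j i≤j j<N e = trans (matched-low i i<m)
    (≡.sym (trans (cong matched (≡.sym m+i≡j)) (matched-high i)))
    where
    m+i≡j : m + i ≡ j
    m+i≡j = trans (cong (_+ i) (trans (≡.sym e) (ℕ.m≤n⇒∣m-n∣≡n∸m i≤j))) (ℕ.m∸n+n≡m i≤j)
    i<m : i ℕ.< m
    i<m = ℕ.+-cancelˡ-< m i m (≡.subst₂ ℕ._<_ (≡.sym m+i≡j) N≡ j<N)
  matched-antipodal : ∀ i j → i ℕ.< N → j ℕ.< N → ℕ.∣ i - j ∣ ≡ m → matched i ≡ matched j
  matched-antipodal i j i<N j<N e with ℕ.≤-total i j
  ... | inj₁ i≤j = matched-antipodal′ i j i≤j j<N e
  ... | inj₂ j≤i = ≡.sym (matched-antipodal′ j i j≤i i<N (trans (ℕ.∣-∣-comm j i) e))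
  -- A matched vertex gives up distance m, at which only its antipode lies. The antipode is matched
  -- too, so adjacency stays symmetric.
  link : Bool → ℕ → Bool
  link b x = if b then f⁻ x else f x
  link-≢ : ∀ b x → (x ℕ.≡ᵇ m) ≡ false → link b x ≡ f x
  link-≢ false x e = refl
  link-≢ true x e = trans (cong (λ t → f x ∧ not t) e) (Bool.∧-identityʳ (f x))
  link-sym : ∀ i j → i ℕ.< N → j ℕ.< N → link (matched i) ℕ.∣ i - j ∣ ≡ link (matched j) ℕ.∣ i - j ∣
  link-sym i j i<N j<N = go (ℕ.∣ i - j ∣ ℕ.≡ᵇ m) refl
    where
    go : ∀ t → (ℕ.∣ i - j ∣ ℕ.≡ᵇ m) ≡ t → link (matched i) ℕ.∣ i - j ∣ ≡ link (matched j) ℕ.∣ i - j ∣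
    go true e = cong (λ b → link b ℕ.∣ i - j ∣)
      (matched-antipodal i j i<N j<N (ℕ.≡ᵇ⇒≡ ℕ.∣ i - j ∣ m (subst Bool.T (≡.sym e) tt)))
    go false e = trans (link-≢ (matched i) ℕ.∣ i - j ∣ e) (≡.sym (link-≢ (matched j) ℕ.∣ i - j ∣ e))
  link-zero : ∀ b → link b 0 ≡ false
  link-zero true = refl
  link-zero false = refl
  A : Fin (suc N) → Fin (suc N) → Bool
  A zero zero = false
  A zero (suc j) = matched (toℕ j)
  A (suc i) zero = matched (toℕ i)
  A (suc i) (suc j) = link (matched (toℕ i)) ℕ.∣ toℕ i - toℕ j ∣
  A-sym : ∀ i j → A i j ≡ A j i
  A-sym zero zero = refl
  A-sym zero (suc j) = refl
  A-sym (suc i) zero = refl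
  A-sym (suc i) (suc j) = trans (link-sym (toℕ i) (toℕ j) (Fin.toℕ<n i) (Fin.toℕ<n j))
    (cong (link (matched (toℕ j))) (ℕ.∣-∣-comm (toℕ i) (toℕ j)))
  A-irrefl : ∀ i → A i i ≡ false
  A-irrefl zero = refl
  A-irrefl (suc i) = trans (cong (link (matched (toℕ i))) (ℕ.∣n-n∣≡0 (toℕ i))) (link-zero (matched (toℕ i)))
  G : Graph (suc N)
  G = record { adj = A ; sym = A-sym ; irrefl = A-irrefl }
  degree-zero : degree G zero ≡ q + q
  degree-zero = begin
    countℕ N matched                                ≡⟨ cong (λ k → countℕ k matched) N≡ ⟩
    countℕ (m + m) matched                          ≡⟨ countℕ-split m m matched ⟩
    countℕ m matched + countℕ m (λ x → matched (m + x))
      ≡⟨ cong₂ _+_ (countℕ-cong m matched (λ x → x ℕ.<ᵇ q) matched-low)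
           (countℕ-cong m (λ x → matched (m + x)) (λ x → x ℕ.<ᵇ q) (λ x _ → matched-high x)) ⟩
    countℕ m (λ x → x ℕ.<ᵇ q) + countℕ m (λ x → x ℕ.<ᵇ q)
      ≡⟨ cong (λ k → k + k) (countℕ-<ᵇ q m q≤m) ⟩
    q + q ∎
  -- The summand `δ b` is the edge to the new vertex, which makes up for the lost antipode.
  link-degree : ∀ b i → i ℕ.< N → δ b + countℕ N (λ j → link b ℕ.∣ i - j ∣) ≡ c
  link-degree true i i<N = cong suc (trans (countℕ-rotate N f⁻ f⁻-sym i i<N) f⁻-count)
  link-degree false i i<N = trans (countℕ-rotate N f f-sym i i<N) f-count
  degree-suc : ∀ i → degree G (suc i) ≡ c
  degree-suc i = link-degree (matched (toℕ i)) (toℕ i) (Fin.toℕ<n i)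

-- Handshake lemma

odd-δ : ∀ b k → odd (δ b + k) ≡ b xor odd k
odd-δ true k = refl
odd-δ false k = refl

xor-interchange : ∀ a b c d → (a xor b) xor (c xor d) ≡ (a xor c) xor (b xor d)
xor-interchange true true c d = xor-rotate c d
  where
  xor-rotate : ∀ c d → c xor d ≡ not c xor not d
  xor-rotate true d = refl
  xor-rotate false d = ≡.sym (not-not d)
xor-interchange true false true d = not-not d
xor-interchange true false false d = refl
xor-interchange false true true d = refl
xor-interchange false true false d = refl
xor-interchange false false c d = refl

odd-count-xor : (p q : Fin N → Bool) → odd (count (λ i → p i xor q i)) ≡ odd (count p) xor odd (count q)
odd-count-xor {zero} p q = refl
odd-count-xor {suc N} p q = begin
  odd (δ (p zero xor q zero) + count (λ i → p (suc i) xor q (suc i)))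
    ≡⟨ odd-δ (p zero xor q zero) (count (λ i → p (suc i) xor q (suc i))) ⟩
  (p zero xor q zero) xor odd (count (λ i → p (suc i) xor q (suc i)))
    ≡⟨ cong ((p zero xor q zero) xor_) (odd-count-xor (λ i → p (suc i)) (λ i → q (suc i))) ⟩
  (p zero xor q zero) xor (odd p′ xor odd q′)
    ≡⟨ xor-interchange (p zero) (q zero) (odd p′) (odd q′) ⟩
  (p zero xor odd p′) xor (q zero xor odd q′)
    ≡⟨ cong₂ _xor_ (odd-δ (p zero) p′) (odd-δ (q zero) q′) ⟨
  odd (count p) xor odd (count q) ∎
  where
  open ≡-Reasoning
  p′ = count (λ i → p (suc i))
  q′ = count (λ i → q (suc i))

-- Induction by deleting vertex zero. Each remaining degree flips parity exactly at a neighbour of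
-- that vertex, so the number of odd degrees among them changes by deg 0 modulo 2, which cancels the
-- contribution of vertex zero itself.
handshake : (G : Graph N) → odd (count (λ v → odd (degree G v))) ≡ false
handshake {zero} G = refl
handshake {suc N} G = begin
  odd (δ (odd (degree G zero)) + count (λ v → odd (degree G (suc v))))
    ≡⟨ odd-δ (odd (degree G zero)) (count (λ v → odd (degree G (suc v)))) ⟩
  odd (degree G zero) xor odd (count (λ v → odd (degree G (suc v))))
    ≡⟨ cong₂ _xor_
         (cong (λ b → odd (δ b + count a)) (irrefl G zero))
         (cong odd (count-cong (λ v → trans (odd-δ (adj G (suc v) zero) (degree G′ v))
           (cong (_xor odd (degree G′ v)) (Defs.sym G (suc v) zero))))) ⟩
  odd (count a) xor odd (count (λ v → a v xor odd (degree G′ v)))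
    ≡⟨ cong (odd (count a) xor_) (trans (odd-count-xor a (λ v → odd (degree G′ v)))
         (trans (cong (odd (count a) xor_) (handshake G′)) (Bool.xor-identityʳ (odd (count a))))) ⟩
  odd (count a) xor odd (count a)
    ≡⟨ Bool.xor-same (odd (count a)) ⟩
  false ∎
  where
  open ≡-Reasoning
  a : Fin N → Bool
  a v = adj G zero (suc v)
  G′ : Graph N
  G′ = record
    { adj = λ i j → adj G (suc i) (suc j)
    ; sym = λ i j → Defs.sym G (suc i) (suc j)
    ; irrefl = λ i → irrefl G (suc i)
    }

-- The polytope of dual degree partitions

even-half : ∀ t → odd t ≡ false → Σ ℕ λ k → t ≡ k + k
odd-half : ∀ t → odd t ≡ true → Σ ℕ λ k → t ≡ suc (k + k)
even-half zero _ = 0 , refl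
even-half (suc t) e with odd-half t (trans (≡.sym (not-not (odd t))) (cong not e))
... | k , refl = suc k , cong suc (≡.sym (ℕ.+-suc k k))
odd-half (suc t) e with even-half t (trans (≡.sym (not-not (odd t))) (cong not e))
... | k , refl = k , refl

k+k≡2*k : ∀ k → k + k ≡ 2 * k
k+k≡2*k k = cong (k +_) (≡.sym (ℕ.+-identityʳ k))

half-≤ : ∀ {k m} → k + k ≤ 2 * m → k ≤ m
half-≤ {k} {m} h = ℕ.*-cancelˡ-≤ 2 (subst (_≤ 2 * m) (k+k≡2*k k) h)

half-< : ∀ {k m} → suc (k + k) ≤ 2 * m → suc k ≤ m
half-< {k} {m} h = ℕ.*-cancelˡ-< 2 k m (subst (ℕ._< 2 * m) (k+k≡2*k k) h)

dualPt-W : (G : Graph (suc d)) (D s : Fin (suc d)) → degree G zero ≡ toℕ s → (∀ v → degree G (suc v) ≡ toℕ D) →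
  dualPt G ≐ W (ℕ→ℚ d) D s
dualPt-W {d} G D s deg₀ degₛ i = begin
  ℕ→ℚ (δ (toℕ i ℕ.<ᵇ degree G zero) + count (λ v → toℕ i ℕ.<ᵇ degree G (suc v)))
    ≡⟨ cong ℕ→ℚ (cong₂ _+_ (cong (λ k → δ (toℕ i ℕ.<ᵇ k)) deg₀)
         (count-const (λ v → toℕ i ℕ.<ᵇ degree G (suc v)) (toℕ i ℕ.<ᵇ toℕ D) (λ v → cong (toℕ i ℕ.<ᵇ_) (degₛ v)))) ⟩
  ℕ→ℚ (δ (toℕ i ℕ.<ᵇ toℕ s) + δ (toℕ i ℕ.<ᵇ toℕ D) * d)
    ≡⟨ ℕ→ℚ-homo-+ (δ (toℕ i ℕ.<ᵇ toℕ s)) (δ (toℕ i ℕ.<ᵇ toℕ D) * d) ⟩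
  ℕ→ℚ (δ (toℕ i ℕ.<ᵇ toℕ s)) +ℚ ℕ→ℚ (δ (toℕ i ℕ.<ᵇ toℕ D) * d)
    ≡⟨ cong₂ _+ℚ_ (ℕ→ℚ-δ (toℕ i ℕ.<ᵇ toℕ s)) (scaled (toℕ i ℕ.<ᵇ toℕ D)) ⟩
  u (toℕ s) i +ℚ ℕ→ℚ d *ℚ u (toℕ D) i
    ≡⟨ solve 2 (λ a b → a :+ b := b :+ con 1ℚ :* a) refl (u (toℕ s) i) (ℕ→ℚ d *ℚ u (toℕ D) i) ⟩
  W (ℕ→ℚ d) D s i ∎
  where
  open ≡-Reasoning
  scaled : ∀ b → ℕ→ℚ (δ b * d) ≡ ℕ→ℚ d *ℚ ind b
  scaled true = trans (cong ℕ→ℚ (ℕ.+-identityʳ d)) (≡.sym (ℚ.*-identityʳ (ℕ→ℚ d)))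
  scaled false = ≡.sym (ℚ.*-zeroʳ (ℕ→ℚ d))

realization : ∀ m (D s : Fin (suc (2 * m))) → IsVertex D s →
  Σ (Graph (suc (2 * m))) λ G → W (ℕ→ℚ (2 * m)) D s ≐ dualPt G
realization m D s (es , inj₁ refl) = regular (even-half (toℕ s) es)
  where
  regular : Σ ℕ (λ k → toℕ s ≡ k + k) → Σ (Graph (suc (2 * m))) λ G → W (ℕ→ℚ (2 * m)) s s ≐ dualPt G
  regular (k , s≡) = proj₁ C , λ i → ≡.sym (dualPt-W (proj₁ C) s s
    (trans (proj₂ C zero) (≡.sym s≡)) (λ v → trans (proj₂ C (suc v)) (≡.sym s≡)) i)
    where
    -- Degree 2k on 2m + 1 vertices leaves out 2m - 2k = 2b nonzero distances.
    b = m ℕ.∸ k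
    b+k≡m : b + k ≡ m
    b+k≡m = ℕ.m∸n+n≡m (half-≤ {k} (subst (_≤ 2 * m) s≡ (ℕ.s≤s⁻¹ (Fin.toℕ<n s))))
    size : suc (2 * m) ≡ suc b + (k + k + b)
    size = cong suc (trans (cong (2 *_) (≡.sym b+k≡m))
      (S.solve 2 (λ b k → S.con 2 S.:* (b S.:+ k) S.:= b S.:+ (k S.:+ k S.:+ b)) refl b k))
      where module S = Data.Nat.Solver.+-*-Solver
    C = circulant (suc (2 * m)) b (k + k) size
realization m D s (es , inj₂ oD) = edge (even-half (toℕ s) es) (odd-half (toℕ D) oD)
  where
  edge : Σ ℕ (λ q → toℕ s ≡ q + q) → Σ ℕ (λ r → toℕ D ≡ suc (r + r)) →
    Σ (Graph (suc (2 * m))) λ G → W (ℕ→ℚ (2 * m)) D s ≐ dualPt G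
  edge (q , s≡) (r , D≡) = proj₁ A , λ i → ≡.sym (dualPt-W (proj₁ A) D s
    (trans (proj₁ (proj₂ A)) (≡.sym s≡)) (λ v → trans (proj₂ (proj₂ A) v) (≡.sym D≡)) i)
    where
    r<m : suc r ≤ m
    r<m = half-< (subst (_≤ 2 * m) D≡ (ℕ.s≤s⁻¹ (Fin.toℕ<n D)))
    -- Degree 2r + 1 on 2m vertices leaves out 2m - 1 - (2r + 1) = 2b nonzero distances, so b = m -
    -- (r + 1).
    A = apex (2 * m) m (m ℕ.∸ suc r) r q (cong (m +_) (ℕ.+-identityʳ m))
      (trans (≡.sym (ℕ.m∸n+n≡m r<m)) (ℕ.+-suc (m ℕ.∸ suc r) r))
      (half-≤ (subst (_≤ 2 * m) s≡ (ℕ.s≤s⁻¹ (Fin.toℕ<n s))))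

gap-antitone : (F : ℕ → ℕ) → (∀ k → F (suc k) ≤ F k) → (t : Fin (suc d)) →
  0ℚ ≤ℚ gap {d} (ℕ→ℚ (F 0)) (λ i → ℕ→ℚ (F (suc (toℕ i)))) t
gap-antitone {zero} F F↓ zero = ℕ→ℚ-nonneg (F 0)
gap-antitone {suc d} F F↓ zero = diff-nonneg (ℕ→ℚ-mono (F↓ 0))
gap-antitone {suc d} F F↓ (suc t) = gap-antitone (λ k → F (suc k)) (λ k → F↓ (suc k)) t

-- The bound n is the number of vertices of degree at least 0, that is `dualDeg G 0`, so all gaps
-- before the last are differences within one decreasing sequence.
dualPt-gap-nonneg : (G : Graph (suc d)) (t : Fin (suc d)) → 0ℚ ≤ℚ gap (ℕ→ℚ d +ℚ 1ℚ) (dualPt G) t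
dualPt-gap-nonneg {d} G t = subst (λ c → 0ℚ ≤ℚ gap c (dualPt G) t)
  (trans (cong ℕ→ℚ (trans (count-const {suc d} (λ _ → true) true (λ _ → refl)) (ℕ.+-identityʳ (suc d)))) (ℕ→ℚ-suc d))
  (gap-antitone (dualDeg G) decreasing t)
  where
  decreasing : ∀ k → dualDeg G (suc k) ≤ dualDeg G k
  decreasing k = count-mono (λ v → suc k ℕ.≤ᵇ degree G v) (λ v → k ℕ.≤ᵇ degree G v)
    (λ v h → ℕ.≤⇒≤ᵇ (ℕ.<⇒≤ (ℕ.≤ᵇ⇒≤ (suc k) (degree G v) h)))

dot-sgn-u : ∀ t → t ≤ d → dot {d} (λ i → sgn (toℕ i)) (u t) ≡ ind (odd t)
dot-sgn-u {d} t t≤d = trans (≡.sym (oddSum≡dot {d} 1ℚ (u t))) (subst (λ t → oddSum {d} 1ℚ (u t) ≡ ind (odd t))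
  (Fin.toℕ-fromℕ< (s≤s t≤d)) (at (Fin.fromℕ< (s≤s t≤d))))
  where
  at : (t : Fin (suc d)) → oddSum {d} 1ℚ (u (toℕ t)) ≡ ind (odd (toℕ t))
  at t = trans (sum-single (λ s → ind (odd (toℕ s)) *ℚ gap {d} 1ℚ (u (toℕ t)) s) t
      (λ s s≢t → trans (cong (ind (odd (toℕ s)) *ℚ_) (gap-u-≢ t s s≢t)) (ℚ.*-zeroʳ (ind (odd (toℕ s))))))
    (trans (cong (ind (odd (toℕ t)) *ℚ_) (gap-u-≡ t)) (ℚ.*-identityʳ (ind (odd (toℕ t)))))

-- Each vertex v adds u_(deg v) to the dual partition, and the alternating form sends u_t to 1 or 0
-- according to the parity of t.
oddSum-dualPt : (c : ℚ) (G : Graph (suc d)) → oddSum c (dualPt G) ≡ ℕ→ℚ (count (λ v → odd (degree G v)))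
oddSum-dualPt {d} c G = begin
  oddSum c (dualPt G)
    ≡⟨ oddSum≡dot c (dualPt G) ⟩
  dot a (dualPt G)
    ≡⟨ dot-congʳ a (λ i → trans (ℕ→ℚ-count (λ v → toℕ i ℕ.<ᵇ degree G v))
         (sum-cong {suc d} (λ v → ≡.sym (ℚ.*-identityˡ (u (degree G v) i))))) ⟩
  dot a (comb (λ _ → 1ℚ) (λ v → u (degree G v)))
    ≡⟨ dot-comb a (λ _ → 1ℚ) (λ v → u (degree G v)) ⟩
  sumFin (λ v → 1ℚ *ℚ dot a (u (degree G v)))
    ≡⟨ sum-cong {suc d} (λ v → trans (ℚ.*-identityˡ (dot a (u (degree G v))))
         (dot-sgn-u (degree G v) (count-false-≤ (adj G v) v (irrefl G v)))) ⟩
  sumFin (λ v → ind (odd (degree G v)))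
    ≡⟨ ℕ→ℚ-count (λ v → odd (degree G v)) ⟨
  ℕ→ℚ (count (λ v → odd (degree G v))) ∎
  where
  open ≡-Reasoning
  a : Pt d
  a i = sgn (toℕ i)

odd-double : ∀ k → odd (k + k) ≡ false
odd-double zero = refl
odd-double (suc k) = trans (cong (λ j → not (odd j)) (ℕ.+-suc k k)) (trans (not-not (odd (k + k))) (odd-double k))

dualPt-oddSum-≤ : ∀ m (c : ℚ) (G : Graph (suc (2 * m))) → oddSum c (dualPt G) ≤ℚ ℕ→ℚ (2 * m)
dualPt-oddSum-≤ m c G = subst (_≤ℚ ℕ→ℚ (2 * m)) (≡.sym (oddSum-dualPt c G))
  (ℕ→ℚ-mono (ℕ.s≤s⁻¹ (ℕ.≤∧≢⇒< (count-≤ (λ v → odd (degree G v))) notAll)))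
  where
  notAll : count (λ v → odd (degree G v)) ≢ suc (2 * m)
  notAll e = true≢false (trans (≡.sym (cong not (trans (cong odd (≡.sym (k+k≡2*k m))) (odd-double m))))
    (trans (cong odd (≡.sym e)) (handshake G)))

-- Slacks of the inequalities

slack : ∀ m → IneqIx m → Pt (2 * m) → ℚ
slack m j x = ineqRhs m j -ℚ dot (ineqCoef m j) x

slack-affine : ∀ m j → Affine (slack m j)
slack-affine m j = ineqCoef m j , ineqRhs m j , λ x → refl

upper-gap : (c : ℚ) (x : Pt d) → 1 ≤ d → c -ℚ dot (λ i → if toℕ i ℕ.≡ᵇ 0 then 1ℚ else 0ℚ) x ≡ gap c x zero
upper-gap {suc d} c x _ = cong (c -ℚ_) (trans
  (cong₂ _+ℚ_ (ℚ.*-identityˡ (x zero)) (sum-zero {d} (λ i → ℚ.*-zeroˡ (x (suc i)))))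
  (ℚ.+-identityʳ (x zero)))

0-0*x+y : ∀ x y → 0ℚ -ℚ (0ℚ *ℚ x +ℚ y) ≡ 0ℚ -ℚ y
0-0*x+y = solve 2 (λ x y → con 0ℚ :- (con 0ℚ :* x :+ y) := con 0ℚ :- y) refl

mono-gap : (t : ℕ) (s : Fin (suc d)) (c : ℚ) (x : Pt d) → toℕ s ≡ suc t → suc (suc t) ≤ d →
  0ℚ -ℚ dot (λ i → if toℕ i ℕ.≡ᵇ suc t then 1ℚ else (if toℕ i ℕ.≡ᵇ t then ⊖ 1ℚ else 0ℚ)) x ≡ gap c x s
mono-gap {suc (suc d)} zero (suc zero) c x refl _ = trans
  (cong (λ z → 0ℚ -ℚ (⊖ 1ℚ *ℚ x zero +ℚ (1ℚ *ℚ x (suc zero) +ℚ z))) (sum-zero {d} (λ i → ℚ.*-zeroˡ (x (suc (suc i))))))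
  (solve 2 (λ x y → con 0ℚ :- (:- con 1ℚ :* x :+ (con 1ℚ :* y :+ con 0ℚ)) := x :- y) refl (x zero) (x (suc zero)))
mono-gap {suc d} (suc t) (suc s) c x e (s≤s h) = trans
  (0-0*x+y (x zero) (dot (λ i → if toℕ i ℕ.≡ᵇ suc t then 1ℚ else (if toℕ i ℕ.≡ᵇ t then ⊖ 1ℚ else 0ℚ)) (λ i → x (suc i))))
  (mono-gap t s (x zero) (λ i → x (suc i)) (ℕ.suc-injective e) h)

nonneg-gap : (s : Fin (suc d)) (c : ℚ) (x : Pt d) → toℕ s ≡ d → 1 ≤ d →
  0ℚ -ℚ dot (λ i → if suc (toℕ i) ℕ.≡ᵇ d then ⊖ 1ℚ else 0ℚ) x ≡ gap c x s
nonneg-gap {suc zero} (suc zero) c x e _ =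
  solve 1 (λ x → con 0ℚ :- (:- con 1ℚ :* x :+ con 0ℚ) := x) refl (x zero)
nonneg-gap {suc (suc d)} (suc s) c x e _ = trans
  (0-0*x+y (x zero) (dot (λ i → if suc (toℕ i) ℕ.≡ᵇ suc d then ⊖ 1ℚ else 0ℚ) (λ i → x (suc i))))
  (nonneg-gap s (x zero) (λ i → x (suc i)) (ℕ.suc-injective e) (s≤s z≤n))

module Slacks (m : ℕ) (1≤m : 1 ≤ m) where

  -- Writing n as `M +ℚ 1ℚ`, and not as `ℕ→ℚ (suc (2 * m))`, lets the ring solver treat it as a
  -- polynomial in M.
  M n : ℚ
  M = ℕ→ℚ (2 * m)
  n = M +ℚ 1ℚ

  1≤2m : 1 ≤ 2 * m
  1≤2m = ℕ.≤-trans 1≤m (ℕ.m≤m+n m (1 * m))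

  0<M : 0ℚ < M
  0<M = ℕ→ℚ-pos 1≤2m

  slack-alt : ∀ x → slack m alt x ≡ M -ℚ oddSum n x
  slack-alt x = cong (M -ℚ_) (≡.sym (oddSum≡dot n x))

  slack-upper : ∀ x → slack m upper x ≡ gap n x zero
  slack-upper x = trans (cong (_-ℚ dot (ineqCoef m upper) x) (ℕ→ℚ-suc (2 * m))) (upper-gap n x 1≤2m)

  -- The facets of the simplex are indexed by their opposite vertices: index 0 is `upper`, the last
  -- index is `nonneg`, and those between are the `mono` inequalities.
  gap-slack : (t : Fin (suc (2 * m))) → Σ (IneqIx m) λ j → ∀ x → slack m j x ≡ gap n x t
  gap-slack zero = upper , slack-upper
  gap-slack (suc s) = last? (suc (suc (toℕ s)) ℕ.≤? 2 * m)
    where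
    last? : Dec (suc (suc (toℕ s)) ≤ 2 * m) → Σ (IneqIx m) λ j → ∀ x → slack m j x ≡ gap n x (suc s)
    last? (yes h) = mono (toℕ s) h , λ x → mono-gap (toℕ s) (suc s) n x refl h
    last? (no ¬h) = nonneg , λ x → nonneg-gap (suc s) n x
      (ℕ.≤-antisym (Fin.toℕ<n s) (ℕ.s≤s⁻¹ (ℕ.≰⇒> ¬h))) 1≤2m

  slack-gap : ∀ j → j ≡ alt ⊎ Σ (Fin (suc (2 * m))) λ t → ∀ x → slack m j x ≡ gap n x t
  slack-gap upper = inj₂ (zero , slack-upper)
  slack-gap (mono t h) = inj₂ (Fin.fromℕ< t< , λ x → mono-gap t (Fin.fromℕ< t<) n x (Fin.toℕ-fromℕ< t<) h)
    where
    t< : suc t ℕ.< suc (2 * m)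
    t< = s≤s (ℕ.<⇒≤ h)
  slack-gap nonneg = inj₂ (Fin.fromℕ (2 * m) , λ x → nonneg-gap (Fin.fromℕ (2 * m)) n x (Fin.toℕ-fromℕ (2 * m)) 1≤2m)
  slack-gap alt = inj₁ refl

  gap-affine : ∀ t → Affine (λ x → gap n x t)
  gap-affine t = Affine-cong (λ x → ≡.sym (proj₂ (gap-slack t) x)) (slack-affine m (proj₁ (gap-slack t)))

  alt-affine : Affine (λ x → M -ℚ oddSum n x)
  alt-affine = Affine-cong (λ x → ≡.sym (slack-alt x)) (slack-affine m alt)

  Poly : Pt (2 * m) → Set
  Poly = Q (suc (2 * m))

  affine-nonneg : {F : Pt (2 * m) → ℚ} → Affine F → (∀ G → 0ℚ ≤ℚ F (dualPt G)) → ∀ x → Poly x → 0ℚ ≤ℚ F x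
  affine-nonneg aff h x (k , w , g , 0≤w , Σw≡1 , x≐) =
    subst (0ℚ ≤ℚ_) (≡.sym (affine-combination aff w (λ i → dualPt (g i)) x Σw≡1 x≐))
      (sum-nonneg {k} (λ i → *-nonneg (0≤w i) (h (g i))))

  Poly-gap : ∀ x → Poly x → ∀ t → 0ℚ ≤ℚ gap n x t
  Poly-gap x x∈Q t = affine-nonneg (gap-affine t) (λ G → dualPt-gap-nonneg G t) x x∈Q

  Poly-alt : ∀ x → Poly x → 0ℚ ≤ℚ M -ℚ oddSum n x
  Poly-alt = affine-nonneg alt-affine (λ G → diff-nonneg (dualPt-oddSum-≤ m n G))

  Poly-slack : ∀ x → Poly x → ∀ j → 0ℚ ≤ℚ slack m j x
  Poly-slack x x∈Q j = cases j (slack-gap j)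
    where
    cases : ∀ j → j ≡ alt ⊎ Σ (Fin (suc (2 * m))) (λ t → ∀ x → slack m j x ≡ gap n x t) → 0ℚ ≤ℚ slack m j x
    cases _ (inj₁ refl) = subst (0ℚ ≤ℚ_) (≡.sym (slack-alt x)) (Poly-alt x x∈Q)
    cases _ (inj₂ (t , h)) = subst (0ℚ ≤ℚ_) (≡.sym (h x)) (Poly-gap x x∈Q t)

  Graphic : Pt (2 * m) → Set
  Graphic p = Σ (Graph (suc (2 * m))) λ G → p ≐ dualPt G

  cone⇒Poly : ∀ {x} → Cone Graphic 1ℚ x → Poly x
  cone⇒Poly C = family C
    where
    -- The definition of `Q` with total weight T in place of 1, since the tail of a convex
    -- combination has smaller weight.
    Family : ℚ → Pt (2 * m) → Set
    Family T x = Σ ℕ λ k → Σ (Fin k → ℚ) λ w → Σ (Fin k → Graph (suc (2 * m))) λ g →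
      (∀ i → 0ℚ ≤ℚ w i) × (sumFin w ≡ T) × (∀ j → x j ≡ sumFin (λ i → w i *ℚ dualPt (g i) j))
    extend : ∀ {w₀ T T′ p x x′} → 0ℚ ≤ℚ w₀ → Graphic p → T′ ≡ w₀ +ℚ T → (∀ j → x′ j ≡ w₀ *ℚ p j +ℚ x j) →
      Family T x → Family T′ x′
    extend {w₀} 0≤w₀ (G , p≐) e h (k , w , g , 0≤w , Σw≡ , x≐) = suc k , w′ , g′ , 0≤w′ ,
      trans (cong (w₀ +ℚ_) Σw≡) (≡.sym e) , λ j → trans (h j) (cong₂ (λ s t → w₀ *ℚ s +ℚ t) (p≐ j) (x≐ j))
      where
      w′ : Fin (suc k) → ℚ
      w′ zero = w₀
      w′ (suc i) = w i
      g′ : Fin (suc k) → Graph (suc (2 * m))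
      g′ zero = G
      g′ (suc i) = g i
      0≤w′ : ∀ i → 0ℚ ≤ℚ w′ i
      0≤w′ zero = 0≤w₀
      0≤w′ (suc i) = 0≤w i
    family : ∀ {T x} → Cone Graphic T x → Family T x
    family (nil h) = 0 , (λ ()) , (λ ()) , (λ ()) , refl , h
    family (cons 0≤w₀ p∈ C e h) = extend 0≤w₀ p∈ e h (family C)

  vertex∈Graphic : ∀ p → VertexPt M p → Graphic p
  vertex∈Graphic p (D , s , v , p≐) = proj₁ (realization m D s v) , λ i → trans (p≐ i) (proj₂ (realization m D s v) i)

  vertex∈Poly : ∀ D s → IsVertex D s → Poly (W M D s)
  vertex∈Poly D s v = cone⇒Poly (cone-point (realization m D s v))

  slack⇒vertexCone : ∀ x → (∀ j → 0ℚ ≤ℚ slack m j x) → Cone (VertexPt M) 1ℚ x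
  slack⇒vertexCone x h = vertex-decomposition M 0<M x
    (λ t → subst (0ℚ ≤ℚ_) (proj₂ (gap-slack t) x) (h (proj₁ (gap-slack t))))
    (diff-nonneg⁻¹ (subst (0ℚ ≤ℚ_) (slack-alt x) (h alt)))

  slack⇒Poly : ∀ x → (∀ j → 0ℚ ≤ℚ slack m j x) → Poly x
  slack⇒Poly x h = cone⇒Poly (cone-concat (λ p v → cone-point (vertex∈Graphic p v)) (slack⇒vertexCone x h))

  Poly⇔inequalities : ∀ x → Poly x ⇔ (∀ j → dot (ineqCoef m j) x ≤ℚ ineqRhs m j)
  Poly⇔inequalities x = mk⇔ (λ x∈Q j → diff-nonneg⁻¹ (Poly-slack x x∈Q j)) (λ h → slack⇒Poly x (λ j → diff-nonneg (h j)))

-- Facets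

-- `IsFacetIneq` leaves the dimension existential; this identifies it with the computed value 2m.
AffDim-unique : {S : Pt d → Set} → ∀ {r s} → AffDim S r → AffDim S s → r ≡ s
AffDim-unique {S = S} {r} {s} (hr , ¬hr) (hs , ¬hs) with ℕ.<-cmp r s
... | tri< r<s _ _ = ⊥-elim (¬hr (HasAffIndep-mono {S = S} (ℕ.≤⇒≤′ (s≤s r<s)) hs))
... | tri≈ _ r≡s _ = r≡s
... | tri> _ _ s<r = ⊥-elim (¬hs (HasAffIndep-mono {S = S} (ℕ.≤⇒≤′ (s≤s s<r)) hr))

¬HasAffIndep-excess : {S : Pt d → Set} → ¬ HasAffIndep S (suc (suc d))
¬HasAffIndep-excess (p , _ , indep) = ¬AffIndep-excess p indep

¬AffIndep-hyperplane : {F : Pt d → ℚ} → Affine F → (q : Pt d) → F q ≢ 0ℚ →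
  (p : Fin (suc d) → Pt d) → AffIndep p → ¬ (∀ i → F (p i) ≡ 0ℚ)
¬AffIndep-hyperplane aff q Fq≢0 p indep Fp≡0 = ¬AffIndep-excess (q ◂ p) (AffIndep-extend aff p q indep Fp≡0 Fq≢0)

-- Adjoining `q`, on the second hyperplane but off the first, and then `q′`, off the second, would
-- give d + 2 affinely independent points.
¬AffIndep-two-hyperplanes : {F G : Pt d → ℚ} → Affine F → Affine G → (q q′ : Pt d) →
  F q ≢ 0ℚ → G q ≡ 0ℚ → G q′ ≢ 0ℚ →
  (p : Fin d → Pt d) → AffIndep p → (∀ i → F (p i) ≡ 0ℚ) → ¬ (∀ i → G (p i) ≡ 0ℚ)
¬AffIndep-two-hyperplanes {d} {F} {G} affF affG q q′ Fq≢0 Gq≡0 Gq′≢0 p indep Fp≡0 Gp≡0 =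
  ¬AffIndep-hyperplane affG q′ Gq′≢0 (q ◂ p) (AffIndep-extend affF p q indep Fp≡0 Fq≢0) on-G
  where
  on-G : ∀ i → G ((q ◂ p) i) ≡ 0ℚ
  on-G zero = Gq≡0
  on-G (suc i) = Gp≡0 i

basis : Fin d → Pt d
basis i j = ind (Relation.Nullary.does (j Fin.≟ i))

dot-basis : (a : Pt d) (i : Fin d) → dot a (basis i) ≡ a i
dot-basis a i = trans
  (sum-single (λ j → a j *ℚ basis i j) i
    (λ j j≢i → trans (cong (λ b → a j *ℚ ind b) (dec-false (j Fin.≟ i) j≢i)) (ℚ.*-zeroʳ (a j))))
  (trans (cong (λ b → a i *ℚ ind b) (dec-true (i Fin.≟ i) refl)) (ℚ.*-identityʳ (a i)))

-- Evaluation at the origin compares the constants, and then evaluation at the unit vectors compares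
-- the coefficients.
affine-proportional : (a a′ : Pt d) (b b′ c : ℚ) → (∀ x → b -ℚ dot a x ≡ c *ℚ (b′ -ℚ dot a′ x)) →
  (∀ i → a i ≡ c *ℚ a′ i) × (b ≡ c *ℚ b′)
affine-proportional {d} a a′ b b′ c h = a≡ , b≡
  where
  open ≡-Reasoning
  b≡ : b ≡ c *ℚ b′
  b≡ = begin
    b                                     ≡⟨ ℚ.+-identityʳ b ⟨
    b -ℚ 0ℚ                               ≡⟨ cong (b -ℚ_) (dot-zeroʳ a) ⟨
    b -ℚ dot a (λ _ → 0ℚ)                 ≡⟨ h (λ _ → 0ℚ) ⟩
    c *ℚ (b′ -ℚ dot a′ (λ _ → 0ℚ))        ≡⟨ cong (λ z → c *ℚ (b′ -ℚ z)) (dot-zeroʳ a′) ⟩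
    c *ℚ (b′ -ℚ 0ℚ)                       ≡⟨ cong (c *ℚ_) (ℚ.+-identityʳ b′) ⟩
    c *ℚ b′                               ∎
  a≡ : ∀ i → a i ≡ c *ℚ a′ i
  a≡ i = begin
    a i                                   ≡⟨ solve 2 (λ a b → a := b :- (b :- a)) refl (a i) b ⟩
    b -ℚ (b -ℚ a i)                       ≡⟨ cong₂ (λ z s → z -ℚ (b -ℚ s)) b≡ (≡.sym (dot-basis a i)) ⟩
    c *ℚ b′ -ℚ (b -ℚ dot a (basis i))     ≡⟨ cong (c *ℚ b′ -ℚ_) (h (basis i)) ⟩
    c *ℚ b′ -ℚ c *ℚ (b′ -ℚ dot a′ (basis i))
      ≡⟨ cong (λ s → c *ℚ b′ -ℚ c *ℚ (b′ -ℚ s)) (dot-basis a′ i) ⟩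
    c *ℚ b′ -ℚ c *ℚ (b′ -ℚ a′ i)          ≡⟨ solve 3 (λ c b a → c :* b :- c :* (b :- a) := c :* a) refl c b′ (a′ i) ⟩
    c *ℚ a′ i                             ∎

argmin : (f : Fin N → ℚ) (P : Fin N → Bool) →
  (∀ i → P i ≡ false) ⊎ Σ (Fin N) λ k → (P k ≡ true) × (∀ i → P i ≡ true → f k ≤ℚ f i)
argmin {zero} f P = inj₁ (λ ())
argmin {suc N} f P = merge (P zero) refl (argmin (λ i → f (suc i)) (λ i → P (suc i)))
  where
  Min : Set
  Min = Σ (Fin (suc N)) λ k → (P k ≡ true) × (∀ i → P i ≡ true → f k ≤ℚ f i)
  merge : ∀ b → P zero ≡ b →
    (∀ i → P (suc i) ≡ false) ⊎ (Σ (Fin N) λ k → (P (suc k) ≡ true) × (∀ i → P (suc i) ≡ true → f (suc k) ≤ℚ f (suc i))) →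
    (∀ i → P i ≡ false) ⊎ Min
  merge false P0 (inj₁ none) = inj₁ λ { zero → P0 ; (suc i) → none i }
  merge true P0 (inj₁ none) = inj₂ (zero , P0 , λ
    { zero _ → ℚ.≤-refl ; (suc i) Pi → ⊥-elim (true≢false (trans (≡.sym Pi) (none i))) })
  merge false P0 (inj₂ (k , Pk , min)) = inj₂ (suc k , Pk , λ
    { zero P0′ → ⊥-elim (true≢false (trans (≡.sym P0′) P0)) ; (suc i) Pi → min i Pi })
  merge true P0 (inj₂ (k , Pk , min)) = compare (ℚ.≤-total (f zero) (f (suc k)))
    where
    compare : f zero ≤ℚ f (suc k) ⊎ f (suc k) ≤ℚ f zero → (∀ i → P i ≡ false) ⊎ Min
    compare (inj₁ le) = inj₂ (zero , P0 , λ { zero _ → ℚ.≤-refl ; (suc i) Pi → ℚ.≤-trans le (min i Pi) })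
    compare (inj₂ ge) = inj₂ (suc k , Pk , λ { zero _ → ge ; (suc i) Pi → min i Pi })

module Facets (m : ℕ) (1≤m : 1 ≤ m) where

  open Slacks m 1≤m

  Vertex : Set
  Vertex = Fin (suc (2 * m))

  2≤2m : 2 ≤ 2 * m
  2≤2m = ℕ.*-monoʳ-≤ 2 1≤m

  v₁ v₂ : Vertex
  v₁ = Fin.fromℕ< (s≤s 1≤2m)
  v₂ = Fin.fromℕ< (s≤s 2≤2m)

  v₁-odd : odd (toℕ v₁) ≡ true
  v₁-odd = cong odd (Fin.toℕ-fromℕ< (s≤s 1≤2m))

  v₂-even : odd (toℕ v₂) ≡ false
  v₂-even = cong odd (Fin.toℕ-fromℕ< (s≤s 2≤2m))

  zero≢v₂ : zero ≢ v₂
  zero≢v₂ e = zero≢2 (trans (cong toℕ e) (Fin.toℕ-fromℕ< (s≤s 2≤2m)))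
    where
    zero≢2 : 0 ≢ 2
    zero≢2 ()

  M≢0 : M ≢ 0ℚ
  M≢0 = 0<⇒≢0 0<M

  0<n : 0ℚ < n
  0<n = +-pos-nonneg 0<M (ℚ.nonNegative⁻¹ 1ℚ)

  n≢0 : n ≢ 0ℚ
  n≢0 = 0<⇒≢0 0<n

  gap-W-D≢0 : ∀ t s → gap {2 * m} n (W M t s) t ≢ 0ℚ
  gap-W-D≢0 t s = cases (t Fin.≟ s)
    where
    cases : Dec (t ≡ s) → gap {2 * m} n (W M t s) t ≢ 0ℚ
    cases (yes refl) e = n≢0 (trans (≡.sym (gap-W-≡ M t)) e)
    cases (no t≢s) e = M≢0 (trans (≡.sym (gap-W-D M t s t≢s)) e)

  gap-W-s≢0 : ∀ D s → D ≢ s → gap {2 * m} n (W M D s) s ≢ 0ℚ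
  gap-W-s≢0 D s D≢s e = ℚ.1≢0 (trans (≡.sym (gap-W-s M D s D≢s)) e)

  alt-zero : ∀ D s → odd (toℕ D) ≡ true → odd (toℕ s) ≡ false → M -ℚ oddSum {2 * m} n (W M D s) ≡ 0ℚ
  alt-zero D s oD es = trans (cong (M -ℚ_) (oddSum-W M D s oD es)) (ℚ.+-inverseʳ M)

  origin : Pt (2 * m)
  origin = W M zero zero

  origin∈Poly : Poly origin
  origin∈Poly = vertex∈Poly zero zero (refl , inj₁ refl)

  alt-origin≢0 : M -ℚ oddSum n origin ≢ 0ℚ
  alt-origin≢0 e = M≢0 (trans (≡.sym (trans (cong (M -ℚ_) oddSum≡0) (ℚ.+-identityʳ M))) e)
    where
    term : ∀ t → ind (odd (toℕ t)) *ℚ gap n origin t ≡ 0ℚ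
    term zero = ℚ.*-zeroˡ (gap n origin zero)
    term (suc t) = trans (cong (ind (odd (toℕ (suc t))) *ℚ_) (gap-W-off M zero zero (suc t) (λ ()) (λ ())))
      (ℚ.*-zeroʳ (ind (odd (toℕ (suc t)))))
    oddSum≡0 : oddSum n origin ≡ 0ℚ
    oddSum≡0 = sum-zero {suc (2 * m)} term

  -- The neighbour along which an odd vertex is cut off; even vertices stay.
  base : Vertex → Vertex → Vertex
  base e t = if odd (toℕ t) then e else t

  base-vertex : ∀ e → odd (toℕ e) ≡ false → ∀ t → IsVertex t (base e t)
  base-vertex e ee t = cases (odd (toℕ t)) refl
    where
    cases : ∀ b → odd (toℕ t) ≡ b → IsVertex t (if b then e else t)
    cases true ot = ee , inj₂ ot
    cases false et = et , inj₁ refl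

  base-≢ : ∀ {e s} t → s ≢ e → s ≢ t → s ≢ base e t
  base-≢ t s≢e s≢t with odd (toℕ t)
  ... | true = s≢e
  ... | false = s≢t

  OnFacet : IneqIx m → Pt (2 * m) → Set
  OnFacet j x = Poly x × (slack m j x ≡ 0ℚ)

  -- One point for each vertex t other than i: the simplex vertex itself if t is even, otherwise the
  -- cut of the edge from t to a fixed even e. Gap t detects the point of t; only gap e is nonzero
  -- at many of them, so e is the exempt index.
  gapFacet-points : (i : Vertex) → HasAffIndep (λ x → Poly x × (gap n x i ≡ 0ℚ)) (2 * m)
  gapFacet-points i = p , (λ s → vertex∈Poly (v s) (base e (v s)) (base-vertex e e-even (v s)) ,
      gap-W-off M (v s) (base e (v s)) i (i≢v s) (base-≢ (v s) i≢e (i≢v s))) ,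
    AffIndep-diagonal p exempt (λ s x → gap n x (v s)) (λ s _ → gap-affine (v s))
      (λ s s≢ → gap-W-D≢0 (v s) (base e (v s)))
      (λ s s≢ t t≢s → gap-W-off M (v t) (base e (v t)) (v s) (v-inj t≢s) (base-≢ (v t) (v≢e s≢) (v-inj t≢s)))
    where
    -- Vertex 0 serves every facet except its own opposite one, for which vertex 2 takes over; it
    -- exists because m is positive.
    even≢ : (i : Vertex) → Σ Vertex λ e → odd (toℕ e) ≡ false × i ≢ e
    even≢ zero = v₂ , v₂-even , zero≢v₂
    even≢ (suc i) = zero , refl , λ ()
    e = proj₁ (even≢ i)
    e-even = proj₁ (proj₂ (even≢ i))
    i≢e = proj₂ (proj₂ (even≢ i))
    v : Fin (2 * m) → Vertex
    v = punchIn i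
    p : Fin (2 * m) → Pt (2 * m)
    p s = W M (v s) (base e (v s))
    exempt = Fin.punchOut i≢e
    i≢v : ∀ s → i ≢ v s
    i≢v s i≡ = Fin.punchInᵢ≢i i s (≡.sym i≡)
    v≢e : ∀ {s} → s ≢ exempt → v s ≢ e
    v≢e s≢ vs≡e = s≢ (Fin.punchIn-injective i _ _ (trans vs≡e (≡.sym (Fin.punchIn-punchOut i≢e))))
    v-inj : ∀ {s t} → t ≢ s → v s ≢ v t
    v-inj t≢s vs≡vt = t≢s (≡.sym (Fin.punchIn-injective i _ _ vs≡vt))

  -- A spanning tree of the odd-even edges: every odd t is joined to the hub 0, and every even t to
  -- the hub 1. Its 2m edges give as many points on the alternating hyperplane.
  edgeTop edgeBase : Vertex → Vertex
  edgeTop t = if odd (toℕ t) then t else v₁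
  edgeBase t = if odd (toℕ t) then zero else t

  edgeTop-odd : ∀ t → odd (toℕ (edgeTop t)) ≡ true
  edgeTop-odd t = cases (odd (toℕ t)) refl
    where
    cases : ∀ b → odd (toℕ t) ≡ b → odd (toℕ (if b then t else v₁)) ≡ true
    cases true ot = ot
    cases false _ = v₁-odd

  edgeBase-even : ∀ t → odd (toℕ (edgeBase t)) ≡ false
  edgeBase-even t = cases (odd (toℕ t)) refl
    where
    cases : ∀ b → odd (toℕ t) ≡ b → odd (toℕ (if b then zero else t)) ≡ false
    cases true _ = refl
    cases false et = et

  edgePt : Vertex → Pt (2 * m)
  edgePt t = W M (edgeTop t) (edgeBase t)

  edgePt-alt : ∀ t → M -ℚ oddSum n (edgePt t) ≡ 0ℚ
  edgePt-alt t = alt-zero (edgeTop t) (edgeBase t) (edgeTop-odd t) (edgeBase-even t)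

  edgePt-gap≢0 : ∀ t → gap n (edgePt t) t ≢ 0ℚ
  edgePt-gap≢0 t = cases (odd (toℕ t)) refl
    where
    cases : ∀ b → odd (toℕ t) ≡ b → gap {2 * m} n (W M (if b then t else v₁) (if b then zero else t)) t ≢ 0ℚ
    cases true ot = gap-W-D≢0 t zero
    cases false et = gap-W-s≢0 v₁ t (odd≢even {D = v₁} {s = t} v₁-odd et)

  edgePt-gap≡0 : ∀ t s → s ≢ v₁ → s ≢ zero → s ≢ t → gap n (edgePt t) s ≡ 0ℚ
  edgePt-gap≡0 t s s≢v₁ s≢0 s≢t = gap-W-off M (edgeTop t) (edgeBase t) s top bottom
    where
    top : s ≢ edgeTop t
    top with odd (toℕ t)
    ... | true = s≢t
    ... | false = s≢v₁
    bottom : s ≢ edgeBase t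
    bottom with odd (toℕ t)
    ... | true = s≢0
    ... | false = s≢t

  -- Vertex 0 is skipped, because its tree edge is also that of vertex 1. Every other non-hub vertex
  -- is a leaf of the tree, so its gap detects its edge, and the hub 1 is exempt.
  altFacet-points : HasAffIndep (λ x → Poly x × (M -ℚ oddSum n x ≡ 0ℚ)) (2 * m)
  altFacet-points = p , (λ s → vertex∈Poly (edgeTop (suc s)) (edgeBase (suc s)) (edgeBase-even (suc s) , inj₂ (edgeTop-odd (suc s))) ,
      edgePt-alt (suc s)) ,
    AffIndep-diagonal p exempt (λ s x → gap n x (suc s)) (λ s _ → gap-affine (suc s))
      (λ s _ → edgePt-gap≢0 (suc s))
      (λ s s≢ t t≢s → edgePt-gap≡0 (suc t) (suc s) (λ e → s≢ (Fin.suc-injective e)) (λ ())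
        (λ e → t≢s (≡.sym (Fin.suc-injective e))))
    where
    p : Fin (2 * m) → Pt (2 * m)
    p s = edgePt (suc s)
    exempt : Fin (2 * m)
    exempt = Fin.fromℕ< 1≤2m

  facet-points : ∀ j → HasAffIndep (OnFacet j) (2 * m)
  facet-points j = cases j (slack-gap j)
    where
    cases : ∀ j → j ≡ alt ⊎ Σ Vertex (λ t → ∀ x → slack m j x ≡ gap n x t) → HasAffIndep (OnFacet j) (2 * m)
    cases _ (inj₁ refl) = proj₁ altFacet-points , (λ i → proj₁ (proj₁ (proj₂ altFacet-points) i) ,
      trans (slack-alt (proj₁ altFacet-points i)) (proj₂ (proj₁ (proj₂ altFacet-points) i))) , proj₂ (proj₂ altFacet-points)
    cases j (inj₂ (t , h)) = proj₁ G , (λ i → proj₁ (proj₁ (proj₂ G) i) ,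
      trans (h (proj₁ G i)) (proj₂ (proj₁ (proj₂ G) i))) , proj₂ (proj₂ G)
      where G = gapFacet-points t

  off-facet : ∀ j → Σ (Pt (2 * m)) λ q → Poly q × slack m j q ≢ 0ℚ
  off-facet j = cases j (slack-gap j)
    where
    cases : ∀ j → j ≡ alt ⊎ Σ Vertex (λ t → ∀ x → slack m j x ≡ gap n x t) → Σ (Pt (2 * m)) λ q → Poly q × slack m j q ≢ 0ℚ
    cases _ (inj₁ refl) = origin , origin∈Poly , λ e → alt-origin≢0 (trans (≡.sym (slack-alt origin)) e)
    cases j (inj₂ (t , h)) = W M t (base zero t) , vertex∈Poly t (base zero t) (base-vertex zero refl t) ,
      λ e → gap-W-D≢0 t (base zero t) (trans (≡.sym (h (W M t (base zero t)))) e)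

  Poly-points : HasAffIndep Poly (suc (2 * m))
  Poly-points = q ◂ p , members , AffIndep-extend (slack-affine m alt) p q (proj₂ (proj₂ (facet-points alt)))
      (λ i → proj₂ (proj₁ (proj₂ (facet-points alt)) i)) (proj₂ (proj₂ (off-facet alt)))
    where
    p = proj₁ (facet-points alt)
    q = proj₁ (off-facet alt)
    members : ∀ i → Poly ((q ◂ p) i)
    members zero = proj₁ (proj₂ (off-facet alt))
    members (suc i) = proj₁ (proj₁ (proj₂ (facet-points alt)) i)

  Poly-dim : AffDim Poly (2 * m)
  Poly-dim = Poly-points , ¬HasAffIndep-excess {S = Poly}

  Proportional : Pt (2 * m) → ℚ → Set
  Proportional a b = Σ (IneqIx m) λ j → Σ ℚ λ c → (0ℚ < c) × (∀ i → a i ≡ c *ℚ ineqCoef m j i) × (b ≡ c *ℚ ineqRhs m j)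

  proportional⇒facet : ∀ a b → Proportional a b → IsFacetIneq Poly a b
  proportional⇒facet a b (j , c , 0<c , a≡ , b≡) = valid , r ,
      -- The definition wants the dimension of the polytope in successor form; the point counts 2m
      -- and 2m + 1 for the face are rewritten along with it.
      subst (AffDim Poly) 2m≡1+r Poly-dim ,
      subst (λ k → HasAffIndep (Face Poly a b) k × ¬ HasAffIndep (Face Poly a b) (suc k)) 2m≡1+r (points , ¬more)
    where
    open ≡-Reasoning
    r = ℕ.pred (2 * m)
    2m≡1+r : 2 * m ≡ suc r
    2m≡1+r = ≡.sym (ℕ.suc-pred (2 * m) {{ℕ.>-nonZero 1≤2m}})
    dot-a : ∀ x → dot a x ≡ c *ℚ dot (ineqCoef m j) x
    dot-a x = trans (dot-congˡ x a≡) (trans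
      (sum-cong {2 * m} (λ i → ℚ.*-assoc c (ineqCoef m j i) (x i))) (sum-*ˡ c (λ i → ineqCoef m j i *ℚ x i)))
    scaled : ∀ x → b -ℚ dot a x ≡ c *ℚ slack m j x
    scaled x = trans (cong₂ _-ℚ_ b≡ (dot-a x))
      (solve 3 (λ c s t → c :* s :- c :* t := c :* (s :- t)) refl c (ineqRhs m j) (dot (ineqCoef m j) x))
    valid : Valid Poly a b
    valid x x∈Q = diff-nonneg⁻¹ (subst (0ℚ ≤ℚ_) (≡.sym (scaled x)) (*-nonneg (ℚ.<⇒≤ 0<c) (Poly-slack x x∈Q j)))
    points : HasAffIndep (Face Poly a b) (2 * m)
    points = proj₁ (facet-points j) , (λ i → proj₁ (proj₁ (proj₂ (facet-points j)) i) , tight i) , proj₂ (proj₂ (facet-points j))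
      where
      tight : ∀ i → dot a (proj₁ (facet-points j) i) ≡ b
      tight i = ≡.sym (diff≡0 (trans (scaled (proj₁ (facet-points j) i))
        (trans (cong (c *ℚ_) (proj₂ (proj₁ (proj₂ (facet-points j)) i))) (ℚ.*-zeroʳ c))))
    ¬more : ¬ HasAffIndep (Face Poly a b) (suc (2 * m))
    ¬more (p , p∈ , indep) = ¬AffIndep-hyperplane (slack-affine m j) (proj₁ (off-facet j)) (proj₂ (proj₂ (off-facet j))) p indep
      (λ i → p*q≡0⇒q≡0 (0<⇒≢0 0<c) (trans (≡.sym (scaled (p i)))
        (trans (cong (b -ℚ_) (proj₂ (p∈ i))) (ℚ.+-inverseʳ b))))

-- LP duality in barycentric coordinates: with f t the slack at the t-th simplex vertex and
-- e the least slack at an even vertex,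
--   M n (b − a·x) = Σ_t y_t h_t + e n (M − O),  h_t = M (f t − e) (t even),  h_t = M f t + e (t odd),
-- and every h_t ≥ 0 because the inequality is valid at the points W.
module FacetNecessity (m : ℕ) (1≤m : 1 ≤ m) (a : Pt (2 * m)) (b : ℚ) (valid : Valid (Q (suc (2 * m))) a b) where

  open Slacks m 1≤m
  open Facets m 1≤m
  open ≡-Reasoning

  f : Vertex → ℚ
  f t = b -ℚ n *ℚ dot a (u (toℕ t))

  dot-W : ∀ D s → dot a (W M D s) ≡ M *ℚ dot a (u (toℕ D)) +ℚ 1ℚ *ℚ dot a (u (toℕ s))
  dot-W D s = dot-linear a M 1ℚ (u (toℕ D)) (u (toℕ s))

  slack-nonneg : ∀ D s → IsVertex D s → 0ℚ ≤ℚ b -ℚ dot a (W M D s)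
  slack-nonneg D s v = diff-nonneg (valid (W M D s) (vertex∈Poly D s v))

  f-even : ∀ s → odd (toℕ s) ≡ false → 0ℚ ≤ℚ f s
  f-even s es = subst (0ℚ ≤ℚ_) (trans (cong (b -ℚ_) (dot-W s s))
      (solve 3 (λ b M s → b :- (M :* s :+ con 1ℚ :* s) := b :- (M :+ con 1ℚ) :* s) refl b M (dot a (u (toℕ s)))))
    (slack-nonneg s s (es , inj₁ refl))

  -- n W(D,s) is M times the simplex vertex n u_D plus the vertex n u_s, so n times the slack at
  -- W(D,s) splits in the same way.
  f-edge : ∀ D s → odd (toℕ D) ≡ true → odd (toℕ s) ≡ false → 0ℚ ≤ℚ M *ℚ f D +ℚ f s
  f-edge D s oD es = subst (0ℚ ≤ℚ_) (trans (cong (λ z → n *ℚ (b -ℚ z)) (dot-W D s))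
      (solve 4 (λ b M D s → (M :+ con 1ℚ) :* (b :- (M :* D :+ con 1ℚ :* s))
        := M :* (b :- (M :+ con 1ℚ) :* D) :+ (b :- (M :+ con 1ℚ) :* s)) refl b M (dot a (u (toℕ D))) (dot a (u (toℕ s)))))
    (*-nonneg (ℚ.<⇒≤ 0<n) (slack-nonneg D s (es , inj₂ oD)))

  least : Σ Vertex λ k → (odd (toℕ k) ≡ false) × (∀ i → odd (toℕ i) ≡ false → f k ≤ℚ f i)
  least = pick (argmin f (λ t → not (odd (toℕ t))))
    where
    pick : (∀ i → not (odd (toℕ i)) ≡ false) ⊎ (Σ Vertex λ k → (not (odd (toℕ k)) ≡ true) × (∀ i → not (odd (toℕ i)) ≡ true → f k ≤ℚ f i)) →
      Σ Vertex λ k → (odd (toℕ k) ≡ false) × (∀ i → odd (toℕ i) ≡ false → f k ≤ℚ f i)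
    pick (inj₁ none) = ⊥-elim (true≢false (none zero))
    pick (inj₂ (k , ek , min)) = k , trans (≡.sym (not-not (odd (toℕ k)))) (cong not ek) , λ i ei → min i (cong not ei)

  e : ℚ
  e = f (proj₁ least)

  0≤e : 0ℚ ≤ℚ e
  0≤e = f-even (proj₁ least) (proj₁ (proj₂ least))

  -- Indicators merge the two parity cases into one polynomial expression, so that `duality` can be
  -- checked term by term.
  h : Vertex → ℚ
  h t = M *ℚ f t -ℚ (ind (not (odd (toℕ t))) *ℚ (M *ℚ e) -ℚ ind (odd (toℕ t)) *ℚ e)

  -- For odd t the value is n times the slack at W(t,k), where k is the even vertex attaining the
  -- minimum e; for even t it is minimality of e.
  h-nonneg : ∀ t → 0ℚ ≤ℚ h t
  h-nonneg t = cases (odd (toℕ t)) refl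
    where
    cases : ∀ o → odd (toℕ t) ≡ o → 0ℚ ≤ℚ M *ℚ f t -ℚ (ind (not o) *ℚ (M *ℚ e) -ℚ ind o *ℚ e)
    cases true ot = subst (0ℚ ≤ℚ_)
      (solve 3 (λ M F e → M :* F :+ e := M :* F :- (con 0ℚ :* (M :* e) :- con 1ℚ :* e)) refl M (f t) e)
      (f-edge t (proj₁ least) ot (proj₁ (proj₂ least)))
    cases false et = subst (0ℚ ≤ℚ_)
      (solve 3 (λ M F e → M :* (F :- e) := M :* F :- (con 1ℚ :* (M :* e) :- con 0ℚ :* e)) refl M (f t) e)
      (*-nonneg (ℚ.<⇒≤ 0<M) (diff-nonneg (proj₂ (proj₂ least) t et)))

  slack-f : ∀ x → n *ℚ (b -ℚ dot a x) ≡ sumFin (λ t → gap n x t *ℚ f t)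
  slack-f x = begin
    n *ℚ (b -ℚ dot a x)
      ≡⟨ solve 3 (λ n b s → n :* (b :- s) := n :* b :- n :* s) refl n b (dot a x) ⟩
    n *ℚ b -ℚ n *ℚ dot a x
      ≡⟨ cong₂ _-ℚ_ (cong (_*ℚ b) (≡.sym (gap-sum n x))) (cong (n *ℚ_) (dot-expansion a n x)) ⟩
    sumFin (gap n x) *ℚ b -ℚ n *ℚ sumFin (λ t → gap n x t *ℚ A t)
      ≡⟨ cong₂ _-ℚ_ (sum-*ʳ (gap n x) b) (sum-*ˡ n (λ t → gap n x t *ℚ A t)) ⟨
    sumFin (λ t → gap n x t *ℚ b) -ℚ sumFin (λ t → n *ℚ (gap n x t *ℚ A t))
      ≡⟨ sum-sub (λ t → gap n x t *ℚ b) (λ t → n *ℚ (gap n x t *ℚ A t)) ⟨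
    sumFin (λ t → gap n x t *ℚ b -ℚ n *ℚ (gap n x t *ℚ A t))
      ≡⟨ sum-cong {suc (2 * m)} (λ t → solve 4 (λ y b n A → y :* b :- n :* (y :* A) := y :* (b :- n :* A)) refl
           (gap n x t) b n (A t)) ⟩
    sumFin (λ t → gap n x t *ℚ f t) ∎
    where
    A : Vertex → ℚ
    A t = dot a (u (toℕ t))

  -- Replacing M f by h takes M e off the even terms and adds e to the odd ones. The correction is M
  -- e E - e O, and E = n - O makes it e n (M - O).
  duality : ∀ x → M *ℚ n *ℚ (b -ℚ dot a x) ≡ sumFin (λ t → gap n x t *ℚ h t) +ℚ e *ℚ n *ℚ (M -ℚ oddSum n x)
  duality x = begin
    M *ℚ n *ℚ (b -ℚ dot a x)
      ≡⟨ ℚ.*-assoc M n (b -ℚ dot a x) ⟩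
    M *ℚ (n *ℚ (b -ℚ dot a x))
      ≡⟨ cong (M *ℚ_) (slack-f x) ⟩
    M *ℚ sumFin (λ t → y t *ℚ f t)
      ≡⟨ sum-*ˡ M (λ t → y t *ℚ f t) ⟨
    sumFin (λ t → M *ℚ (y t *ℚ f t))
      ≡⟨ sum-cong {suc (2 * m)} (λ t → solve 6 (λ M y F v o e →
           M :* (y :* F) := y :* (M :* F :- (v :* (M :* e) :- o :* e)) :+ (M :* e :* (v :* y) :- e :* (o :* y))) refl
           M (y t) (f t) (ev t) (od t) e) ⟩
    sumFin (λ t → y t *ℚ h t +ℚ (M *ℚ e *ℚ (ev t *ℚ y t) -ℚ e *ℚ (od t *ℚ y t)))
      ≡⟨ sum-+ (λ t → y t *ℚ h t) (λ t → M *ℚ e *ℚ (ev t *ℚ y t) -ℚ e *ℚ (od t *ℚ y t)) ⟩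
    H +ℚ sumFin (λ t → M *ℚ e *ℚ (ev t *ℚ y t) -ℚ e *ℚ (od t *ℚ y t))
      ≡⟨ cong (H +ℚ_) (trans (sum-sub (λ t → M *ℚ e *ℚ (ev t *ℚ y t)) (λ t → e *ℚ (od t *ℚ y t)))
           (cong₂ _-ℚ_ (sum-*ˡ (M *ℚ e) (λ t → ev t *ℚ y t)) (sum-*ˡ e (λ t → od t *ℚ y t)))) ⟩
    H +ℚ (M *ℚ e *ℚ evenSum n x -ℚ e *ℚ oddSum n x)
      ≡⟨ cong (λ E → H +ℚ (M *ℚ e *ℚ E -ℚ e *ℚ oddSum n x)) (evenSum≡ n x) ⟩
    H +ℚ (M *ℚ e *ℚ (n -ℚ oddSum n x) -ℚ e *ℚ oddSum n x)
      ≡⟨ cong (H +ℚ_) (solve 3 (λ M e O → M :* e :* (M :+ con 1ℚ :- O) :- e :* O := e :* (M :+ con 1ℚ) :* (M :- O)) refl M e (oddSum n x)) ⟩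
    H +ℚ e *ℚ n *ℚ (M -ℚ oddSum n x) ∎
    where
    y ev od : Vertex → ℚ
    y = gap n x
    ev t = ind (not (odd (toℕ t)))
    od t = ind (odd (toℕ t))
    H = sumFin (λ t → y t *ℚ h t)

  0<Mn : 0ℚ < M *ℚ n
  0<Mn = *-pos 0<M 0<n

  weights-nonneg : ∀ x → Poly x → ∀ t → 0ℚ ≤ℚ gap n x t *ℚ h t
  weights-nonneg x x∈Q t = *-nonneg (Poly-gap x x∈Q t) (h-nonneg t)

  alt-weight-nonneg : ∀ x → Poly x → 0ℚ ≤ℚ e *ℚ n *ℚ (M -ℚ oddSum n x)
  alt-weight-nonneg x x∈Q = *-nonneg (*-nonneg 0≤e (ℚ.<⇒≤ 0<n)) (Poly-alt x x∈Q)

  tight : ∀ x → Face Poly a b x → sumFin (λ t → gap n x t *ℚ h t) +ℚ e *ℚ n *ℚ (M -ℚ oddSum n x) ≡ 0ℚ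
  tight x (x∈Q , ax≡b) = trans (≡.sym (duality x)) (trans
    (cong (M *ℚ n *ℚ_) (trans (cong (b -ℚ_) ax≡b) (ℚ.+-inverseʳ b))) (ℚ.*-zeroʳ (M *ℚ n)))

  tight-gap : ∀ x → Face Poly a b x → ∀ t → 0ℚ < h t → gap n x t ≡ 0ℚ
  tight-gap x x∈F t 0<h = p*q≡0⇒q≡0 (0<⇒≢0 0<h) (trans (ℚ.*-comm (h t) (gap n x t))
    (sum≡0⇒≡0 {suc (2 * m)} (weights-nonneg x (proj₁ x∈F))
      (p+q≡0⇒p≡0 (sum-nonneg {suc (2 * m)} (weights-nonneg x (proj₁ x∈F))) (alt-weight-nonneg x (proj₁ x∈F)) (tight x x∈F)) t))

  tight-alt : ∀ x → Face Poly a b x → 0ℚ < e → M -ℚ oddSum n x ≡ 0ℚ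
  tight-alt x x∈F 0<e = p*q≡0⇒q≡0 (0<⇒≢0 (*-pos 0<e 0<n))
    (p+q≡0⇒q≡0 (sum-nonneg {suc (2 * m)} (weights-nonneg x (proj₁ x∈F))) (alt-weight-nonneg x (proj₁ x∈F)) (tight x x∈F))

  proportional : ∀ j κ → 0ℚ < κ → (∀ x → M *ℚ n *ℚ (b -ℚ dot a x) ≡ κ *ℚ slack m j x) → Proportional a b
  proportional j κ 0<κ eq = j , c , *-pos (proj₁ (proj₂ inv)) 0<κ ,
      affine-proportional a (ineqCoef m j) b (ineqRhs m j) c scaled
    where
    inv = recip 0<Mn
    c = proj₁ inv *ℚ κ
    scaled : ∀ x → b -ℚ dot a x ≡ c *ℚ slack m j x
    scaled x = begin
      b -ℚ dot a x                                   ≡⟨ ℚ.*-identityˡ (b -ℚ dot a x) ⟨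
      1ℚ *ℚ (b -ℚ dot a x)                           ≡⟨ cong (_*ℚ (b -ℚ dot a x)) (proj₂ (proj₂ inv)) ⟨
      proj₁ inv *ℚ (M *ℚ n) *ℚ (b -ℚ dot a x)        ≡⟨ ℚ.*-assoc (proj₁ inv) (M *ℚ n) (b -ℚ dot a x) ⟩
      proj₁ inv *ℚ (M *ℚ n *ℚ (b -ℚ dot a x))        ≡⟨ cong (proj₁ inv *ℚ_) (eq x) ⟩
      proj₁ inv *ℚ (κ *ℚ slack m j x)                ≡⟨ ℚ.*-assoc (proj₁ inv) κ (slack m j x) ⟨
      c *ℚ slack m j x                               ∎

  H-zero : (∀ t → h t ≡ 0ℚ) → ∀ x → sumFin (λ t → gap n x t *ℚ h t) ≡ 0ℚ
  H-zero h≡0 x = sum-zero {suc (2 * m)} (λ t → trans (cong (gap n x t *ℚ_) (h≡0 t)) (ℚ.*-zeroʳ (gap n x t)))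

  e-zero : e ≡ 0ℚ → ∀ (x : Pt (2 * m)) → e *ℚ n *ℚ (M -ℚ oddSum n x) ≡ 0ℚ
  e-zero e≡0 x = trans (cong (_*ℚ (M -ℚ oddSum n x)) (trans (cong (_*ℚ n) e≡0) (ℚ.*-zeroˡ n))) (ℚ.*-zeroˡ (M -ℚ oddSum n x))

  -- The two hyperplanes are told apart by the tree edge at t, which is on the alternating
  -- hyperplane but off gap t, and by the origin, which is off the alternating hyperplane.
  no-gap-and-alt : HasAffIndep (Face Poly a b) (2 * m) → 0ℚ < e → ∀ t → ¬ 0ℚ < h t
  no-gap-and-alt (p , p∈F , indep) 0<e t 0<h = ¬AffIndep-two-hyperplanes (gap-affine t) alt-affine
    (edgePt t) origin (edgePt-gap≢0 t) (edgePt-alt t) alt-origin≢0 p indep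
    (λ i → tight-gap (p i) (p∈F i) t 0<h) (λ i → tight-alt (p i) (p∈F i) 0<e)

  -- The witnesses are the simplex vertices n u_s and n u_t. For an odd index such a vertex has been
  -- cut off, but it still distinguishes the two hyperplanes.
  no-two-gaps : HasAffIndep (Face Poly a b) (2 * m) → ∀ s t → t ≢ s → 0ℚ < h s → ¬ 0ℚ < h t
  no-two-gaps (p , p∈F , indep) s t t≢s 0<hs 0<ht = ¬AffIndep-two-hyperplanes (gap-affine s) (gap-affine t)
    (W M s s) (W M t t) (gap-W-D≢0 s s) (gap-W-off M s s t t≢s t≢s) (gap-W-D≢0 t t) p indep
    (λ i → tight-gap (p i) (p∈F i) s 0<hs) (λ i → tight-gap (p i) (p∈F i) t 0<ht)

  ¬0<h⇒h≡0 : ∀ t → ¬ 0ℚ < h t → h t ≡ 0ℚ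
  ¬0<h⇒h≡0 t ¬0<h = ℚ.≤-antisym (ℚ.≮⇒≥ ¬0<h) (h-nonneg t)

  module _ (points : HasAffIndep (Face Poly a b) (2 * m)) (¬more : ¬ HasAffIndep (Face Poly a b) (suc (2 * m))) where

    alt-case : 0ℚ < e → Proportional a b
    alt-case 0<e = proportional alt (e *ℚ n) (*-pos 0<e 0<n) (λ x → trans (duality x) (trans
      (cong₂ _+ℚ_ (H-zero (λ t → ¬0<h⇒h≡0 t (no-gap-and-alt points 0<e t)) x) (cong (e *ℚ n *ℚ_) (≡.sym (slack-alt x))))
      (ℚ.+-identityˡ (e *ℚ n *ℚ slack m alt x))))

    gap-case : e ≡ 0ℚ → ∀ t → 0ℚ < h t → Proportional a b
    gap-case e≡0 t 0<h = proportional (proj₁ (gap-slack t)) (h t) 0<h (λ x → begin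
      M *ℚ n *ℚ (b -ℚ dot a x)
        ≡⟨ duality x ⟩
      sumFin (λ s → gap n x s *ℚ h s) +ℚ e *ℚ n *ℚ (M -ℚ oddSum n x)
        ≡⟨ cong₂ _+ℚ_ (sum-single (λ s → gap n x s *ℚ h s) t (λ s s≢t →
             trans (cong (gap n x s *ℚ_) (¬0<h⇒h≡0 s (no-two-gaps points t s s≢t 0<h))) (ℚ.*-zeroʳ (gap n x s))))
             (e-zero e≡0 x) ⟩
      gap n x t *ℚ h t +ℚ 0ℚ
        ≡⟨ solve 2 (λ y h → y :* h :+ con 0ℚ := h :* y) refl (gap n x t) (h t) ⟩
      h t *ℚ gap n x t
        ≡⟨ cong (h t *ℚ_) (proj₂ (gap-slack t) x) ⟨
      h t *ℚ slack m (proj₁ (gap-slack t)) x ∎)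

    -- With all multipliers zero the inequality is an identity, so its face is the whole polytope
    -- and contains 2m + 1 affinely independent points.
    trivial-case : e ≡ 0ℚ → (∀ t → h t ≡ 0ℚ) → ⊥
    trivial-case e≡0 h≡0 = ¬more (proj₁ Poly-points , (λ i → proj₁ (proj₂ Poly-points) i , on-face (proj₁ Poly-points i)) ,
        proj₂ (proj₂ Poly-points))
      where
      on-face : ∀ x → dot a x ≡ b
      on-face x = ≡.sym (diff≡0 (p*q≡0⇒q≡0 (0<⇒≢0 0<Mn)
        (trans (duality x) (cong₂ _+ℚ_ (H-zero h≡0 x) (e-zero e≡0 x)))))

    facet⇒proportional : Proportional a b
    facet⇒proportional = on-e (0≤⇒≡0⊎0< 0≤e)
      where
      on-h : e ≡ 0ℚ → Dec (Σ Vertex λ t → 0ℚ < h t) → Proportional a b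
      on-h e≡0 (yes (t , 0<h)) = gap-case e≡0 t 0<h
      on-h e≡0 (no none) = ⊥-elim (trivial-case e≡0 (λ t → ¬0<h⇒h≡0 t (λ 0<h → none (t , 0<h))))
      on-e : e ≡ 0ℚ ⊎ 0ℚ < e → Proportional a b
      on-e (inj₂ 0<e) = alt-case 0<e
      on-e (inj₁ e≡0) = on-h e≡0 (Fin.any? (λ t → 0ℚ ℚ.<? h t))

module _ (m : ℕ) (1≤m : 1 ≤ m) where

  open Slacks m 1≤m using (Poly)
  open Facets m 1≤m

  facet⇔proportional : ∀ a b → IsFacetIneq Poly a b ⇔ Proportional a b
  facet⇔proportional a b = mk⇔ to (proportional⇒facet a b)
    where
    to : IsFacetIneq Poly a b → Proportional a b
    to (valid , r , dimQ , dimF) = FacetNecessity.facet⇒proportional m 1≤m a b valid (proj₁ dims) (proj₂ dims)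
      where
      dims : HasAffIndep (Face Poly a b) (2 * m) × ¬ HasAffIndep (Face Poly a b) (suc (2 * m))
      dims = subst (λ k → HasAffIndep (Face Poly a b) k × ¬ HasAffIndep (Face Poly a b) (suc k))
        (AffDim-unique {S = Poly} dimQ Poly-dim) dimF

-- Extreme points

-- Half of the first positive weight is split off, so that the rest keeps positive mass.
cone-split : Cone P T ξ → 0ℚ < T → Σ (Pt _) λ p → P p × Σ ℚ λ c →
  0ℚ < c × 0ℚ < T -ℚ c × Cone P (T -ℚ c) (λ i → ξ i -ℚ c *ℚ p i)
cone-split (nil _) 0<T = ⊥-elim (ℚ.<-irrefl refl 0<T)
cone-split {P = P} {T = T′} {ξ = x′} (cons {w} {T} {p = p} {x} 0≤w p∈P C e h) 0<T′ = split (0≤⇒≡0⊎0< 0≤w)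
  where
  split : w ≡ 0ℚ ⊎ 0ℚ < w → Σ (Pt _) λ p → P p × Σ ℚ λ c →
    0ℚ < c × 0ℚ < T′ -ℚ c × Cone P (T′ -ℚ c) (λ i → x′ i -ℚ c *ℚ p i)
  split (inj₁ w≡0) = later (cone-split C (subst (0ℚ <_) T′≡T 0<T′))
    where
    T′≡T : T′ ≡ T
    T′≡T = trans e (trans (cong (_+ℚ T) w≡0) (ℚ.+-identityˡ T))
    x≡x′ : ∀ i → x i ≡ x′ i
    x≡x′ i = ≡.sym (trans (h i) (trans (cong (λ w → w *ℚ p i +ℚ x i) w≡0)
      (solve 2 (λ p x → con 0ℚ :* p :+ x := x) refl (p i) (x i))))
    later : (Σ (Pt _) λ p → P p × Σ ℚ λ c → 0ℚ < c × 0ℚ < T -ℚ c × Cone P (T -ℚ c) (λ i → x i -ℚ c *ℚ p i)) →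
      Σ (Pt _) λ p → P p × Σ ℚ λ c → 0ℚ < c × 0ℚ < T′ -ℚ c × Cone P (T′ -ℚ c) (λ i → x′ i -ℚ c *ℚ p i)
    later (p , p∈P , c , 0<c , 0<T-c , D) = p , p∈P , c , 0<c , subst (λ T → 0ℚ < T -ℚ c) (≡.sym T′≡T) 0<T-c ,
      cone-cong (cong (_-ℚ c) (≡.sym T′≡T)) (λ i → cong (_-ℚ c *ℚ p i) (x≡x′ i)) D
  split (inj₂ 0<w) = p , p∈P , c , 0<c , subst (0ℚ <_) (≡.sym rest) (+-pos-nonneg 0<c (cone-mass-nonneg C)) ,
      cons (ℚ.<⇒≤ 0<c) p∈P C rest
        (λ i → trans (cong (_-ℚ c *ℚ p i) (h i))
          (solve 3 (λ w p x → w :* p :+ x :- con ½ :* w :* p := con ½ :* w :* p :+ x) refl w (p i) (x i)))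
    where
    c = ½ *ℚ w
    0<c : 0ℚ < c
    0<c = *-pos (ℚ.positive⁻¹ ½) 0<w
    rest : T′ -ℚ c ≡ c +ℚ T
    rest = trans (cong (_-ℚ c) e) (solve 2 (λ w T → w :+ T :- con ½ :* w := con ½ :* w :+ T) refl w T)

affine-segment : {F : Pt d → ℚ} → Affine F → (x y z : Pt d) (t : ℚ) →
  (∀ i → x i ≡ t *ℚ y i +ℚ (1ℚ -ℚ t) *ℚ z i) → F x ≡ t *ℚ F y +ℚ (1ℚ -ℚ t) *ℚ F z
affine-segment {F = F} (a , b , h) x y z t x≡ = begin
  F x
    ≡⟨ h x ⟩
  b -ℚ dot a x
    ≡⟨ cong (b -ℚ_) (trans (dot-congʳ a x≡) (dot-linear a t (1ℚ -ℚ t) y z)) ⟩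
  b -ℚ (t *ℚ dot a y +ℚ (1ℚ -ℚ t) *ℚ dot a z)
    ≡⟨ solve 4 (λ b t y z → b :- (t :* y :+ (con 1ℚ :- t) :* z) := t :* (b :- y) :+ (con 1ℚ :- t) :* (b :- z)) refl
         b t (dot a y) (dot a z) ⟩
  t *ℚ (b -ℚ dot a y) +ℚ (1ℚ -ℚ t) *ℚ (b -ℚ dot a z)
    ≡⟨ cong₂ (λ p q → t *ℚ p +ℚ (1ℚ -ℚ t) *ℚ q) (≡.sym (h y)) (≡.sym (h z)) ⟩
  t *ℚ F y +ℚ (1ℚ -ℚ t) *ℚ F z ∎
  where open ≡-Reasoning

module Extreme (m : ℕ) (1≤m : 1 ≤ m) where

  open Slacks m 1≤m
  open ≡-Reasoning

  vertexPt∈Poly : ∀ p → VertexPt M p → Poly p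
  vertexPt∈Poly p v = cone⇒Poly (cone-point (vertex∈Graphic p v))

  -- Splitting a vertex p off a convex combination of vertices and rescaling the rest to z puts x
  -- strictly between p and z. Extremality gives p = z, hence x = p.
  extreme⇒vertex : ∀ x → IsExtreme Poly x → VertexPt M x
  extreme⇒vertex x (x∈Q , ext) = from-split (cone-split (slack⇒vertexCone x (Poly-slack x x∈Q)) (ℚ.positive⁻¹ 1ℚ))
    where
    from-split : (Σ (Pt (2 * m)) λ p → VertexPt M p × Σ ℚ λ c →
      0ℚ < c × 0ℚ < 1ℚ -ℚ c × Cone (VertexPt M) (1ℚ -ℚ c) (λ i → x i -ℚ c *ℚ p i)) → VertexPt M x
    from-split (p , vp , c , 0<c , 0<1-c , C) =
        proj₁ vp , proj₁ (proj₂ vp) , proj₁ (proj₂ (proj₂ vp)) , λ i → trans (x≐p i) (proj₂ (proj₂ (proj₂ vp)) i)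
      where
      inv = recip 0<1-c
      r = proj₁ inv
      z : Pt (2 * m)
      z i = r *ℚ (x i -ℚ c *ℚ p i)
      z∈Q : Poly z
      z∈Q = cone⇒Poly (cone-concat (λ p v → cone-point (vertex∈Graphic p v))
        (cone-cong (proj₂ (proj₂ inv)) (λ _ → refl) (cone-scale r (ℚ.<⇒≤ (proj₁ (proj₂ inv))) C)))
      x≡ : ∀ i → x i ≡ c *ℚ p i +ℚ (1ℚ -ℚ c) *ℚ z i
      x≡ i = begin
        x i                                                        ≡⟨ solve 3 (λ x c p → x := c :* p :+ con 1ℚ :* (x :- c :* p)) refl (x i) c (p i) ⟩
        c *ℚ p i +ℚ 1ℚ *ℚ (x i -ℚ c *ℚ p i)                        ≡⟨ cong (λ s → c *ℚ p i +ℚ s *ℚ (x i -ℚ c *ℚ p i)) (proj₂ (proj₂ inv)) ⟨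
        c *ℚ p i +ℚ r *ℚ (1ℚ -ℚ c) *ℚ (x i -ℚ c *ℚ p i)            ≡⟨ solve 4 (λ q r s t → q :+ r :* s :* t := q :+ s :* (r :* t)) refl (c *ℚ p i) r (1ℚ -ℚ c) (x i -ℚ c *ℚ p i) ⟩
        c *ℚ p i +ℚ (1ℚ -ℚ c) *ℚ z i                               ∎
      c<1 : c < 1ℚ
      c<1 = ≡.subst₂ _<_ (ℚ.+-identityˡ c) (sub-add 1ℚ c) (ℚ.+-monoˡ-< c 0<1-c)
      p≐z : p ≐ z
      p≐z = ext p z c (vertexPt∈Poly p vp) z∈Q 0<c c<1 x≡
      x≐p : x ≐ p
      x≐p i = trans (x≡ i) (trans (cong (λ s → c *ℚ p i +ℚ (1ℚ -ℚ c) *ℚ s) (≡.sym (p≐z i)))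
        (solve 2 (λ c p → c :* p :+ (con 1ℚ :- c) :* p := p) refl c (p i)))

  -- The tight inequalities pin the point down. If D = s, a single gap is left and must be n.
  -- Otherwise the odd sum M sits entirely in gap D, which leaves n - M = 1 for gap s.
  determined : ∀ D s → IsVertex D s → ∀ p → (∀ t → t ≢ D → t ≢ s → gap n p t ≡ 0ℚ) →
    (odd (toℕ D) ≡ true → M -ℚ oddSum n p ≡ 0ℚ) → ∀ t → gap n p t ≡ gap {2 * m} n (W M D s) t
  determined D s (es , inj₁ refl) p off _ t = cases (t Fin.≟ s)
    where
    cases : Dec (t ≡ s) → gap n p t ≡ gap {2 * m} n (W M s s) t
    cases (yes refl) = trans (≡.sym (sum-single (gap n p) t (λ t′ t′≢t → off t′ t′≢t t′≢t)))
      (trans (gap-sum n p) (≡.sym (gap-W-≡ M t)))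
    cases (no t≢s) = trans (off t t≢s t≢s) (≡.sym (gap-W-off M s s t t≢s t≢s))
  determined D s (es , inj₂ oD) p off alt≡0 t = cases (t Fin.≟ D) (t Fin.≟ s)
    where
    oddSum≡M : oddSum n p ≡ M
    oddSum≡M = ≡.sym (diff≡0 (alt≡0 oD))
    D≢s : D ≢ s
    D≢s = odd≢even {D = D} {s = s} oD es
    cases : Dec (t ≡ D) → Dec (t ≡ s) → gap n p t ≡ gap {2 * m} n (W M D s) t
    cases (yes refl) _ = trans (≡.sym (oddSum-edge n p D s oD es off)) (trans oddSum≡M (≡.sym (gap-W-D M D s D≢s)))
    cases (no _) (yes refl) = begin
      gap n p s                 ≡⟨ evenSum-edge n p D s oD es off ⟨
      evenSum n p               ≡⟨ evenSum≡ n p ⟩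
      n -ℚ oddSum n p           ≡⟨ cong (n -ℚ_) oddSum≡M ⟩
      n -ℚ M                    ≡⟨ solve 1 (λ M → M :+ con 1ℚ :- M := con 1ℚ) refl M ⟩
      1ℚ                        ≡⟨ gap-W-s M D s D≢s ⟨
      gap n (W M D s) s         ∎
    cases (no t≢D) (no t≢s) = trans (off t t≢D t≢s) (≡.sym (gap-W-off M D s t t≢D t≢s))

  -- An affine function that is nonnegative on the polytope and zero inside a segment is zero at
  -- both ends. So `y` and `z` inherit every tight inequality of `x`, and `determined` gives them
  -- equal gaps.
  vertex⇒extreme : ∀ x → VertexPt M x → IsExtreme Poly x
  vertex⇒extreme x vx@(D , s , v , x≐) = vertexPt∈Poly x vx , unique
    where
    unique : ∀ y z t → Poly y → Poly z → 0ℚ < t → t < 1ℚ → (∀ i → x i ≡ t *ℚ y i +ℚ (1ℚ -ℚ t) *ℚ z i) → y ≐ z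
    unique y z t y∈Q z∈Q 0<t t<1 x≡ = gap-injective n y z (λ τ → trans (fixed y (λ F → proj₁ F) τ) (≡.sym (fixed z (λ F → proj₂ F) τ)))
      where
      tight : {F : Pt (2 * m) → ℚ} → Affine F → (∀ w → Poly w → 0ℚ ≤ℚ F w) → F x ≡ 0ℚ → F y ≡ 0ℚ × F z ≡ 0ℚ
      tight {F} aff F≥0 Fx≡0 =
          p*q≡0⇒q≡0 (0<⇒≢0 0<t) (p+q≡0⇒p≡0 tFy≥0 tFz≥0 sum≡0) ,
          p*q≡0⇒q≡0 (0<⇒≢0 (diff-pos t<1)) (p+q≡0⇒q≡0 tFy≥0 tFz≥0 sum≡0)
        where
        tFy≥0 : 0ℚ ≤ℚ t *ℚ F y
        tFy≥0 = *-nonneg (ℚ.<⇒≤ 0<t) (F≥0 y y∈Q)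
        tFz≥0 : 0ℚ ≤ℚ (1ℚ -ℚ t) *ℚ F z
        tFz≥0 = *-nonneg (ℚ.<⇒≤ (diff-pos t<1)) (F≥0 z z∈Q)
        sum≡0 : t *ℚ F y +ℚ (1ℚ -ℚ t) *ℚ F z ≡ 0ℚ
        sum≡0 = trans (≡.sym (affine-segment aff x y z t x≡)) Fx≡0
      -- `pick` is one of the two projections, so that a single argument serves both ends of the
      -- segment.
      fixed : ∀ w → ({F : Pt (2 * m) → ℚ} → F y ≡ 0ℚ × F z ≡ 0ℚ → F w ≡ 0ℚ) → ∀ τ → gap n w τ ≡ gap {2 * m} n (W M D s) τ
      fixed w pick = determined D s v w
        (λ τ τ≢D τ≢s → pick {λ x → gap n x τ} (tight (gap-affine τ) (λ w w∈Q → Poly-gap w w∈Q τ)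
          (trans (gap-cong n x≐ τ) (gap-W-off M D s τ τ≢D τ≢s))))
        (λ oD → pick {λ x → M -ℚ oddSum n x} (tight alt-affine Poly-alt
          (trans (cong (M -ℚ_) (trans (sum-cong {suc (2 * m)} (λ τ → cong (ind (odd (toℕ τ)) *ℚ_) (gap-cong n x≐ τ)))
            (oddSum-W M D s oD (proj₁ v)))) (ℚ.+-inverseʳ M))))

-- Matching the vertices of the truncated simplex with the listed points

ind-below : (M : ℚ) (N : ℕ) → ℕ→ℚ (suc N) ≡ M +ℚ 1ℚ → ∀ a b → (Bool.T b → Bool.T a) →
  M *ℚ ind a +ℚ 1ℚ *ℚ ind b ≡ (if b then ℕ→ℚ (suc N) else (if a then M else 0ℚ))
ind-below M N n≡ true true h = trans (solve 1 (λ M → M :* con 1ℚ :+ con 1ℚ :* con 1ℚ := M :+ con 1ℚ) refl M) (≡.sym n≡)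
ind-below M N n≡ true false h = solve 1 (λ M → M :* con 1ℚ :+ con 1ℚ :* con 0ℚ := M) refl M
ind-below M N n≡ false true h = ⊥-elim (h tt)
ind-below M N n≡ false false h = solve 1 (λ M → M :* con 0ℚ :+ con 1ℚ :* con 0ℚ := con 0ℚ) refl M

ind-above : (M : ℚ) (N : ℕ) → ℕ→ℚ (suc N) ≡ M +ℚ 1ℚ → ∀ a b → (Bool.T a → Bool.T b) →
  M *ℚ ind a +ℚ 1ℚ *ℚ ind b ≡ (if a then ℕ→ℚ (suc N) else (if b then 1ℚ else 0ℚ))
ind-above M N n≡ true true h = trans (solve 1 (λ M → M :* con 1ℚ :+ con 1ℚ :* con 1ℚ := M :+ con 1ℚ) refl M) (≡.sym n≡)
ind-above M N n≡ true false h = ⊥-elim (h tt)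
ind-above M N n≡ false true h = solve 1 (λ M → M :* con 0ℚ :+ con 1ℚ :* con 1ℚ := con 1ℚ) refl M
ind-above M N n≡ false false h = solve 1 (λ M → M :* con 0ℚ :+ con 1ℚ :* con 0ℚ := con 0ℚ) refl M

T-<ᵇ-mono : ∀ {a b} i → a ≤ b → Bool.T (i ℕ.<ᵇ a) → Bool.T (i ℕ.<ᵇ b)
T-<ᵇ-mono {a} i a≤b h = ℕ.<⇒<ᵇ (ℕ.<-≤-trans (ℕ.<ᵇ⇒< i a h) a≤b)

module Listing (m : ℕ) where

  M : ℚ
  M = ℕ→ℚ (2 * m)

  W-ptA : ∀ k (s : Fin (suc (2 * m))) → toℕ s ≡ 2 * k → W M s s ≐ ptA m k
  W-ptA k s s≡ i = trans (cong (λ t → M *ℚ ind (toℕ i ℕ.<ᵇ t) +ℚ 1ℚ *ℚ ind (toℕ i ℕ.<ᵇ t)) s≡) (both (toℕ i ℕ.<ᵇ 2 * k))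
    where
    both : ∀ b → M *ℚ ind b +ℚ 1ℚ *ℚ ind b ≡ (if b then ℕ→ℚ (suc (2 * m)) else 0ℚ)
    both true = ind-below M (2 * m) (ℕ→ℚ-suc (2 * m)) true true (λ _ → tt)
    both false = ind-below M (2 * m) (ℕ→ℚ-suc (2 * m)) false false (λ ())

  W-ptB : ∀ k l (D s : Fin (suc (2 * m))) → toℕ D ≡ 2 * k + 2 * l + 1 → toℕ s ≡ 2 * k → W M D s ≐ ptB m k l
  W-ptB k l D s D≡ s≡ i = trans (cong₂ (λ D s → M *ℚ ind (toℕ i ℕ.<ᵇ D) +ℚ 1ℚ *ℚ ind (toℕ i ℕ.<ᵇ s)) D≡ s≡)
    (ind-below M (2 * m) (ℕ→ℚ-suc (2 * m)) (toℕ i ℕ.<ᵇ 2 * k + 2 * l + 1) (toℕ i ℕ.<ᵇ 2 * k)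
      (T-<ᵇ-mono (toℕ i) (ℕ.≤-trans (ℕ.m≤m+n (2 * k) (2 * l)) (ℕ.m≤m+n (2 * k + 2 * l) 1))))

  W-ptC : ∀ k l (D s : Fin (suc (2 * m))) → toℕ D ≡ 2 * k + 1 → toℕ s ≡ 2 * k + 2 * l + 2 → W M D s ≐ ptC m k l
  W-ptC k l D s D≡ s≡ i = trans (cong₂ (λ D s → M *ℚ ind (toℕ i ℕ.<ᵇ D) +ℚ 1ℚ *ℚ ind (toℕ i ℕ.<ᵇ s)) D≡ s≡)
    (ind-above M (2 * m) (ℕ→ℚ-suc (2 * m)) (toℕ i ℕ.<ᵇ 2 * k + 1) (toℕ i ℕ.<ᵇ 2 * k + 2 * l + 2)
      (T-<ᵇ-mono (toℕ i) (ℕ.+-mono-≤ (ℕ.m≤m+n (2 * k) (2 * l)) (s≤s z≤n))))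

  module S = Data.Nat.Solver.+-*-Solver

  top-≡ : ∀ k l → 2 * k + 2 * l + 2 ≡ 2 * suc (k + l)
  top-≡ = S.solve 2 (λ k l → S.con 2 S.:* k S.:+ S.con 2 S.:* l S.:+ S.con 2 S.:= S.con 2 S.:* (S.con 1 S.:+ (k S.:+ l))) refl

  odd-≡ : ∀ k l → 2 * k + 2 * l + 1 ≡ suc ((k + l) + (k + l))
  odd-≡ = S.solve 2 (λ k l → S.con 2 S.:* k S.:+ S.con 2 S.:* l S.:+ S.con 1 S.:= S.con 1 S.:+ (k S.:+ l S.:+ (k S.:+ l))) refl

  odd-≡₀ : ∀ k → 2 * k + 1 ≡ suc (k + k)
  odd-≡₀ = S.solve 1 (λ k → S.con 2 S.:* k S.:+ S.con 1 S.:= S.con 1 S.:+ (k S.:+ k)) refl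

  index : ∀ k → k ≤ 2 * m → Σ (Fin (suc (2 * m))) λ t → toℕ t ≡ k
  index k k≤ = Fin.fromℕ< (s≤s k≤) , Fin.toℕ-fromℕ< (s≤s k≤)

  odd-2*k : ∀ {t} k → t ≡ 2 * k → odd t ≡ false
  odd-2*k k refl = trans (cong odd (≡.sym (k+k≡2*k k))) (odd-double k)

  odd-suc-double : ∀ {t} k → t ≡ suc (k + k) → odd t ≡ true
  odd-suc-double k refl = cong not (odd-double k)

  bounds : ∀ k l → suc (k + l) ≤ m → 2 * k + 2 * l + 2 ≤ 2 * m
  bounds k l h = subst (_≤ 2 * m) (≡.sym (top-≡ k l)) (ℕ.*-monoʳ-≤ 2 h)

  listed⇒vertex : ∀ x → Listed m x → VertexPt M x
  listed⇒vertex x (inj₁ (k , k≤m , x≐)) = proj₁ s , proj₁ s , (odd-2*k k (proj₂ s) , inj₁ refl) ,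
      λ i → trans (x≐ i) (≡.sym (W-ptA k (proj₁ s) (proj₂ s) i))
    where s = index (2 * k) (ℕ.*-monoʳ-≤ 2 k≤m)
  listed⇒vertex x (inj₂ (inj₁ (k , l , h , x≐))) = proj₁ D , proj₁ s ,
      (odd-2*k k (proj₂ s) , inj₂ (odd-suc-double (k + l) (trans (proj₂ D) (odd-≡ k l)))) ,
      λ i → trans (x≐ i) (≡.sym (W-ptB k l (proj₁ D) (proj₁ s) (proj₂ D) (proj₂ s) i))
    where
    D = index (2 * k + 2 * l + 1) (ℕ.≤-trans (ℕ.+-monoʳ-≤ (2 * k + 2 * l) (s≤s z≤n)) (bounds k l h))
    s = index (2 * k) (ℕ.≤-trans (ℕ.≤-trans (ℕ.m≤m+n (2 * k) (2 * l)) (ℕ.m≤m+n (2 * k + 2 * l) 2)) (bounds k l h))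
  listed⇒vertex x (inj₂ (inj₂ (k , l , h , x≐))) = proj₁ D , proj₁ s ,
      (odd-2*k (suc (k + l)) (trans (proj₂ s) (top-≡ k l)) , inj₂ (odd-suc-double k (trans (proj₂ D) (odd-≡₀ k)))) ,
      λ i → trans (x≐ i) (≡.sym (W-ptC k l (proj₁ D) (proj₁ s) (proj₂ D) (proj₂ s) i))
    where
    D = index (2 * k + 1) (ℕ.≤-trans (ℕ.+-mono-≤ (ℕ.m≤m+n (2 * k) (2 * l)) (s≤s z≤n)) (bounds k l h))
    s = index (2 * k + 2 * l + 2) (bounds k l h)

  -- Put s = 2q and D = 2r + 1. If s lies below D, the coordinates between them equal M and the
  -- point is b^(q, r-q). If s lies above D, they equal 1 and the point is c^(r, q-r-1).
  vertex⇒listed : ∀ x → VertexPt M x → Listed m x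
  vertex⇒listed x (D , s , (es , inj₁ refl) , x≐) = from (even-half (toℕ s) es)
    where
    from : Σ ℕ (λ k → toℕ s ≡ k + k) → Listed m x
    from (k , s≡) = inj₁ (k , half-≤ (subst (_≤ 2 * m) s≡ (ℕ.s≤s⁻¹ (Fin.toℕ<n s))) ,
      λ i → trans (x≐ i) (W-ptA k s (trans s≡ (k+k≡2*k k)) i))
  vertex⇒listed x (D , s , (es , inj₂ oD) , x≐) = from (even-half (toℕ s) es) (odd-half (toℕ D) oD)
    where
    from : Σ ℕ (λ q → toℕ s ≡ q + q) → Σ ℕ (λ r → toℕ D ≡ suc (r + r)) → Listed m x
    from (q , s≡) (r , D≡) = compare (ℕ.≤-<-connex q r)
      where
      r<m : suc r ≤ m
      r<m = half-< (subst (_≤ 2 * m) D≡ (ℕ.s≤s⁻¹ (Fin.toℕ<n D)))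
      q≤m : q ≤ m
      q≤m = half-≤ (subst (_≤ 2 * m) s≡ (ℕ.s≤s⁻¹ (Fin.toℕ<n s)))
      compare : q ≤ r ⊎ r ℕ.< q → Listed m x
      compare (inj₁ q≤r) = inj₂ (inj₁ (q , r ℕ.∸ q , subst (λ t → suc t ≤ m) (≡.sym r≡) r<m , λ i → trans (x≐ i)
        (W-ptB q (r ℕ.∸ q) D s (trans D≡ (≡.sym (trans (odd-≡ q (r ℕ.∸ q)) (cong (λ t → suc (t + t)) r≡)))) (trans s≡ (k+k≡2*k q)) i)))
        where
        r≡ : q + (r ℕ.∸ q) ≡ r
        r≡ = ℕ.m+[n∸m]≡n q≤r
      compare (inj₂ r<q) = inj₂ (inj₂ (r , q ℕ.∸ suc r , subst (_≤ m) (≡.sym q≡) q≤m , λ i → trans (x≐ i)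
        (W-ptC r (q ℕ.∸ suc r) D s (trans D≡ (≡.sym (odd-≡₀ r)))
          (trans s≡ (trans (k+k≡2*k q) (≡.sym (trans (top-≡ r (q ℕ.∸ suc r)) (cong (2 *_) q≡))))) i)))
        where
        q≡ : suc (r + (q ℕ.∸ suc r)) ≡ q
        q≡ = ℕ.m+[n∸m]≡n r<q

extreme⇔listed : ∀ m x → IsExtreme (Q (suc (2 * m))) x ⇔ Listed m x
-- For n = 1 the space has dimension 0: its only point is a^(0), and the one-vertex graph realizes
-- it.
extreme⇔listed zero x = mk⇔ (λ _ → inj₁ (0 , z≤n , λ ())) (λ _ → x∈Q , λ _ _ _ _ _ _ _ _ ())
  where
  K₁ : Graph 1
  K₁ = record { adj = λ _ _ → false ; sym = λ _ _ → refl ; irrefl = λ _ → refl }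
  x∈Q : Q 1 x
  x∈Q = 1 , (λ _ → 1ℚ) , (λ _ → K₁) , (λ _ → ℚ.nonNegative⁻¹ 1ℚ) , refl , λ ()
extreme⇔listed m@(suc _) x = mk⇔
  (λ ext → Listing.vertex⇒listed m x (Extreme.extreme⇒vertex m (s≤s z≤n) x ext))
  (λ l → Extreme.vertex⇒extreme m (s≤s z≤n) x (Listing.listed⇒vertex m x l))

-- The facet equivalence sits under 1 ≤ m: for m = 0 the polytope is a single point without facets,
-- while the listed inequalities still exist in degenerate form. The extreme points are described
-- for every m.
theorem2p2 : (m : ℕ) →
    (1 ≤ m →
    ((∀ x → Q (suc (2 * m)) x ⇔ (∀ j → dot (ineqCoef m j) x ≤ℚ ineqRhs m j))
    × (∀ a b → IsFacetIneq (Q (suc (2 * m))) a b ⇔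
    (Σ (IneqIx m) λ j → Σ ℚ λ c → (0ℚ < c)
    × (∀ i → a i ≡ c *ℚ ineqCoef m j i) × (b ≡ c *ℚ ineqRhs m j)))))
    × (∀ x → IsExtreme (Q (suc (2 * m))) x ⇔ Listed m x)
theorem2p2 m = (λ 1≤m → Slacks.Poly⇔inequalities m 1≤m , facet⇔proportional m 1≤m) , extreme⇔listed m
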